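{- All Schubert matroids are Ehrhart positive: if $\mathsf{M}$ is a Schubert matroid, then all coefficients of the Ehrhart polynomial $\operatorname{ehr}(\mathscr{P}(\mathsf{M}),t)$ of its base polytope are nonnegative.
   Context: Lattice paths: for $0\le k\le n$, consider lattice paths from $(0,0)$ to $(n-k,k)$ with exactly $n$ steps, each equal to $+(1,0)$ (East, E) or $+(0,1)$ (North, N). For such a path $P$, let $s(P)\subseteq[n]$ be the set of positions of its north steps. A path $L$ lies below a path $U$ (equivalently $U$ lies above $L$) if $|s(L)\cap[m]|\le |s(U)\cap[m]|$ for every $m=1,\dots,n$. If $L$ lies below $U$, then $\{s(P): P \text{ lies above } L \text{ and below } U\}$ is the set of bases of a matroid $\mathsf{M}[L,U]$ of rank $k$ on $[n]$ (a lattice path matroid). Schubert matroid: write $\mathsf{M}[U]:=\mathsf{M}[L,U]$ where $L=\mathrm{E}\cdots\mathrm{E}\mathrm{N}\cdots\mathrm{N}$ ($n-k$ east steps followed by $k$ north steps). A matroid is a Schubert matroid if and only if it is isomorphic to a matroid of the form $\mathsf{M}[U]$. Base polytope: $\mathscr{P}(\mathsf{M})\subset\mathbb{R}^n$ is the convex hull of the indicator vectors of the bases of $\mathsf{M}$. The Ehrhart polynomial $\operatorname{ehr}(P,t)$ of a lattice polytope $P$ is the unique polynomial with $\operatorname{ehr}(P,m)=|mP\cap\mathbb{Z}^n|$ for all integers $m\ge0$. -}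

module Defs where

open import Level using (0ℓ)
open import Data.Bool.Base using (if_then_else_)
open import Data.Fin.Base using (Fin; toℕ)
open import Data.Fin.Permutation using (Permutation; _⟨$⟩ˡ_)
open import Data.Fin.Subset using (Subset; Side; inside; outside; _∈_; _∉_; _∪_; _∩_; _-_; ⁅_⁆; ∣_∣)
open import Data.Integer.Base using (ℤ; +_)
open import Data.List.Base using (List; length; foldr)
import Data.List.Membership.Propositional as List
open import Data.List.Relation.Unary.All using (All)
open import Data.List.Relation.Unary.Unique.Propositional using (Unique)
open import Data.Nat.Base as ℕ using (ℕ; zero; suc; _∸_)
import Data.Nat.Properties as ℕ
open import Data.Product.Base using (Σ; ∃; _×_; _,_; proj₁; proj₂; map₁; map₂)
open import Data.Rational.Base as ℚ using (ℚ; 0ℚ; 1ℚ; ½)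
import Data.Rational.Properties as ℚ
open import Data.Rational.Solver using (module +-*-Solver)
open import Data.Vec.Base as Vec using (Vec; []; _∷_; lookup; tabulate)
open import Data.Vec.Functional as Vector using (Vector)
open import Function.Bundles using (_⇔_)
open import Relation.Binary.PropositionalEquality
open import Relation.Nullary.Decidable using (does)
open import Relation.Unary using (Pred)

-- Real numbers are Cauchy sequences of rationals, equal when their
-- difference tends to 0.  All operations are termwise.

module Real where

  IsCauchy : (ℕ → ℚ) → Set
  IsCauchy x = ∀ ε → 0ℚ ℚ.< ε → ∃ λ N → ∀ m n → N ℕ.≤ m → N ℕ.≤ n → ℚ.∣ x m ℚ.- x n ∣ ℚ.≤ ε

  record ℝ : Set where
    constructor mkℝ
    field
      seq    : ℕ → ℚ
      cauchy : IsCauchy seq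

  open ℝ public

  infix  4 _≈_ _≤_
  infixl 6 _+_
  infixl 7 _*_

  _≈_ : ℝ → ℝ → Set
  x ≈ y = ∀ ε → 0ℚ ℚ.< ε → ∃ λ N → ∀ n → N ℕ.≤ n → ℚ.∣ seq x n ℚ.- seq y n ∣ ℚ.≤ ε

  _≤_ : ℝ → ℝ → Set
  x ≤ y = ∀ ε → 0ℚ ℚ.< ε → ∃ λ N → ∀ n → N ℕ.≤ n → seq x n ℚ.≤ seq y n ℚ.+ ε

  fromℚ : ℚ → ℝ
  fromℚ q = mkℝ (λ _ → q) λ ε 0<ε → 0 , λ _ _ _ _ →
    subst (ℚ._≤ ε) (cong ℚ.∣_∣ (sym (ℚ.+-inverseʳ q))) (ℚ.<⇒≤ 0<ε)

  fromℤ : ℤ → ℝ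
  fromℤ z = fromℚ (z ℚ./ 1)

  0ℝ 1ℝ : ℝ
  0ℝ = fromℚ 0ℚ
  1ℝ = fromℚ 1ℚ

  private
    open ℚ.≤-Reasoning
    open +-*-Solver

    difference-+ : ∀ a b c d → (a ℚ.+ b) ℚ.- (c ℚ.+ d) ≡ (a ℚ.- c) ℚ.+ (b ℚ.- d)
    difference-+ = solve 4 (λ a b c d → (a :+ b) :- (c :+ d) := (a :- c) :+ (b :- d)) refl

    difference-* : ∀ a b c d → a ℚ.* b ℚ.- c ℚ.* d ≡ a ℚ.* (b ℚ.- d) ℚ.+ d ℚ.* (a ℚ.- c)
    difference-* = solve 4 (λ a b c d → a :* b :- c :* d := a :* (b :- d) :+ d :* (a :- c)) refl

    add-back : ∀ a b → a ≡ (a ℚ.- b) ℚ.+ b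
    add-back = solve 2 (λ a b → a := (a :- b) :+ b) refl

    half>0 : ∀ {ε} → 0ℚ ℚ.< ε → 0ℚ ℚ.< ½ ℚ.* ε
    half>0 {ε} 0<ε = subst (ℚ._< ½ ℚ.* ε) (ℚ.*-zeroʳ ½) (ℚ.*-monoʳ-<-pos ½ 0<ε)

    half+half : ∀ ε → ½ ℚ.* ε ℚ.+ ½ ℚ.* ε ≡ ε
    half+half ε = trans (sym (ℚ.*-distribʳ-+ ε ½ ½)) (ℚ.*-identityˡ ε)

    +-cauchy : ∀ x y → IsCauchy x → IsCauchy y → IsCauchy (λ n → x n ℚ.+ y n)
    +-cauchy x y cx cy ε 0<ε
      with cx (½ ℚ.* ε) (half>0 0<ε) | cy (½ ℚ.* ε) (half>0 0<ε)
    ... | N₁ , h₁ | N₂ , h₂ = N₁ ℕ.⊔ N₂ , λ m n N≤m N≤n → begin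
      ℚ.∣ (x m ℚ.+ y m) ℚ.- (x n ℚ.+ y n) ∣
        ≡⟨ cong ℚ.∣_∣ (difference-+ (x m) (y m) (x n) (y n)) ⟩
      ℚ.∣ (x m ℚ.- x n) ℚ.+ (y m ℚ.- y n) ∣
        ≤⟨ ℚ.∣p+q∣≤∣p∣+∣q∣ (x m ℚ.- x n) (y m ℚ.- y n) ⟩
      ℚ.∣ x m ℚ.- x n ∣ ℚ.+ ℚ.∣ y m ℚ.- y n ∣
        ≤⟨ ℚ.+-mono-≤ (h₁ m n (ℕ.m⊔n≤o⇒m≤o N₁ N₂ N≤m) (ℕ.m⊔n≤o⇒m≤o N₁ N₂ N≤n))
                      (h₂ m n (ℕ.m⊔n≤o⇒n≤o N₁ N₂ N≤m) (ℕ.m⊔n≤o⇒n≤o N₁ N₂ N≤n)) ⟩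
      ½ ℚ.* ε ℚ.+ ½ ℚ.* ε ≡⟨ half+half ε ⟩
      ε ∎

    EventuallyBoundedBy : ℚ → (ℕ → ℚ) → Set
    EventuallyBoundedBy B x = ∃ λ N → ∀ n → N ℕ.≤ n → ℚ.∣ x n ∣ ℚ.≤ B

    bounded : ∀ {x} → IsCauchy x → ∃ λ B → 0ℚ ℚ.< B × EventuallyBoundedBy B x
    bounded {x} cx with cx 1ℚ (ℚ.positive⁻¹ 1ℚ)
    ... | N , h = 1ℚ ℚ.+ ℚ.∣ x N ∣
                , ℚ.+-mono-<-≤ (ℚ.positive⁻¹ 1ℚ) (ℚ.0≤∣p∣ (x N))
                , N , λ n N≤n → begin
      ℚ.∣ x n ∣
        ≡⟨ cong ℚ.∣_∣ (add-back (x n) (x N)) ⟩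
      ℚ.∣ (x n ℚ.- x N) ℚ.+ x N ∣      ≤⟨ ℚ.∣p+q∣≤∣p∣+∣q∣ (x n ℚ.- x N) (x N) ⟩
      ℚ.∣ x n ℚ.- x N ∣ ℚ.+ ℚ.∣ x N ∣  ≤⟨ ℚ.+-monoˡ-≤ ℚ.∣ x N ∣ (h n N N≤n ℕ.≤-refl) ⟩
      1ℚ ℚ.+ ℚ.∣ x N ∣                 ∎

    +-pos : ∀ p q → 0ℚ ℚ.< p → 0ℚ ℚ.< q → 0ℚ ℚ.< p ℚ.+ q
    +-pos p q 0<p 0<q = subst (ℚ._< p ℚ.+ q) (ℚ.+-identityˡ 0ℚ) (ℚ.+-mono-< 0<p 0<q)

    divide : ∀ B ε → 0ℚ ℚ.< B → 0ℚ ℚ.< ε → ∃ λ δ → 0ℚ ℚ.< δ × B ℚ.* δ ≡ ε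
    divide B ε 0<B 0<ε = 1/B ℚ.* ε
      , subst (ℚ._< 1/B ℚ.* ε) (ℚ.*-zeroʳ 1/B) (ℚ.*-monoʳ-<-pos 1/B 0<ε)
      , trans (sym (ℚ.*-assoc B 1/B ε))
              (trans (cong (ℚ._* ε) (ℚ.*-inverseʳ B)) (ℚ.*-identityˡ ε))
      where
      instance
        B-pos : ℚ.Positive B
        B-pos = ℚ.positive 0<B
        B-nonZero : ℚ.NonZero B
        B-nonZero = ℚ.pos⇒nonZero B
      1/B : ℚ
      1/B = ℚ.1/ B
      instance
        1/B-pos : ℚ.Positive 1/B
        1/B-pos = ℚ.1/pos⇒pos B

    *-mono-∣∣ : ∀ p q {a b} → 0ℚ ℚ.≤ a → ℚ.∣ p ∣ ℚ.≤ a → ℚ.∣ q ∣ ℚ.≤ b → ℚ.∣ p ℚ.* q ∣ ℚ.≤ a ℚ.* b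
    *-mono-∣∣ p q {a} {b} 0≤a p≤a q≤b = begin
      ℚ.∣ p ℚ.* q ∣        ≡⟨ ℚ.∣p*q∣≡∣p∣*∣q∣ p q ⟩
      ℚ.∣ p ∣ ℚ.* ℚ.∣ q ∣  ≤⟨ ℚ.*-monoʳ-≤-nonNeg ℚ.∣ q ∣ {{ℚ.∣-∣-nonNeg q}} p≤a ⟩
      a ℚ.* ℚ.∣ q ∣        ≤⟨ ℚ.*-monoˡ-≤-nonNeg a {{ℚ.nonNegative 0≤a}} q≤b ⟩
      a ℚ.* b              ∎

    triangle : ∀ p q {s t} → ℚ.∣ p ∣ ℚ.≤ s → ℚ.∣ q ∣ ℚ.≤ t → ℚ.∣ p ℚ.+ q ∣ ℚ.≤ s ℚ.+ t
    triangle p q p≤s q≤t = ℚ.≤-trans (ℚ.∣p+q∣≤∣p∣+∣q∣ p q) (ℚ.+-mono-≤ p≤s q≤t)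

    product-estimate : ∀ a b c d B C δ → 0ℚ ℚ.< B → 0ℚ ℚ.< C →
      ℚ.∣ a ∣ ℚ.≤ B → ℚ.∣ d ∣ ℚ.≤ C → ℚ.∣ a ℚ.- c ∣ ℚ.≤ δ → ℚ.∣ b ℚ.- d ∣ ℚ.≤ δ →
      ℚ.∣ a ℚ.* b ℚ.- c ℚ.* d ∣ ℚ.≤ (B ℚ.+ C) ℚ.* δ
    product-estimate a b c d B C δ 0<B 0<C a≤B d≤C a-c≤δ b-d≤δ =
      subst₂ ℚ._≤_
        (sym (cong ℚ.∣_∣ (difference-* a b c d)))
        (sym (ℚ.*-distribʳ-+ δ B C))
        (triangle (a ℚ.* (b ℚ.- d)) (d ℚ.* (a ℚ.- c))
          (*-mono-∣∣ a (b ℚ.- d) (ℚ.<⇒≤ 0<B) a≤B b-d≤δ)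
          (*-mono-∣∣ d (a ℚ.- c) (ℚ.<⇒≤ 0<C) d≤C a-c≤δ))

    *-cauchy : ∀ x y → IsCauchy x → IsCauchy y → IsCauchy (λ n → x n ℚ.* y n)
    *-cauchy x y cx cy ε 0<ε = N , estimate
      where
      Bx = bounded {x} cx
      By = bounded {y} cy
      B C : ℚ
      B = proj₁ Bx
      C = proj₁ By
      0<B : 0ℚ ℚ.< B
      0<B = proj₁ (proj₂ Bx)
      0<C : 0ℚ ℚ.< C
      0<C = proj₁ (proj₂ By)
      Δ = divide (B ℚ.+ C) ε (+-pos B C 0<B 0<C) 0<ε
      δ : ℚ
      δ = proj₁ Δ
      0<δ : 0ℚ ℚ.< δ
      0<δ = proj₁ (proj₂ Δ)
      K = proj₁ (proj₂ (proj₂ Bx))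
      L = proj₁ (proj₂ (proj₂ By))
      M₁ = proj₁ (cx δ 0<δ)
      M₂ = proj₁ (cy δ 0<δ)
      N = (K ℕ.⊔ L) ℕ.⊔ (M₁ ℕ.⊔ M₂)
      K≤N : K ℕ.≤ N
      K≤N = ℕ.≤-trans (ℕ.m≤m⊔n K L) (ℕ.m≤m⊔n _ _)
      L≤N : L ℕ.≤ N
      L≤N = ℕ.≤-trans (ℕ.m≤n⊔m K L) (ℕ.m≤m⊔n _ _)
      M₁≤N : M₁ ℕ.≤ N
      M₁≤N = ℕ.≤-trans (ℕ.m≤m⊔n M₁ M₂) (ℕ.m≤n⊔m (K ℕ.⊔ L) _)
      M₂≤N : M₂ ℕ.≤ N
      M₂≤N = ℕ.≤-trans (ℕ.m≤n⊔m M₁ M₂) (ℕ.m≤n⊔m (K ℕ.⊔ L) _)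
      scaled : ∀ m n → N ℕ.≤ m → N ℕ.≤ n →
        ℚ.∣ x m ℚ.* y m ℚ.- x n ℚ.* y n ∣ ℚ.≤ (B ℚ.+ C) ℚ.* δ
      scaled m n N≤m N≤n = product-estimate (x m) (y m) (x n) (y n) B C δ 0<B 0<C
        (proj₂ (proj₂ (proj₂ Bx)) m (ℕ.≤-trans K≤N N≤m))
        (proj₂ (proj₂ (proj₂ By)) n (ℕ.≤-trans L≤N N≤n))
        (proj₂ (cx δ 0<δ) m n (ℕ.≤-trans M₁≤N N≤m) (ℕ.≤-trans M₁≤N N≤n))
        (proj₂ (cy δ 0<δ) m n (ℕ.≤-trans M₂≤N N≤m) (ℕ.≤-trans M₂≤N N≤n))
      estimate : ∀ m n → N ℕ.≤ m → N ℕ.≤ n → ℚ.∣ x m ℚ.* y m ℚ.- x n ℚ.* y n ∣ ℚ.≤ ε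
      estimate m n N≤m N≤n = ℚ.≤-trans (scaled m n N≤m N≤n) (ℚ.≤-reflexive (proj₂ (proj₂ Δ)))

  _+_ _*_ : ℝ → ℝ → ℝ
  x + y = mkℝ (λ n → seq x n ℚ.+ seq y n) (+-cauchy (seq x) (seq y) (cauchy x) (cauchy y))
  x * y = mkℝ (λ n → seq x n ℚ.* seq y n) (*-cauchy (seq x) (seq y) (cauchy x) (cauchy y))

  ∑ : ∀ {n} → Vector ℝ n → ℝ
  ∑ = Vector.foldr _+_ 0ℝ

open Real using (ℝ; 0ℝ; 1ℝ; fromℤ; ∑)

infix 4 _≋_

_≋_ : ∀ {n} → Vector ℝ n → Vector ℝ n → Set
x ≋ y = ∀ i → x i Real.≈ y i

conv : ∀ {n} → Pred (Vector ℝ n) 0ℓ → Pred (Vector ℝ n) 0ℓ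
conv {n} S x = ∃ λ r → Σ (Vector (Vector ℝ n) r) λ v → Σ (Vector ℝ r) λ c →
  (∀ j → S (v j)) × (∀ j → 0ℝ Real.≤ c j) × ∑ c Real.≈ 1ℝ ×
  x ≋ (λ i → ∑ (λ j → c j Real.* v j i))

dilate : ∀ {n} → ℕ → Pred (Vector ℝ n) 0ℓ → Pred (Vector ℝ n) 0ℓ
dilate m P y = ∃ λ x → P x × y ≋ (λ i → fromℤ (+ m) Real.* x i)

latticePoints : ∀ {n} → Pred (Vector ℝ n) 0ℓ → Pred (Vec ℤ n) 0ℓ
latticePoints P z = P (λ i → fromℤ (lookup z i))

HasCardinality : ∀ {A : Set} → Pred A 0ℓ → ℕ → Set
HasCardinality {A} S N = Σ (List A) λ xs →
  Unique xs × (∀ a → (a List.∈ xs) ⇔ S a) × length xs ≡ N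

-- Coefficients in order of increasing degree.
Polynomial : Set
Polynomial = List ℚ

eval : Polynomial → ℚ → ℚ
eval p t = foldr (λ a r → a ℚ.+ t ℚ.* r) 0ℚ p

IsEhrhartPolynomial : ∀ {n} → Pred (Vector ℝ n) 0ℓ → Polynomial → Set
IsEhrhartPolynomial P p = ∀ (m : ℕ) → ∃ λ N →
  HasCardinality (latticePoints (dilate m P)) N × eval p (+ m ℚ./ 1) ≡ + N ℚ./ 1

-- A polynomial is determined by its values at the natural numbers, so the
-- witness is the Ehrhart polynomial of P (up to trailing zero coefficients).
EhrhartPositive : ∀ {n} → Pred (Vector ℝ n) 0ℓ → Set
EhrhartPositive P = ∃ λ p → IsEhrhartPolynomial P p × All (0ℚ ℚ.≤_) p

record Matroid (n : ℕ) : Set₁ where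
  field
    IsBasis  : Pred (Subset n) 0ℓ
    nonEmpty : ∃ λ B → IsBasis B
    exchange : ∀ {A B} → IsBasis A → IsBasis B → ∀ {a} → a ∈ A → a ∉ B →
               ∃ λ b → b ∈ B × b ∉ A × IsBasis ((A - a) ∪ ⁅ b ⁆)

open Matroid public

indicator : ∀ {n} → Subset n → Vector ℝ n
indicator B i = if lookup B i then 1ℝ else 0ℝ

basePolytope : ∀ {n} → Matroid n → Pred (Vector ℝ n) 0ℓ
basePolytope M = conv λ x → ∃ λ B → IsBasis M B × x ≋ indicator B

image : ∀ {n} → Permutation n n → Subset n → Subset n
image σ B = tabulate λ i → lookup B (σ ⟨$⟩ˡ i)

-- Isomorphism of matroids on [n], given by their families of bases.
infix 4 _≅_

_≅_ : ∀ {n} → Pred (Subset n) 0ℓ → Pred (Subset n) 0ℓ → Set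
_≅_ {n} 𝓐 𝓑 = Σ (Permutation n n) λ σ → ∀ B → 𝓐 B ⇔ 𝓑 (image σ B)

data Step : Set where
  E N : Step

endpoint : ∀ {n} → Vec Step n → ℕ × ℕ
endpoint []       = 0 , 0
endpoint (E ∷ xs) = map₁ suc (endpoint xs)
endpoint (N ∷ xs) = map₂ suc (endpoint xs)

record LatticePath (n k : ℕ) : Set where
  constructor mkPath
  field
    steps : Vec Step n
    ends  : endpoint steps ≡ (n ∸ k , k)

open LatticePath public

isNorth : Step → Side
isNorth N = inside
isNorth E = outside

northSteps : ∀ {n k} → LatticePath n k → Subset n
northSteps P = Vec.map isNorth (steps P)

-- The set [m] = {1,…,m} ⊆ [n]; the element i : Fin n stands for i + 1.
initial : ∀ {n} → ℕ → Subset n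
initial m = tabulate λ i → does (toℕ i ℕ.<? m)

LiesBelow : ∀ {n k} → LatticePath n k → LatticePath n k → Set
LiesBelow {n} L U = ∀ m → 1 ℕ.≤ m → m ℕ.≤ n →
  ∣ northSteps L ∩ initial m ∣ ℕ.≤ ∣ northSteps U ∩ initial m ∣

-- The bases of M[L,U], for L below U.
pathBases : ∀ {n k} → LatticePath n k → LatticePath n k → Pred (Subset n) 0ℓ
pathBases {n} {k} L U B = Σ (LatticePath n k) λ P →
  LiesBelow L P × LiesBelow P U × northSteps P ≡ B

private
  endpoint-cast : ∀ {m n} .(eq : m ≡ n) (xs : Vec Step m) →
                  endpoint (Vec.cast eq xs) ≡ endpoint xs
  endpoint-cast {n = zero}  eq []       = refl
  endpoint-cast {n = suc _} eq (E ∷ xs) = cong (map₁ suc) (endpoint-cast (cong ℕ.pred eq) xs)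
  endpoint-cast {n = suc _} eq (N ∷ xs) = cong (map₂ suc) (endpoint-cast (cong ℕ.pred eq) xs)

  endpoint-EN : ∀ a b → endpoint (Vec.replicate a E Vec.++ Vec.replicate b N) ≡ (a , b)
  endpoint-EN zero    zero    = refl
  endpoint-EN zero    (suc b) = cong (map₂ suc) (endpoint-EN zero b)
  endpoint-EN (suc a) b       = cong (map₁ suc) (endpoint-EN a b)

-- M[U] = M[L,U] for this L = E⋯EN⋯N, which lies below every U.
lowestPath : ∀ {n k} → k ℕ.≤ n → LatticePath n k
lowestPath {n} {k} k≤n = mkPath
  (Vec.cast (ℕ.m∸n+n≡m k≤n) (Vec.replicate (n ∸ k) E Vec.++ Vec.replicate k N))
  (trans (endpoint-cast (ℕ.m∸n+n≡m k≤n) _) (endpoint-EN (n ∸ k) k))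

IsSchubert : ∀ {n} → Matroid n → Set
IsSchubert {n} M = ∃ λ k → Σ (k ℕ.≤ n) λ k≤n → Σ (LatticePath n k) λ U →
  IsBasis M ≅ pathBases (lowestPath k≤n) U

{-# OPTIONS --safe #-}
module Submission where

-- Let U be the upper path, u_j the number of north steps among its first j
-- steps, and S_j the partial sums of a vector x.  Up to a permutation of the
-- coordinates, the lattice points of the t-th dilate of the base polytope are
-- the integer vectors with 0 ≤ x_i ≤ t, S_j ≤ t u_j and S_n = t u_n.  These
-- inequalities hold at the vertices, hence on the polytope (inequality,
-- lattice⇒valid).  Conversely, an integer vector satisfying them is a sum of t
-- indicator vectors of bases: for s < t the s-th basis is the path whose slack
-- below U after j steps is ⌊(t u_j - S_j + s) / t⌋, and the sum is right by
-- Hermite's identity (sample-valid, sample-sum, valid⇒lattice).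
--
-- The slacks d_j = t u_j - S_j form a walk from 0 to 0 in ℕ which rises by at
-- most t at a north step of U and falls by at most t at an east step.  Write
-- d = l t + r with 0 ≤ r < t.  Then a step is determined by the new remainder
-- and one of two letters: ↓ when the remainder weakly falls, ↑ when it weakly
-- rises, and the letter alone decides how the level l changes.  So the number
-- of walks is a sum, over the words in ↓ and ↑ whose levels stay nonnegative,
-- of numbers of sequences in {0, …, t - 1} with prescribed weak descents and
-- ascents, that is, of order polynomials of fences (count-states).
--
-- It remains to see that the order polynomial X_w of a fence has nonnegative
-- coefficients (fence-nonNeg).  Collect the X_w in a power series X(t) in the
-- noncommuting variables ↓ and ↑.  Writing a weak ascent as no condition minus
-- a strict descent gives X = L + L ↑ X, where L_w(t) = (-1)^b C(t + a, a + b + 1)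
-- for a word w with a letters ↓ and b letters ↑.  Its derivative at 0 is
-- V_w = a! b! / (a + b + 1)! ≥ 0.  The Pascal recurrences of the L_w yield
-- dL/dt = V + L (↓ - ↑) V (ℓ-flow), and with the previous equation this gives
-- dX/dt = (1 + X ↓) V (1 + ↑ X) (ξ-flow).  The right-hand side involves only
-- nonnegative V_w and the X_w of shorter words, so the coefficients of X_w are
-- nonnegative by induction on the length of w.

open import Defs
open import Data.Bool.Base using (true; false; if_then_else_)
open import Data.Empty using (⊥)
open import Data.Fin.Base using (Fin; zero; suc; toℕ)
open import Data.Fin.Permutation using (Permutation; _⟨$⟩ˡ_; _⟨$⟩ʳ_; inverseˡ; inverseʳ)
import Data.Fin.Properties as Fin
open import Data.Fin.Subset as Subset using (Subset)
open import Data.Integer.Base as ℤ using (ℤ; +_)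
import Data.Integer.Properties as ℤ
open import Data.List.Base as List using (List; []; _∷_; _++_; length; map; concatMap; applyUpTo; upTo)
open import Data.List.Membership.Propositional using (_∈_; find; lose)
import Data.List.Membership.Propositional.Properties as List
import Data.List.Properties as List
open import Data.List.Relation.Unary.All as All using (All; []; _∷_)
import Data.List.Relation.Unary.All.Properties as All
import Data.List.Relation.Unary.AllPairs as AllPairs
import Data.List.Relation.Unary.AllPairs.Properties as AllPairs
open import Data.List.Relation.Unary.Any using (here)
open import Data.List.Relation.Unary.Unique.Propositional using (Unique)
import Data.List.Relation.Unary.Unique.Propositional.Properties as Unique
open import Data.Maybe.Base using (Maybe; just; nothing)
open import Data.Nat.Base as ℕ using (ℕ; zero; suc; z≤n; s≤s; _∸_; _⊓_)
open import Data.Nat.Divisibility using (∣-refl)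
import Data.Nat.DivMod as ℕ
import Data.Nat.Properties as ℕ
open import Data.Product.Base using (∃; _×_; _,_; proj₁; proj₂)
open import Data.Rational.Base as ℚ using (ℚ; 0ℚ; 1ℚ; _+_; _*_; _-_; -_; _≤_; _<_; ∣_∣)
import Data.Rational.Properties as ℚ
open import Data.Rational.Solver using (module +-*-Solver)
import Data.Rational.Unnormalised.Base as ℚᵘ
import Data.Rational.Unnormalised.Properties as ℚᵘ
open import Data.Sum.Base using (inj₁; inj₂)
open import Data.Vec.Base as Vec using (Vec; []; _∷_; lookup; tabulate)
import Data.Vec.Functional as Vector
import Data.Vec.Properties as Vec
open import Function.Base using (_∘_; id)
open import Function.Bundles using (_⇔_; mk⇔; module Equivalence)
open import Relation.Binary.PropositionalEquality
open import Relation.Nullary using (ofʸ; ofⁿ)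

open Real using (ℝ; seq; cauchy; fromℚ; ∑)
open +-*-Solver using (solve; _:+_; _:*_; _:-_; :-_; _:=_; con)

-- Integers and natural numbers among the rationals

abstract

  -- Abstract, because unfolding the normalisation of z / 1 blows up the terms below.
  int : ℤ → ℚ
  int z = z ℚ./ 1

  int-def : ∀ z → int z ≡ z ℚ./ 1
  int-def z = refl

  int-0 : int (+ 0) ≡ 0ℚ
  int-0 = refl

  int-1 : int (+ 1) ≡ 1ℚ
  int-1 = refl

  int-+ : ∀ a b → int (a ℤ.+ b) ≡ int a + int b
  int-+ a b = ℚ.toℚᵘ-injective (ℚᵘ.≃-trans (ℚ.toℚᵘ-fromℚᵘ (ℚᵘ.mkℚᵘ (a ℤ.+ b) 0))
    (ℚᵘ.≃-trans (ℚᵘ.*≡* eq) (ℚᵘ.≃-sym (ℚᵘ.≃-trans (ℚ.toℚᵘ-homo-+ (int a) (int b))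
      (ℚᵘ.+-cong (ℚ.toℚᵘ-fromℚᵘ (ℚᵘ.mkℚᵘ a 0)) (ℚ.toℚᵘ-fromℚᵘ (ℚᵘ.mkℚᵘ b 0)))))))
    where
    eq : (a ℤ.+ b) ℤ.* (ℤ.1ℤ ℤ.* ℤ.1ℤ) ≡ (a ℤ.* ℤ.1ℤ ℤ.+ b ℤ.* ℤ.1ℤ) ℤ.* ℤ.1ℤ
    eq = cong (ℤ._* ℤ.1ℤ) (sym (cong₂ ℤ._+_ (ℤ.*-identityʳ a) (ℤ.*-identityʳ b)))

  int-* : ∀ a b → int (a ℤ.* b) ≡ int a * int b
  int-* a b = ℚ.toℚᵘ-injective (ℚᵘ.≃-trans (ℚ.toℚᵘ-fromℚᵘ (ℚᵘ.mkℚᵘ (a ℤ.* b) 0))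
    (ℚᵘ.≃-sym (ℚᵘ.≃-trans (ℚ.toℚᵘ-homo-* (int a) (int b))
      (ℚᵘ.*-cong (ℚ.toℚᵘ-fromℚᵘ (ℚᵘ.mkℚᵘ a 0)) (ℚ.toℚᵘ-fromℚᵘ (ℚᵘ.mkℚᵘ b 0))))))

  int-mono-≤ : ∀ {a b} → a ℤ.≤ b → int a ≤ int b
  int-mono-≤ {a} {b} a≤b = ℚ.toℚᵘ-cancel-≤
    (ℚᵘ.≤-respˡ-≃ (ℚᵘ.≃-sym (ℚ.toℚᵘ-fromℚᵘ (ℚᵘ.mkℚᵘ a 0)))
      (ℚᵘ.≤-respʳ-≃ (ℚᵘ.≃-sym (ℚ.toℚᵘ-fromℚᵘ (ℚᵘ.mkℚᵘ b 0)))
        (ℚᵘ.*≤* (ℤ.*-monoʳ-≤-nonNeg ℤ.1ℤ a≤b))))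

  int-cancel-≤ : ∀ {a b} → int a ≤ int b → a ℤ.≤ b
  int-cancel-≤ {a} {b} p = subst₂ ℤ._≤_ (ℤ.*-identityʳ a) (ℤ.*-identityʳ b)
    (ℚᵘ.drop-*≤* {ℚᵘ.mkℚᵘ a 0} {ℚᵘ.mkℚᵘ b 0}
      (ℚᵘ.≤-respˡ-≃ (ℚ.toℚᵘ-fromℚᵘ (ℚᵘ.mkℚᵘ a 0))
        (ℚᵘ.≤-respʳ-≃ (ℚ.toℚᵘ-fromℚᵘ (ℚᵘ.mkℚᵘ b 0)) (ℚ.toℚᵘ-mono-≤ p))))

nat : ℕ → ℚ
nat n = int (+ n)

nat-suc : ∀ n → nat (suc n) ≡ 1ℚ + nat n
nat-suc n = trans (int-+ (+ 1) (+ n)) (cong (_+ nat n) int-1)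

nat-+ : ∀ m n → nat (m ℕ.+ n) ≡ nat m + nat n
nat-+ m n = int-+ (+ m) (+ n)

0≤nat : ∀ n → 0ℚ ≤ nat n
0≤nat n = subst (_≤ nat n) int-0 (int-mono-≤ {+ 0} {+ n} (ℤ.+≤+ z≤n))

0<nat : ∀ n → 0ℚ ℚ.< nat (suc n)
0<nat n = ℚ.<-≤-trans (ℚ.positive⁻¹ 1ℚ) (subst (_≤ nat (suc n)) int-1 (int-mono-≤ {+ 1} {+ suc n} (ℤ.+≤+ (s≤s z≤n))))

+-nonneg : ∀ {p q} → 0ℚ ≤ p → 0ℚ ≤ q → 0ℚ ≤ p + q
+-nonneg = ℚ.+-mono-≤

*-nonneg : ∀ {p q} → 0ℚ ≤ p → 0ℚ ≤ q → 0ℚ ≤ p * q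
*-nonneg {p} {q} 0≤p 0≤q =
  subst (_≤ p * q) (ℚ.*-zeroʳ p) (ℚ.*-monoˡ-≤-nonNeg p {{ℚ.nonNegative 0≤p}} 0≤q)

*-cancel-nonneg : ∀ {p q} → 0ℚ ℚ.< p → 0ℚ ≤ p * q → 0ℚ ≤ q
*-cancel-nonneg {p} {q} 0<p 0≤pq = ℚ.*-cancelˡ-≤-pos p {{ℚ.positive 0<p}}
  (subst (_≤ p * q) (sym (ℚ.*-zeroʳ p)) 0≤pq)

*-cancelˡ : ∀ p .{{_ : ℚ.NonZero p}} {q r} → p * q ≡ p * r → q ≡ r
*-cancelˡ p {q} {r} eq = trans (sym (undo q)) (trans (cong (ℚ.1/ p *_) eq) (undo r))
  where
  undo : ∀ q → ℚ.1/ p * (p * q) ≡ q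
  undo q = trans (sym (ℚ.*-assoc (ℚ.1/ p) p q))
    (trans (cong (_* q) (ℚ.*-inverseˡ p)) (ℚ.*-identityˡ q))

+-cancelˡ : ∀ p {q r} → p + q ≡ p + r → q ≡ r
+-cancelˡ p {q} {r} eq = trans (undo q) (trans (cong (_- p) eq) (sym (undo r)))
  where
  undo : ∀ q → q ≡ (p + q) - p
  undo q = solve 2 (λ p q → q := (p :+ q) :- p) refl p q

-- Polynomials over the rationals

infixl 6 _+ᴾ_
infixl 7 _*ᴾ_ _·ᴾ_

-- Addition, multiplication by a constant, and multiplication.
_+ᴾ_ : Polynomial → Polynomial → Polynomial
[]      +ᴾ q       = q
(a ∷ p) +ᴾ []      = a ∷ p
(a ∷ p) +ᴾ (b ∷ q) = a + b ∷ p +ᴾ q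

_·ᴾ_ : ℚ → Polynomial → Polynomial
c ·ᴾ p = map (c *_) p

_*ᴾ_ : Polynomial → Polynomial → Polynomial
p *ᴾ []      = []
p *ᴾ (b ∷ q) = b ·ᴾ p +ᴾ (0ℚ ∷ p *ᴾ q)

-- The value at x of the derivative.
evalD : Polynomial → ℚ → ℚ
evalD []      x = 0ℚ
evalD (a ∷ p) x = eval p x + x * evalD p x

eval-+ : ∀ p q x → eval (p +ᴾ q) x ≡ eval p x + eval q x
eval-+ []      q       x = sym (ℚ.+-identityˡ _)
eval-+ (a ∷ p) []      x = sym (ℚ.+-identityʳ _)
eval-+ (a ∷ p) (b ∷ q) x rewrite eval-+ p q x =
  solve 5 (λ a b x u v → (a :+ b) :+ x :* (u :+ v) := (a :+ x :* u) :+ (b :+ x :* v)) refl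
    a b x (eval p x) (eval q x)

eval-· : ∀ c p x → eval (c ·ᴾ p) x ≡ c * eval p x
eval-· c []      x = sym (ℚ.*-zeroʳ c)
eval-· c (a ∷ p) x rewrite eval-· c p x =
  solve 4 (λ c a x u → c :* a :+ x :* (c :* u) := c :* (a :+ x :* u)) refl c a x (eval p x)

eval-* : ∀ p q x → eval (p *ᴾ q) x ≡ eval p x * eval q x
eval-* p []      x = sym (ℚ.*-zeroʳ (eval p x))
eval-* p (b ∷ q) x
  rewrite eval-+ (b ·ᴾ p) (0ℚ ∷ p *ᴾ q) x | eval-· b p x | eval-* p q x =
  solve 4 (λ u b x v → b :* u :+ (con 0ℚ :+ x :* (u :* v)) := u :* (b :+ x :* v)) refl
    (eval p x) b x (eval q x)

evalD-+ : ∀ p q x → evalD (p +ᴾ q) x ≡ evalD p x + evalD q x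
evalD-+ []      q       x = sym (ℚ.+-identityˡ _)
evalD-+ (a ∷ p) []      x = sym (ℚ.+-identityʳ _)
evalD-+ (a ∷ p) (b ∷ q) x rewrite eval-+ p q x | evalD-+ p q x =
  solve 5 (λ x u v s t → (u :+ v) :+ x :* (s :+ t) := (u :+ x :* s) :+ (v :+ x :* t)) refl
    x (eval p x) (eval q x) (evalD p x) (evalD q x)

evalD-· : ∀ c p x → evalD (c ·ᴾ p) x ≡ c * evalD p x
evalD-· c []      x = sym (ℚ.*-zeroʳ c)
evalD-· c (a ∷ p) x rewrite eval-· c p x | evalD-· c p x =
  solve 4 (λ c x u s → c :* u :+ x :* (c :* s) := c :* (u :+ x :* s)) refl
    c x (eval p x) (evalD p x)

evalD-* : ∀ p q x → evalD (p *ᴾ q) x ≡ evalD p x * eval q x + eval p x * evalD q x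
evalD-* p []      x = solve 2 (λ u s → con 0ℚ := s :* con 0ℚ :+ u :* con 0ℚ) refl (eval p x) (evalD p x)
evalD-* p (b ∷ q) x
  rewrite evalD-+ (b ·ᴾ p) (0ℚ ∷ p *ᴾ q) x | evalD-· b p x | eval-* p q x | evalD-* p q x =
  solve 6 (λ b x u v s t → b :* s :+ (u :* v :+ x :* (s :* v :+ u :* t))
                        := s :* (b :+ x :* v) :+ u :* (v :+ x :* t)) refl
    b x (eval p x) (eval q x) (evalD p x) (evalD q x)

-- The polynomial p (x + 1).
shift : Polynomial → Polynomial
shift []      = []
shift (a ∷ p) = (a ∷ []) +ᴾ (1ℚ ∷ 1ℚ ∷ []) *ᴾ shift p

eval-shift : ∀ p x → eval (shift p) x ≡ eval p (1ℚ + x)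
eval-shift []      x = refl
eval-shift (a ∷ p) x
  rewrite eval-+ (a ∷ []) ((1ℚ ∷ 1ℚ ∷ []) *ᴾ shift p) x
        | eval-* (1ℚ ∷ 1ℚ ∷ []) (shift p) x | eval-shift p x =
  solve 3 (λ a x u → (a :+ x :* con 0ℚ) :+ (con 1ℚ :+ x :* (con 1ℚ :+ x :* con 0ℚ)) :* u
                  := a :+ (con 1ℚ :+ x) :* u) refl a x (eval p (1ℚ + x))

evalD-shift : ∀ p x → evalD (shift p) x ≡ evalD p (1ℚ + x)
evalD-shift []      x = refl
evalD-shift (a ∷ p) x
  rewrite evalD-+ (a ∷ []) ((1ℚ ∷ 1ℚ ∷ []) *ᴾ shift p) x
        | evalD-* (1ℚ ∷ 1ℚ ∷ []) (shift p) x | eval-shift p x | evalD-shift p x =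
  solve 3 (λ x u s → (con 0ℚ :+ x :* con 0ℚ)
                     :+ (((con 1ℚ :+ x :* con 0ℚ) :+ x :* (con 0ℚ :+ x :* con 0ℚ)) :* u
                     :+ (con 1ℚ :+ x :* (con 1ℚ :+ x :* con 0ℚ)) :* s)
                  := u :+ (con 1ℚ :+ x) :* s) refl x (eval p (1ℚ + x)) (evalD p (1ℚ + x))

-- Synthetic division by x - c.
divide : ℚ → Polynomial → Polynomial
divide c []          = []
divide c (a ∷ [])    = []
divide c (a ∷ b ∷ p) = eval (b ∷ p) c ∷ divide c (b ∷ p)

eval-divide : ∀ c p x → eval p x ≡ eval p c + (x - c) * eval (divide c p) x
eval-divide c []       x = solve 2 (λ x c → con 0ℚ := con 0ℚ :+ (x :- c) :* con 0ℚ) refl x c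
eval-divide c (a ∷ []) x =
  solve 3 (λ a x c → a :+ x :* con 0ℚ := (a :+ c :* con 0ℚ) :+ (x :- c) :* con 0ℚ) refl a x c
eval-divide c (a ∷ b ∷ p) x rewrite eval-divide c (b ∷ p) x =
  solve 5 (λ a x c u v → a :+ x :* (u :+ (x :- c) :* v) := (a :+ c :* u) :+ (x :- c) :* (u :+ x :* v))
    refl a x c (eval (b ∷ p) c) (eval (divide c (b ∷ p)) x)

length-divide : ∀ c a p → length (divide c (a ∷ p)) ≡ length p
length-divide c a []      = refl
length-divide c a (b ∷ p) = cong suc (length-divide c b p)

nat≢ : ∀ {m n} → m ℕ.< n → nat n - nat m ≢ 0ℚ
nat≢ {m} {n} m<n eq = ℕ.<⇒≱ m<n (ℤ.drop‿+≤+ (int-cancel-≤ {+ n} {+ m} (ℚ.≤-reflexive nat-eq)))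
  where
  nat-eq : nat n ≡ nat m
  nat-eq = trans (solve 2 (λ a b → a := (a :- b) :+ b) refl (nat n) (nat m))
                 (trans (cong (_+ nat m) eq) (ℚ.+-identityˡ (nat m)))

-- Induction on a bound k for the number of coefficients: divide by x - M.
vanish : ∀ k p → length p ℕ.≤ k → ∀ M → (∀ n → M ℕ.≤ n → eval p (nat n) ≡ 0ℚ) → ∀ x → eval p x ≡ 0ℚ
vanish k       []      _         M zeros x = refl
vanish (suc k) (a ∷ p) (s≤s len) M zeros x = begin
  eval (a ∷ p) x
    ≡⟨ eval-divide c (a ∷ p) x ⟩
  eval (a ∷ p) c + (x - c) * eval q x
    ≡⟨ cong₂ (λ u v → u + (x - c) * v) (zeros M ℕ.≤-refl)
         (vanish k q (subst (ℕ._≤ k) (sym (length-divide c a p)) len) (suc M) q-zeros x) ⟩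
  0ℚ + (x - c) * 0ℚ
    ≡⟨ solve 1 (λ y → con 0ℚ :+ y :* con 0ℚ := con 0ℚ) refl (x - c) ⟩
  0ℚ ∎
  where
  open ≡-Reasoning
  c = nat M
  q = divide c (a ∷ p)
  q-zeros : ∀ n → suc M ℕ.≤ n → eval q (nat n) ≡ 0ℚ
  q-zeros n M<n = *-cancelˡ (nat n - c) {{ℚ.≢-nonZero (nat≢ M<n)}} (begin
    (nat n - c) * eval q (nat n)
      ≡⟨ ℚ.+-identityˡ _ ⟨
    0ℚ + (nat n - c) * eval q (nat n)
      ≡⟨ cong (_+ (nat n - c) * eval q (nat n)) (zeros M ℕ.≤-refl) ⟨
    eval (a ∷ p) c + (nat n - c) * eval q (nat n)
      ≡⟨ eval-divide c (a ∷ p) (nat n) ⟨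
    eval (a ∷ p) (nat n)
      ≡⟨ zeros n (ℕ.<⇒≤ M<n) ⟩
    0ℚ
      ≡⟨ ℚ.*-zeroʳ (nat n - c) ⟨
    (nat n - c) * 0ℚ ∎)

-- A polynomial is determined by its values at large natural numbers.
eval-unique : ∀ M p q → (∀ n → M ℕ.≤ n → eval p (nat n) ≡ eval q (nat n)) → ∀ x → eval p x ≡ eval q x
eval-unique M p q agree x = begin
  eval p x
    ≡⟨ solve 2 (λ u v → u := (u :+ con (- 1ℚ) :* v) :+ v) refl (eval p x) (eval q x) ⟩
  (eval p x + (- 1ℚ) * eval q x) + eval q x
    ≡⟨ cong (_+ eval q x) (eval-difference x) ⟨
  eval d x + eval q x
    ≡⟨ cong (_+ eval q x) (vanish (length d) d ℕ.≤-refl M d-zeros x) ⟩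
  0ℚ + eval q x
    ≡⟨ ℚ.+-identityˡ _ ⟩
  eval q x ∎
  where
  open ≡-Reasoning
  d = p +ᴾ (- 1ℚ) ·ᴾ q
  eval-difference : ∀ y → eval d y ≡ eval p y + (- 1ℚ) * eval q y
  eval-difference y = trans (eval-+ p _ y) (cong (λ v → eval p y + v) (eval-· (- 1ℚ) q y))
  d-zeros : ∀ n → M ℕ.≤ n → eval d (nat n) ≡ 0ℚ
  d-zeros n M≤n = trans (eval-difference (nat n)) (trans (cong (_+ (- 1ℚ) * eval q (nat n)) (agree n M≤n))
    (solve 1 (λ v → v :+ con (- 1ℚ) :* v := con 0ℚ) refl (eval q (nat n))))

-- Equality of polynomial functions.  Polynomials that agree have the same
-- coefficients up to trailing zeros, so head₀ and tail₀ respect this relation.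
Agree : Polynomial → Polynomial → Set
Agree p q = ∀ x → eval p x ≡ eval q x

-- The constant coefficient, and the quotient by x of the remaining terms.
head₀ : Polynomial → ℚ
head₀ []      = 0ℚ
head₀ (a ∷ p) = a

tail₀ : Polynomial → Polynomial
tail₀ []      = []
tail₀ (a ∷ p) = p

eval-head-tail : ∀ p x → eval p x ≡ head₀ p + x * eval (tail₀ p) x
eval-head-tail []      x = solve 1 (λ x → con 0ℚ := con 0ℚ :+ x :* con 0ℚ) refl x
eval-head-tail (a ∷ p) x = refl

evalD-tail : ∀ p x → evalD p x ≡ eval (tail₀ p) x + x * evalD (tail₀ p) x
evalD-tail []      x = solve 1 (λ x → con 0ℚ := con 0ℚ :+ x :* con 0ℚ) refl x
evalD-tail (a ∷ p) x = refl

agree-head : ∀ p q → Agree p q → head₀ p ≡ head₀ q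
agree-head p q pq = trans (sym (at-0 p)) (trans (pq 0ℚ) (at-0 q))
  where
  at-0 : ∀ p → eval p 0ℚ ≡ head₀ p
  at-0 p = trans (eval-head-tail p 0ℚ)
    (solve 2 (λ a u → a :+ con 0ℚ :* u := a) refl (head₀ p) (eval (tail₀ p) 0ℚ))

agree-tail : ∀ p q → Agree p q → Agree (tail₀ p) (tail₀ q)
agree-tail p q pq = eval-unique 1 (tail₀ p) (tail₀ q) from-1
  where
  eq : ∀ x → head₀ p + x * eval (tail₀ p) x ≡ head₀ p + x * eval (tail₀ q) x
  eq x = trans (sym (eval-head-tail p x)) (trans (pq x) (trans (eval-head-tail q x)
    (cong (_+ x * eval (tail₀ q) x) (sym (agree-head p q pq)))))
  -- The factor x can be cancelled only at n ≥ 1, which is enough by uniqueness.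
  from-1 : ∀ n → 1 ℕ.≤ n → eval (tail₀ p) (nat n) ≡ eval (tail₀ q) (nat n)
  from-1 (suc n) _ = *-cancelˡ (nat (suc n)) {{ℚ.≢-nonZero (ℚ.<⇒≢ (0<nat n) ∘ sym)}}
    (+-cancelˡ (head₀ p) (eq (nat (suc n))))

evalD-agree : ∀ p q → Agree p q → ∀ x → evalD p x ≡ evalD q x
evalD-agree []      []      pq x = refl
evalD-agree p@(_ ∷ p′) q@[]       pq x =
  trans (evalD-tail p x) (trans (cong₂ (λ u v → u + x * v) (agree-tail p q pq x)
    (evalD-agree p′ [] (agree-tail p q pq) x)) (sym (evalD-tail q x)))
evalD-agree p@[]       q@(_ ∷ q′) pq x =
  trans (evalD-tail p x) (trans (cong₂ (λ u v → u + x * v) (agree-tail p q pq x)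
    (evalD-agree [] q′ (agree-tail p q pq) x)) (sym (evalD-tail q x)))
evalD-agree p@(_ ∷ p′) q@(_ ∷ q′) pq x =
  cong₂ (λ u v → u + x * v) (agree-tail p q pq x) (evalD-agree p′ q′ (agree-tail p q pq) x)

-- All coefficients are nonnegative.
NonNeg : Polynomial → Set
NonNeg = All (0ℚ ≤_)

nonNeg-+ : ∀ {p q} → NonNeg p → NonNeg q → NonNeg (p +ᴾ q)
nonNeg-+ []       qs       = qs
nonNeg-+ (a ∷ ps) []       = a ∷ ps
nonNeg-+ (a ∷ ps) (b ∷ qs) = +-nonneg a b ∷ nonNeg-+ ps qs

nonNeg-· : ∀ {c p} → 0ℚ ≤ c → NonNeg p → NonNeg (c ·ᴾ p)
nonNeg-· 0≤c []       = []
nonNeg-· 0≤c (a ∷ ps) = *-nonneg 0≤c a ∷ nonNeg-· 0≤c ps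

nonNeg-* : ∀ {p q} → NonNeg p → NonNeg q → NonNeg (p *ᴾ q)
nonNeg-* ps []       = []
nonNeg-* ps (b ∷ qs) = nonNeg-+ (nonNeg-· b ps) (ℚ.≤-refl ∷ nonNeg-* ps qs)

nonNeg-agree : ∀ p s → Agree p s → NonNeg s → NonNeg p
nonNeg-agree []      s ps ss = []
nonNeg-agree (a ∷ p) s ps ss =
  subst (0ℚ ≤_) (sym (agree-head (a ∷ p) s ps)) (head-nonNeg ss)
    ∷ nonNeg-agree p (tail₀ s) (agree-tail (a ∷ p) s ps) (tail-nonNeg ss)
  where
  head-nonNeg : ∀ {s} → NonNeg s → 0ℚ ≤ head₀ s
  head-nonNeg []      = ℚ.≤-refl
  head-nonNeg (b ∷ _) = b
  tail-nonNeg : ∀ {s} → NonNeg s → NonNeg (tail₀ s)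
  tail-nonNeg []       = []
  tail-nonNeg (_ ∷ bs) = bs

-- Coefficients k a₀, (k + 1) a₁, …, so that the derivative of a ∷ p is weighted 1 p.
weighted : ℕ → Polynomial → Polynomial
weighted k []      = []
weighted k (a ∷ p) = nat k * a ∷ weighted (suc k) p

derivative : Polynomial → Polynomial
derivative p = weighted 1 (tail₀ p)

eval-weighted : ∀ k p x → eval (weighted k p) x ≡ nat k * eval p x + x * evalD p x
eval-weighted k []      x = solve 2 (λ k x → con 0ℚ := k :* con 0ℚ :+ x :* con 0ℚ) refl (nat k) x
eval-weighted k (a ∷ p) x rewrite eval-weighted (suc k) p x | nat-suc k =
  solve 5 (λ k a x u s → k :* a :+ x :* ((con 1ℚ :+ k) :* u :+ x :* s)
                      := k :* (a :+ x :* u) :+ x :* (u :+ x :* s)) refl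
    (nat k) a x (eval p x) (evalD p x)

eval-derivative : ∀ p x → eval (derivative p) x ≡ evalD p x
eval-derivative p x = trans (eval-weighted 1 (tail₀ p) x)
  (trans (cong (_+ x * evalD (tail₀ p) x) (trans (cong (_* eval (tail₀ p) x) int-1) (ℚ.*-identityˡ (eval (tail₀ p) x)))) (sym (evalD-tail p x)))

weighted-nonNeg⁻¹ : ∀ k p → NonNeg (weighted (suc k) p) → NonNeg p
weighted-nonNeg⁻¹ k []      []       = []
weighted-nonNeg⁻¹ k (a ∷ p) (b ∷ bs) = *-cancel-nonneg (0<nat k) b ∷ weighted-nonNeg⁻¹ (suc k) p bs

-- A polynomial has nonnegative coefficients if its constant term is
-- nonnegative and its derivative has the values of such a polynomial.
nonNeg-from-derivative : ∀ p s → 0ℚ ≤ eval p 0ℚ → NonNeg s →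
  (∀ n → evalD p (nat n) ≡ eval s (nat n)) → NonNeg p
nonNeg-from-derivative []      s _   _  _  = []
nonNeg-from-derivative (a ∷ p) s 0≤a ss eq =
  subst (0ℚ ≤_) (solve 2 (λ a u → a :+ con 0ℚ :* u := a) refl a (eval p 0ℚ)) 0≤a
    ∷ weighted-nonNeg⁻¹ 0 p (nonNeg-agree (derivative (a ∷ p)) s
        (eval-unique 0 (derivative (a ∷ p)) s λ n _ → trans (eval-derivative (a ∷ p) (nat n)) (eq n)) ss)

-- Noncommutative power series

-- In a word describing a sequence of remainders, ↓ stands for a weak descent
-- and ↑ for a weak ascent.
data Letter : Set where
  ↓ ↑ : Letter

Word : Set
Word = List Letter

-- A power series in the noncommuting variables ↓ and ↑, by its coefficients.
Series : Set
Series = Word → ℚ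

-- The sum of f u ⊗ g v over all factorisations of a word as u ++ v.
convolve : {A : Set} → (A → A → A) → (A → A → A) → (Word → A) → (Word → A) → Word → A
convolve _⊕_ _⊗_ f g []      = f [] ⊗ g []
convolve _⊕_ _⊗_ f g (l ∷ w) = (f [] ⊗ g (l ∷ w)) ⊕ convolve _⊕_ _⊗_ (f ∘ (l ∷_)) g w

infixl 7 _∗_
infixl 6 _⊞_
infixr 8 _▸_

-- The product of power series.
_∗_ : Series → Series → Series
_∗_ = convolve _+_ _*_

_⊞_ : Series → Series → Series
(f ⊞ g) w = f w + g w

-- Left multiplication by the linear form in ↓ and ↑ with coefficients χ.
_▸_ : (Letter → ℚ) → Series → Series
(χ ▸ f) []      = 0ℚ
(χ ▸ f) (l ∷ w) = χ l * f w

▸-cong : ∀ χ {f g} → f ≗ g → χ ▸ f ≗ χ ▸ g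
▸-cong χ p []      = refl
▸-cong χ p (l ∷ w) = cong (χ l *_) (p w)

▸-distrib : ∀ χ f g → χ ▸ (f ⊞ g) ≗ χ ▸ f ⊞ χ ▸ g
▸-distrib χ f g []      = refl
▸-distrib χ f g (l ∷ w) = ℚ.*-distribˡ-+ (χ l) (f w) (g w)

∗-cong : ∀ {f f′ g g′} → f ≗ f′ → g ≗ g′ → f ∗ g ≗ f′ ∗ g′
∗-cong p q []      = cong₂ _*_ (p []) (q [])
∗-cong p q (l ∷ w) = cong₂ _+_ (cong₂ _*_ (p []) (q (l ∷ w))) (∗-cong (p ∘ (l ∷_)) q w)

∗-congˡ : ∀ f {g g′} → g ≗ g′ → f ∗ g ≗ f ∗ g′
∗-congˡ f = ∗-cong {f} (λ _ → refl)

∗-congʳ : ∀ {f f′} g → f ≗ f′ → f ∗ g ≗ f′ ∗ g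
∗-congʳ g p = ∗-cong {g = g} p (λ _ → refl)

∗-distribˡ : ∀ f g h → f ∗ (g ⊞ h) ≗ f ∗ g ⊞ f ∗ h
∗-distribˡ f g h []      = ℚ.*-distribˡ-+ (f []) (g []) (h [])
∗-distribˡ f g h (l ∷ w) rewrite ∗-distribˡ (f ∘ (l ∷_)) g h w =
  solve 5 (λ a b c u v → a :* (b :+ c) :+ (u :+ v) := (a :* b :+ u) :+ (a :* c :+ v)) refl
    (f []) (g (l ∷ w)) (h (l ∷ w)) ((f ∘ (l ∷_) ∗ g) w) ((f ∘ (l ∷_) ∗ h) w)

∗-distribʳ : ∀ f g h → (f ⊞ g) ∗ h ≗ f ∗ h ⊞ g ∗ h
∗-distribʳ f g h []      = ℚ.*-distribʳ-+ (h []) (f []) (g [])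
∗-distribʳ f g h (l ∷ w) =
  trans (cong (λ z → (f [] + g []) * h (l ∷ w) + z) (∗-distribʳ (f ∘ (l ∷_)) (g ∘ (l ∷_)) h w))
  (solve 5 (λ a b c u v → (a :+ b) :* c :+ (u :+ v) := (a :* c :+ u) :+ (b :* c :+ v)) refl
    (f []) (g []) (h (l ∷ w)) ((f ∘ (l ∷_) ∗ h) w) ((g ∘ (l ∷_) ∗ h) w))

∗-scaleˡ : ∀ c f g w → ((λ v → c * f v) ∗ g) w ≡ c * (f ∗ g) w
∗-scaleˡ c f g []      = ℚ.*-assoc c (f []) (g [])
∗-scaleˡ c f g (l ∷ w) =
  trans (cong (λ z → (c * f []) * g (l ∷ w) + z) (∗-scaleˡ c (f ∘ (l ∷_)) g w))
  (solve 4 (λ c a b u → (c :* a) :* b :+ c :* u := c :* (a :* b :+ u)) refl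
    c (f []) (g (l ∷ w)) ((f ∘ (l ∷_) ∗ g) w))

∗-zeroˡ : ∀ f g → (∀ v → f v ≡ 0ℚ) → ∀ w → (f ∗ g) w ≡ 0ℚ
∗-zeroˡ f g f≡0 []      = trans (cong (_* g []) (f≡0 [])) (ℚ.*-zeroˡ (g []))
∗-zeroˡ f g f≡0 (l ∷ w) = cong₂ _+_ (trans (cong (_* g (l ∷ w)) (f≡0 [])) (ℚ.*-zeroˡ (g (l ∷ w))))
                                   (∗-zeroˡ (f ∘ (l ∷_)) g (f≡0 ∘ (l ∷_)) w)

▸-∗ : ∀ χ f g → (χ ▸ f) ∗ g ≗ χ ▸ (f ∗ g)
▸-∗ χ f g []      = ℚ.*-zeroˡ (g [])
▸-∗ χ f g (l ∷ w) = trans (cong₂ _+_ (ℚ.*-zeroˡ (g (l ∷ w))) (∗-scaleˡ (χ l) f g w)) (ℚ.+-identityˡ _)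

∗-assoc : ∀ f g h → (f ∗ g) ∗ h ≗ f ∗ (g ∗ h)
∗-assoc f g h []      = ℚ.*-assoc (f []) (g []) (h [])
∗-assoc f g h (l ∷ w) =
  trans (cong (λ z → (f [] * g []) * h (l ∷ w) + z)
    (trans (∗-distribʳ (λ v → f [] * g (l ∷ v)) (f ∘ (l ∷_) ∗ g) h w)
      (cong₂ _+_ (∗-scaleˡ (f []) (g ∘ (l ∷_)) h w) (∗-assoc (f ∘ (l ∷_)) g h w))))
  (solve 5 (λ a b c u v → (a :* b) :* c :+ (a :* u :+ v) := a :* (b :* c :+ u) :+ v) refl
    (f []) (g []) (h (l ∷ w)) ((g ∘ (l ∷_) ∗ h) w) ((f ∘ (l ∷_) ∗ (g ∗ h)) w))

-- The linear forms ↓, ↑ and ↓ - ↑.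
χ↓ χ↑ σ : Letter → ℚ
χ↓ ↓ = 1ℚ
χ↓ ↑ = 0ℚ
χ↑ ↓ = 0ℚ
χ↑ ↑ = 1ℚ
σ  ↓ = 1ℚ
σ  ↑ = - 1ℚ

χ↓≗χ↑+σ : ∀ f → χ↓ ▸ f ≗ χ↑ ▸ f ⊞ σ ▸ f
χ↓≗χ↑+σ f []      = refl
χ↓≗χ↑+σ f (↓ ∷ w) = solve 1 (λ u → con 1ℚ :* u := con 0ℚ :* u :+ con 1ℚ :* u) refl (f w)
χ↓≗χ↑+σ f (↑ ∷ w) = solve 1 (λ u → con 0ℚ :* u := con 1ℚ :* u :+ con (- 1ℚ) :* u) refl (f w)

-- The coefficient of f ∗ (χ ▸ g) at w depends only on those of g at shorter words.
∗-▸-local : ∀ χ f g g′ w → (∀ v → length v ℕ.< length w → g v ≡ g′ v) →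
  (f ∗ (χ ▸ g)) w ≡ (f ∗ (χ ▸ g′)) w
∗-▸-local χ f g g′ []      eq = refl
∗-▸-local χ f g g′ (l ∷ w) eq = cong₂ _+_
  (cong (λ z → f [] * (χ l * z)) (eq w ℕ.≤-refl))
  (∗-▸-local χ (f ∘ (l ∷_)) g g′ w (λ v v<w → eq v (ℕ.m≤n⇒m≤1+n v<w)))

fixpoint-unique : ∀ χ a f g h → g ≗ a ⊞ f ∗ (χ ▸ g) → h ≗ a ⊞ f ∗ (χ ▸ h) → g ≗ h
fixpoint-unique χ a f g h g-eq h-eq w = bounded (suc (length w)) w ℕ.≤-refl
  where
  bounded : ∀ n w → length w ℕ.< n → g w ≡ h w
  bounded (suc n) w (s≤s w≤n) = trans (g-eq w) (trans
    (cong (λ z → a w + z) (∗-▸-local χ f g h w λ v v<w → bounded n v (ℕ.<-≤-trans v<w w≤n)))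
    (sym (h-eq w)))

-- Chains with strict and weak descents

abstract

  -- inv n is 1 / (n + 1).
  inv : ℕ → ℚ
  inv n = (ℚ.1/ nat (suc n)) {{ℚ.pos⇒nonZero (nat (suc n)) {{ℚ.positive (0<nat n)}}}}

  inv-inverse : ∀ n → nat (suc n) * inv n ≡ 1ℚ
  inv-inverse n = ℚ.*-inverseʳ (nat (suc n)) {{ℚ.pos⇒nonZero (nat (suc n)) {{ℚ.positive (0<nat n)}}}}

  0≤inv : ∀ n → 0ℚ ≤ inv n
  0≤inv n = ℚ.<⇒≤ (ℚ.positive⁻¹ (inv n) {{ℚ.1/pos⇒pos (nat (suc n)) {{ℚ.positive (0<nat n)}}}})

-- The number of letters ↓, and of letters ↑.
downs ups : Word → ℕ
downs []      = 0
downs (↓ ∷ w) = suc (downs w)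
downs (↑ ∷ w) = downs w
ups []      = 0
ups (↓ ∷ w) = ups w
ups (↑ ∷ w) = suc (ups w)

-- 1 / (a + b + 2) for a word with a letters ↓ and b letters ↑.
recip : Word → ℚ
recip w = inv (suc (downs w ℕ.+ ups w))

-- For w with a letters ↓ and b letters ↑ this is the polynomial
-- (-1)^b C(x + a, a + b + 1), built one factor (x + a + 1) / (a + b + 2) or
-- - (x - b - 1) / (a + b + 2) at a time.  At a natural number t it counts, with
-- sign (-1)^b, the sequences in {0, …, t - 1} of length a + b + 1 that descend
-- weakly at ↓ and strictly at ↑.
chain : Word → Polynomial
chain []      = 0ℚ ∷ 1ℚ ∷ []
chain (↓ ∷ w) = ((1ℚ + nat (downs w)) * recip w ∷ recip w ∷ []) *ᴾ chain w
chain (↑ ∷ w) = ((1ℚ + nat (ups w)) * recip w ∷ - recip w ∷ []) *ᴾ chain w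

recip-inverse : ∀ w → ((1ℚ + nat (downs w)) + (1ℚ + nat (ups w))) * recip w ≡ 1ℚ
recip-inverse w = trans (cong (_* recip w) eq) (inv-inverse (suc (downs w ℕ.+ ups w)))
  where
  a = downs w
  b = ups w
  eq : (1ℚ + nat a) + (1ℚ + nat b) ≡ nat (suc (suc (a ℕ.+ b)))
  eq = sym (trans (nat-suc (suc (a ℕ.+ b))) (trans (cong (λ z → 1ℚ + z) (trans (nat-suc (a ℕ.+ b)) (cong (λ z → 1ℚ + z) (nat-+ a b))))
    (solve 2 (λ a b → con 1ℚ :+ (con 1ℚ :+ (a :+ b)) := (con 1ℚ :+ a) :+ (con 1ℚ :+ b)) refl (nat a) (nat b))))

eval-chain-↓ : ∀ w x → eval (chain (↓ ∷ w)) x ≡ ((1ℚ + nat (downs w)) + x) * recip w * eval (chain w) x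
eval-chain-↓ w x = trans (eval-* _ (chain w) x)
  (solve 4 (λ a x e u → ((con 1ℚ :+ a) :* e :+ x :* (e :+ x :* con 0ℚ)) :* u := ((con 1ℚ :+ a) :+ x) :* e :* u)
    refl (nat (downs w)) x (recip w) (eval (chain w) x))

eval-chain-↑ : ∀ w x → eval (chain (↑ ∷ w)) x ≡ ((1ℚ + nat (ups w)) - x) * recip w * eval (chain w) x
eval-chain-↑ w x = trans (eval-* _ (chain w) x)
  (solve 4 (λ b x e u → ((con 1ℚ :+ b) :* e :+ x :* (:- e :+ x :* con 0ℚ)) :* u := ((con 1ℚ :+ b) :- x) :* e :* u)
    refl (nat (ups w)) x (recip w) (eval (chain w) x))

-- Shifting (x + a) ⋯ (x - b) by one exchanges the factor x - b for x + 1 + a.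
chain-ratio : ∀ w x → eval (chain w) (1ℚ + x) * (x - nat (ups w)) ≡ eval (chain w) x * ((1ℚ + x) + nat (downs w))
chain-ratio [] x rewrite int-0 = solve 1 (λ x → (con 0ℚ :+ (con 1ℚ :+ x) :* (con 1ℚ :+ (con 1ℚ :+ x) :* con 0ℚ)) :* (x :- con 0ℚ)
  := (con 0ℚ :+ x :* (con 1ℚ :+ x :* con 0ℚ)) :* ((con 1ℚ :+ x) :+ con 0ℚ)) refl x
chain-ratio (↓ ∷ w) x = begin
  eval (chain (↓ ∷ w)) (1ℚ + x) * (x - b)
    ≡⟨ cong (_* (x - b)) (eval-chain-↓ w (1ℚ + x)) ⟩
  ((1ℚ + a) + (1ℚ + x)) * e * u * (x - b)
    ≡⟨ solve 5 (λ a b x e u → ((con 1ℚ :+ a) :+ (con 1ℚ :+ x)) :* e :* u :* (x :- b)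
         := ((con 1ℚ :+ a) :+ (con 1ℚ :+ x)) :* e :* (u :* (x :- b))) refl a b x e u ⟩
  ((1ℚ + a) + (1ℚ + x)) * e * (u * (x - b))
    ≡⟨ cong (λ z → ((1ℚ + a) + (1ℚ + x)) * e * z) (chain-ratio w x) ⟩
  ((1ℚ + a) + (1ℚ + x)) * e * (v * ((1ℚ + x) + a))
    ≡⟨ solve 4 (λ a x e v → ((con 1ℚ :+ a) :+ (con 1ℚ :+ x)) :* e :* (v :* ((con 1ℚ :+ x) :+ a))
         := ((con 1ℚ :+ a) :+ x) :* e :* v :* ((con 1ℚ :+ x) :+ (con 1ℚ :+ a))) refl a x e v ⟩
  ((1ℚ + a) + x) * e * v * ((1ℚ + x) + (1ℚ + a))
    ≡⟨ cong₂ (λ y z → y * ((1ℚ + x) + z)) (eval-chain-↓ w x) (nat-suc (downs w)) ⟨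
  eval (chain (↓ ∷ w)) x * ((1ℚ + x) + nat (suc (downs w))) ∎
  where
  open ≡-Reasoning
  a = nat (downs w)
  b = nat (ups w)
  e = recip w
  u = eval (chain w) (1ℚ + x)
  v = eval (chain w) x
chain-ratio (↑ ∷ w) x = begin
  eval (chain (↑ ∷ w)) (1ℚ + x) * (x - nat (suc (ups w)))
    ≡⟨ cong₂ (λ y z → y * (x - z)) (eval-chain-↑ w (1ℚ + x)) (nat-suc (ups w)) ⟩
  ((1ℚ + b) - (1ℚ + x)) * e * u * (x - (1ℚ + b))
    ≡⟨ solve 4 (λ b x e u → ((con 1ℚ :+ b) :- (con 1ℚ :+ x)) :* e :* u :* (x :- (con 1ℚ :+ b))
         := ((con 1ℚ :+ b) :- x) :* e :* (u :* (x :- b))) refl b x e u ⟩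
  ((1ℚ + b) - x) * e * (u * (x - b))
    ≡⟨ cong (λ z → ((1ℚ + b) - x) * e * z) (chain-ratio w x) ⟩
  ((1ℚ + b) - x) * e * (v * ((1ℚ + x) + a))
    ≡⟨ ℚ.*-assoc (((1ℚ + b) - x) * e) v ((1ℚ + x) + a) ⟨
  ((1ℚ + b) - x) * e * v * ((1ℚ + x) + a)
    ≡⟨ cong (_* ((1ℚ + x) + a)) (eval-chain-↑ w x) ⟨
  eval (chain (↑ ∷ w)) x * ((1ℚ + x) + a) ∎
  where
  open ≡-Reasoning
  a = nat (downs w)
  b = nat (ups w)
  e = recip w
  u = eval (chain w) (1ℚ + x)
  v = eval (chain w) x

-- Pascal recurrences, for the values and for the derivatives.
chain-↓ : ∀ w x → eval (chain (↓ ∷ w)) (1ℚ + x) ≡ eval (chain (↓ ∷ w)) x + eval (chain w) (1ℚ + x)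
chain-↓ w x = begin
  eval (chain (↓ ∷ w)) (1ℚ + x)
    ≡⟨ eval-chain-↓ w (1ℚ + x) ⟩
  ((1ℚ + a) + (1ℚ + x)) * e * u
    ≡⟨ solve 5 (λ a b x e u → ((con 1ℚ :+ a) :+ (con 1ℚ :+ x)) :* e :* u
         := e :* (u :* (x :- b)) :+ ((con 1ℚ :+ a) :+ (con 1ℚ :+ b)) :* e :* u) refl a b x e u ⟩
  e * (u * (x - b)) + ((1ℚ + a) + (1ℚ + b)) * e * u
    ≡⟨ cong₂ (λ y z → e * y + z * u) (chain-ratio w x) (recip-inverse w) ⟩
  e * (v * ((1ℚ + x) + a)) + 1ℚ * u
    ≡⟨ solve 5 (λ a x e u v → e :* (v :* ((con 1ℚ :+ x) :+ a)) :+ con 1ℚ :* u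
         := ((con 1ℚ :+ a) :+ x) :* e :* v :+ u) refl a x e u v ⟩
  ((1ℚ + a) + x) * e * v + u
    ≡⟨ cong (_+ u) (eval-chain-↓ w x) ⟨
  eval (chain (↓ ∷ w)) x + u ∎
  where
  open ≡-Reasoning
  a = nat (downs w)
  b = nat (ups w)
  e = recip w
  u = eval (chain w) (1ℚ + x)
  v = eval (chain w) x

chain-↑ : ∀ w x → eval (chain (↑ ∷ w)) (1ℚ + x) ≡ eval (chain (↑ ∷ w)) x + (- 1ℚ) * eval (chain w) x
chain-↑ w x = begin
  eval (chain (↑ ∷ w)) (1ℚ + x)
    ≡⟨ eval-chain-↑ w (1ℚ + x) ⟩
  ((1ℚ + b) - (1ℚ + x)) * e * u
    ≡⟨ solve 4 (λ b x e u → ((con 1ℚ :+ b) :- (con 1ℚ :+ x)) :* e :* u := :- (e :* (u :* (x :- b)))) refl b x e u ⟩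
  - (e * (u * (x - b)))
    ≡⟨ cong (λ z → - (e * z)) (chain-ratio w x) ⟩
  - (e * (v * ((1ℚ + x) + a)))
    ≡⟨ solve 5 (λ a b x e v → :- (e :* (v :* ((con 1ℚ :+ x) :+ a)))
         := ((con 1ℚ :+ b) :- x) :* e :* v :- ((con 1ℚ :+ a) :+ (con 1ℚ :+ b)) :* e :* v) refl a b x e v ⟩
  ((1ℚ + b) - x) * e * v - ((1ℚ + a) + (1ℚ + b)) * e * v
    ≡⟨ cong (λ z → ((1ℚ + b) - x) * e * v - z * v) (recip-inverse w) ⟩
  ((1ℚ + b) - x) * e * v - 1ℚ * v
    ≡⟨ solve 2 (λ y v → y :- con 1ℚ :* v := y :+ con (- 1ℚ) :* v) refl (((1ℚ + b) - x) * e * v) v ⟩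
  ((1ℚ + b) - x) * e * v + (- 1ℚ) * v
    ≡⟨ cong (_+ (- 1ℚ) * v) (eval-chain-↑ w x) ⟨
  eval (chain (↑ ∷ w)) x + (- 1ℚ) * v ∎
  where
  open ≡-Reasoning
  a = nat (downs w)
  b = nat (ups w)
  e = recip w
  u = eval (chain w) (1ℚ + x)
  v = eval (chain w) x

chain-↓′ : ∀ w x → evalD (chain (↓ ∷ w)) (1ℚ + x) ≡ evalD (chain (↓ ∷ w)) x + evalD (chain w) (1ℚ + x)
chain-↓′ w x = begin
  evalD (chain (↓ ∷ w)) (1ℚ + x)
    ≡⟨ evalD-shift (chain (↓ ∷ w)) x ⟨
  evalD (shift (chain (↓ ∷ w))) x
    ≡⟨ evalD-agree (shift (chain (↓ ∷ w))) (chain (↓ ∷ w) +ᴾ shift (chain w)) agree x ⟩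
  evalD (chain (↓ ∷ w) +ᴾ shift (chain w)) x
    ≡⟨ evalD-+ (chain (↓ ∷ w)) (shift (chain w)) x ⟩
  evalD (chain (↓ ∷ w)) x + evalD (shift (chain w)) x
    ≡⟨ cong (λ z → evalD (chain (↓ ∷ w)) x + z) (evalD-shift (chain w) x) ⟩
  evalD (chain (↓ ∷ w)) x + evalD (chain w) (1ℚ + x) ∎
  where
  open ≡-Reasoning
  agree : Agree (shift (chain (↓ ∷ w))) (chain (↓ ∷ w) +ᴾ shift (chain w))
  agree y = trans (eval-shift (chain (↓ ∷ w)) y) (trans (chain-↓ w y)
    (sym (trans (eval-+ (chain (↓ ∷ w)) (shift (chain w)) y) (cong (λ z → eval (chain (↓ ∷ w)) y + z) (eval-shift (chain w) y)))))

chain-↑′ : ∀ w x → evalD (chain (↑ ∷ w)) (1ℚ + x) ≡ evalD (chain (↑ ∷ w)) x + (- 1ℚ) * evalD (chain w) x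
chain-↑′ w x = begin
  evalD (chain (↑ ∷ w)) (1ℚ + x)
    ≡⟨ evalD-shift (chain (↑ ∷ w)) x ⟨
  evalD (shift (chain (↑ ∷ w))) x
    ≡⟨ evalD-agree (shift (chain (↑ ∷ w))) (chain (↑ ∷ w) +ᴾ (- 1ℚ) ·ᴾ chain w) agree x ⟩
  evalD (chain (↑ ∷ w) +ᴾ (- 1ℚ) ·ᴾ chain w) x
    ≡⟨ evalD-+ (chain (↑ ∷ w)) ((- 1ℚ) ·ᴾ chain w) x ⟩
  evalD (chain (↑ ∷ w)) x + evalD ((- 1ℚ) ·ᴾ chain w) x
    ≡⟨ cong (λ z → evalD (chain (↑ ∷ w)) x + z) (evalD-· (- 1ℚ) (chain w) x) ⟩
  evalD (chain (↑ ∷ w)) x + (- 1ℚ) * evalD (chain w) x ∎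
  where
  open ≡-Reasoning
  agree : Agree (shift (chain (↑ ∷ w))) (chain (↑ ∷ w) +ᴾ (- 1ℚ) ·ᴾ chain w)
  agree y = trans (eval-shift (chain (↑ ∷ w)) y) (trans (chain-↑ w y)
    (sym (trans (eval-+ (chain (↑ ∷ w)) ((- 1ℚ) ·ᴾ chain w) y) (cong (λ z → eval (chain (↑ ∷ w)) y + z) (eval-· (- 1ℚ) (chain w) y)))))

*-zero : ∀ k {y z} → y ≡ k * z → z ≡ 0ℚ → y ≡ 0ℚ
*-zero k y≡kz z≡0 = trans y≡kz (trans (cong (k *_) z≡0) (ℚ.*-zeroʳ k))

chain-zero : ∀ w → eval (chain w) 0ℚ ≡ 0ℚ
chain-zero []      = refl
chain-zero (↓ ∷ w) = *-zero (((1ℚ + nat (downs w)) + 0ℚ) * recip w) (eval-chain-↓ w 0ℚ) (chain-zero w)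
chain-zero (↑ ∷ w) = *-zero (((1ℚ + nat (ups w)) - 0ℚ) * recip w) (eval-chain-↑ w 0ℚ) (chain-zero w)

-- The derivative of chain w at 0, equal to a! b! / (a + b + 1)!.
slope : Series
slope w = evalD (chain w) 0ℚ

slope-nonneg : ∀ w → 0ℚ ≤ slope w
-- chain w vanishes at 0, so a factor k + e x with k ≥ 0 multiplies the slope by k.
slope-factor-nonneg : ∀ n e w → 0ℚ ≤ evalD (((1ℚ + nat n) * recip w ∷ e ∷ []) *ᴾ chain w) 0ℚ

slope-nonneg []      = ℚ.<⇒≤ (ℚ.positive⁻¹ 1ℚ)
slope-nonneg (↓ ∷ w) = slope-factor-nonneg (downs w) (recip w) w
slope-nonneg (↑ ∷ w) = slope-factor-nonneg (ups w) (- recip w) w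

slope-factor-nonneg n e w = subst (0ℚ ≤_) (sym eq)
  (*-nonneg (*-nonneg (subst (0ℚ ≤_) (nat-suc n) (0≤nat (suc n))) (0≤inv (suc (downs w ℕ.+ ups w)))) (slope-nonneg w))
  where
  k = (1ℚ + nat n) * recip w
  eq : evalD ((k ∷ e ∷ []) *ᴾ chain w) 0ℚ ≡ k * slope w
  eq = trans (evalD-* (k ∷ e ∷ []) (chain w) 0ℚ)
    (trans (cong (λ z → evalD (k ∷ e ∷ []) 0ℚ * z + eval (k ∷ e ∷ []) 0ℚ * slope w) (chain-zero w))
    (solve 4 (λ d k e v → d :* con 0ℚ :+ (k :+ con 0ℚ :* (e :+ con 0ℚ :* con 0ℚ)) :* v := k :* v) refl
      (evalD (k ∷ e ∷ []) 0ℚ) k e (slope w)))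

-- Values and derivatives of the chain polynomials at t.
ℓ ℓ′ : ℕ → Series
ℓ  t w = eval (chain w) (nat t)
ℓ′ t w = evalD (chain w) (nat t)

ℓ-[] : ∀ t → ℓ t [] ≡ nat t
ℓ-[] t = solve 1 (λ x → con 0ℚ :+ x :* (con 1ℚ :+ x :* con 0ℚ) := x) refl (nat t)

ℓ-[]-suc : ∀ t → ℓ (suc t) [] ≡ 1ℚ + ℓ t []
ℓ-[]-suc t = trans (ℓ-[] (suc t)) (trans (nat-suc t) (cong (λ z → 1ℚ + z) (sym (ℓ-[] t))))

ℓ↓ : ∀ t w → ℓ (suc t) (↓ ∷ w) ≡ ℓ t (↓ ∷ w) + ℓ (suc t) w
ℓ↓ t w rewrite nat-suc t = chain-↓ w (nat t)

ℓ↑ : ∀ t w → ℓ (suc t) (↑ ∷ w) ≡ ℓ t (↑ ∷ w) + (- 1ℚ) * ℓ t w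
ℓ↑ t w rewrite nat-suc t = chain-↑ w (nat t)

ℓ′↓ : ∀ t w → ℓ′ (suc t) (↓ ∷ w) ≡ ℓ′ t (↓ ∷ w) + ℓ′ (suc t) w
ℓ′↓ t w rewrite nat-suc t = chain-↓′ w (nat t)

ℓ′↑ : ∀ t w → ℓ′ (suc t) (↑ ∷ w) ≡ ℓ′ t (↑ ∷ w) + (- 1ℚ) * ℓ′ t w
ℓ′↑ t w rewrite nat-suc t = chain-↑′ w (nat t)

ℓ-zero : ∀ w → ℓ 0 w ≡ 0ℚ
ℓ-zero w = trans (cong (eval (chain w)) int-0) (chain-zero w)

-- The differential equation dℓ/dt = V + ℓ (↓ - ↑) V for V = slope.  Both sides
-- satisfy the Pascal recurrences for derivatives, and they agree at t = 0.
ℓ-flow : ∀ t → ℓ′ t ≗ slope ⊞ ℓ t ∗ σ ▸ slope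
ℓ-flow zero w = trans (cong (evalD (chain w)) int-0)
  (sym (trans (cong (λ z → slope w + z) (∗-zeroˡ (ℓ 0) (σ ▸ slope) ℓ-zero w)) (ℚ.+-identityʳ (slope w))))
ℓ-flow (suc t) [] =
  solve 2 (λ x u → con 1ℚ :+ x :* con 0ℚ :+ x :* (con 0ℚ :+ x :* con 0ℚ) := con 1ℚ :+ u :* con 0ℚ) refl
    (nat (suc t)) (ℓ (suc t) [])
ℓ-flow (suc t) (↓ ∷ w) = begin
  ℓ′ (suc t) (↓ ∷ w)
    ≡⟨ ℓ′↓ t w ⟩
  ℓ′ t (↓ ∷ w) + ℓ′ (suc t) w
    ≡⟨ cong₂ _+_ (ℓ-flow t (↓ ∷ w)) (ℓ-flow (suc t) w) ⟩
  (slope (↓ ∷ w) + (ℓ t [] * (1ℚ * slope w) + p)) + (slope w + q)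
    ≡⟨ solve 5 (λ v₁ v x p q → (v₁ :+ (x :* (con 1ℚ :* v) :+ p)) :+ (v :+ q)
         := v₁ :+ ((con 1ℚ :+ x) :* (con 1ℚ :* v) :+ (p :+ q))) refl (slope (↓ ∷ w)) (slope w) (ℓ t []) p q ⟩
  slope (↓ ∷ w) + ((1ℚ + ℓ t []) * (1ℚ * slope w) + (p + q))
    ≡⟨ cong₂ (λ y z → slope (↓ ∷ w) + (y * (1ℚ * slope w) + z)) (ℓ-[]-suc t)
         (trans (∗-congʳ (σ ▸ slope) (ℓ↓ t) w) (∗-distribʳ (ℓ t ∘ (↓ ∷_)) (ℓ (suc t)) (σ ▸ slope) w)) ⟨
  slope (↓ ∷ w) + (ℓ (suc t) ∗ σ ▸ slope) (↓ ∷ w) ∎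
  where
  open ≡-Reasoning
  p = (ℓ t ∘ (↓ ∷_) ∗ σ ▸ slope) w
  q = (ℓ (suc t) ∗ σ ▸ slope) w
ℓ-flow (suc t) (↑ ∷ w) = begin
  ℓ′ (suc t) (↑ ∷ w)
    ≡⟨ ℓ′↑ t w ⟩
  ℓ′ t (↑ ∷ w) + (- 1ℚ) * ℓ′ t w
    ≡⟨ cong₂ (λ y z → y + (- 1ℚ) * z) (ℓ-flow t (↑ ∷ w)) (ℓ-flow t w) ⟩
  (slope (↑ ∷ w) + (ℓ t [] * (- 1ℚ * slope w) + p)) + (- 1ℚ) * (slope w + q)
    ≡⟨ solve 5 (λ v₁ v x p q → (v₁ :+ (x :* (con (- 1ℚ) :* v) :+ p)) :+ con (- 1ℚ) :* (v :+ q)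
         := v₁ :+ ((con 1ℚ :+ x) :* (con (- 1ℚ) :* v) :+ (p :+ con (- 1ℚ) :* q))) refl (slope (↑ ∷ w)) (slope w) (ℓ t []) p q ⟩
  slope (↑ ∷ w) + ((1ℚ + ℓ t []) * (- 1ℚ * slope w) + (p + (- 1ℚ) * q))
    ≡⟨ cong₂ (λ y z → slope (↑ ∷ w) + (y * (- 1ℚ * slope w) + z)) (ℓ-[]-suc t)
         (trans (∗-congʳ (σ ▸ slope) (ℓ↑ t) w)
           (trans (∗-distribʳ (ℓ t ∘ (↑ ∷_)) (λ v → (- 1ℚ) * ℓ t v) (σ ▸ slope) w)
             (cong (λ z → p + z) (∗-scaleˡ (- 1ℚ) (ℓ t) (σ ▸ slope) w)))) ⟨
  slope (↑ ∷ w) + (ℓ (suc t) ∗ σ ▸ slope) (↑ ∷ w) ∎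
  where
  open ≡-Reasoning
  p = (ℓ t ∘ (↑ ∷_) ∗ σ ▸ slope) w
  q = (ℓ t ∗ σ ▸ slope) w

-- Order polynomials of fences

infixl 7 _∗ᴾ_

_∗ᴾ_ : (Word → Polynomial) → (Word → Polynomial) → Word → Polynomial
_∗ᴾ_ = convolve _+ᴾ_ _*ᴾ_

-- Left multiplication by the variables ↑ and ↓.  The zero polynomial is the empty
-- list, so that products with it have no coefficients to be checked.
up down : (Word → Polynomial) → Word → Polynomial
up f (↑ ∷ w) = f w
up f _       = []
down f (↓ ∷ w) = f w
down f _       = []

eval-∗ : ∀ f g x w → eval ((f ∗ᴾ g) w) x ≡ ((λ v → eval (f v) x) ∗ (λ v → eval (g v) x)) w
eval-∗ f g x []      = eval-* (f []) (g []) x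
eval-∗ f g x (l ∷ w) = trans (eval-+ (f [] *ᴾ g (l ∷ w)) _ x)
  (cong₂ _+_ (eval-* (f []) (g (l ∷ w)) x) (eval-∗ (f ∘ (l ∷_)) g x w))

evalD-∗ : ∀ f g x w → evalD ((f ∗ᴾ g) w) x ≡
  ((λ v → evalD (f v) x) ∗ (λ v → eval (g v) x)) w + ((λ v → eval (f v) x) ∗ (λ v → evalD (g v) x)) w
evalD-∗ f g x []      = evalD-* (f []) (g []) x
evalD-∗ f g x (l ∷ w) = trans (evalD-+ (f [] *ᴾ g (l ∷ w)) _ x)
  (trans (cong₂ _+_ (evalD-* (f []) (g (l ∷ w)) x) (evalD-∗ (f ∘ (l ∷_)) g x w))
    (solve 4 (λ a b c d → (a :+ b) :+ (c :+ d) := (a :+ c) :+ (b :+ d)) refl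
      (evalD (f []) x * eval (g (l ∷ w)) x) (eval (f []) x * evalD (g (l ∷ w)) x) _ _))

eval-up : ∀ f x → (λ v → eval (up f v) x) ≗ χ↑ ▸ (λ v → eval (f v) x)
eval-up f x []      = refl
eval-up f x (↓ ∷ w) = sym (ℚ.*-zeroˡ (eval (f w) x))
eval-up f x (↑ ∷ w) = sym (ℚ.*-identityˡ (eval (f w) x))

eval-down : ∀ f x → (λ v → eval (down f v) x) ≗ χ↓ ▸ (λ v → eval (f v) x)
eval-down f x []      = refl
eval-down f x (↑ ∷ w) = sym (ℚ.*-zeroˡ (eval (f w) x))
eval-down f x (↓ ∷ w) = sym (ℚ.*-identityˡ (eval (f w) x))

evalD-up : ∀ f x → (λ v → evalD (up f v) x) ≗ χ↑ ▸ (λ v → evalD (f v) x)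
evalD-up f x []      = refl
evalD-up f x (↓ ∷ w) = sym (ℚ.*-zeroˡ (evalD (f w) x))
evalD-up f x (↑ ∷ w) = sym (ℚ.*-identityˡ (evalD (f w) x))

-- The order polynomial of a fence: at a natural number t it counts the sequences
-- in {0, …, t - 1} of length |w| + 1 that descend weakly at ↓ and ascend weakly
-- at ↑.  It is the solution of fence = chain + chain ∗ ↑ fence, obtained by
-- cutting the word at the first ascent that is not traded for a strict descent;
-- ∗-up-fence f is the product f ∗ ↑ fence, spelt out to make the recursion on
-- words structural.
fence : Word → Polynomial
∗-up-fence : (Word → Polynomial) → Word → Polynomial

fence w = chain w +ᴾ ∗-up-fence chain w

∗-up-fence f []      = []
∗-up-fence f (↓ ∷ w) = f [] *ᴾ [] +ᴾ ∗-up-fence (f ∘ (↓ ∷_)) w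
∗-up-fence f (↑ ∷ w) = f [] *ᴾ fence w +ᴾ ∗-up-fence (f ∘ (↑ ∷_)) w

∗-up-fence-correct : ∀ f w → ∗-up-fence f w ≡ (f ∗ᴾ up fence) w
∗-up-fence-correct f []      = refl
∗-up-fence-correct f (↓ ∷ w) = ∗-up-fence-correct (f ∘ (↓ ∷_)) w
∗-up-fence-correct f (↑ ∷ w) = cong (λ z → f [] *ᴾ fence w +ᴾ z) (∗-up-fence-correct (f ∘ (↑ ∷_)) w)

-- Values and derivatives of the fence polynomials at t.
ξ ξ′ : ℕ → Series
ξ  t w = eval (fence w) (nat t)
ξ′ t w = evalD (fence w) (nat t)

ξ-eq : ∀ t → ξ t ≗ ℓ t ⊞ ℓ t ∗ χ↑ ▸ ξ t
ξ-eq t w rewrite ∗-up-fence-correct chain w = trans (eval-+ (chain w) ((chain ∗ᴾ up fence) w) (nat t))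
  (cong (λ z → ℓ t w + z) (trans (eval-∗ chain (up fence) (nat t) w) (∗-congˡ (ℓ t) (eval-up fence (nat t)) w)))

ξ′-eq : ∀ t → ξ′ t ≗ (ℓ′ t ⊞ ℓ′ t ∗ χ↑ ▸ ξ t) ⊞ ℓ t ∗ χ↑ ▸ ξ′ t
ξ′-eq t w rewrite ∗-up-fence-correct chain w = trans (evalD-+ (chain w) ((chain ∗ᴾ up fence) w) (nat t))
  (trans (cong (λ z → ℓ′ t w + z) (trans (evalD-∗ chain (up fence) (nat t) w)
      (cong₂ _+_ (∗-congˡ (ℓ′ t) (eval-up fence (nat t)) w) (∗-congˡ (ℓ t) (evalD-up fence (nat t)) w))))
    (sym (ℚ.+-assoc (ℓ′ t w) _ _)))

-- υ is V (1 + ↑ ξ) and ω is (1 + ξ ↓) V (1 + ↑ ξ), for V = slope.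
υ ω : ℕ → Series
υ t = slope ⊞ slope ∗ χ↑ ▸ ξ t
ω t = υ t ⊞ ξ t ∗ χ↓ ▸ υ t

-- The differential equation dξ/dt = (1 + ξ ↓) V (1 + ↑ ξ): both sides solve
-- F = (υ + ℓ (↓ - ↑) υ) + ℓ ↑ F, which determines F.
ξ-flow : ∀ t → ξ′ t ≗ ω t
ξ-flow t = fixpoint-unique χ↑ (u ⊞ l ∗ σ ▸ u) l (ξ′ t) (ω t) ξ′-fix ω-fix
  where
  open ≡-Reasoning
  u = υ t
  l = ℓ t
  x = ξ t
  ξ′-fix : ξ′ t ≗ (u ⊞ l ∗ σ ▸ u) ⊞ l ∗ χ↑ ▸ ξ′ t
  ξ′-fix w = trans (ξ′-eq t w) (cong (λ z → z + (l ∗ χ↑ ▸ ξ′ t) w) (begin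
    ℓ′ t w + (ℓ′ t ∗ χ↑ ▸ x) w
      ≡⟨ cong₂ _+_ (ℓ-flow t w) (∗-congʳ (χ↑ ▸ x) (ℓ-flow t) w) ⟩
    (slope w + (l ∗ σ ▸ slope) w) + ((slope ⊞ l ∗ σ ▸ slope) ∗ χ↑ ▸ x) w
      ≡⟨ cong (λ z → (slope w + (l ∗ σ ▸ slope) w) + z) (trans (∗-distribʳ slope (l ∗ σ ▸ slope) (χ↑ ▸ x) w)
           (cong (λ z → (slope ∗ χ↑ ▸ x) w + z) (trans (∗-assoc l (σ ▸ slope) (χ↑ ▸ x) w)
             (∗-congˡ l (▸-∗ σ slope (χ↑ ▸ x)) w)))) ⟩
    (slope w + (l ∗ σ ▸ slope) w) + ((slope ∗ χ↑ ▸ x) w + (l ∗ σ ▸ (slope ∗ χ↑ ▸ x)) w)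
      ≡⟨ solve 4 (λ a b c d → (a :+ b) :+ (c :+ d) := (a :+ c) :+ (b :+ d)) refl
           (slope w) ((l ∗ σ ▸ slope) w) ((slope ∗ χ↑ ▸ x) w) ((l ∗ σ ▸ (slope ∗ χ↑ ▸ x)) w) ⟩
    u w + ((l ∗ σ ▸ slope) w + (l ∗ σ ▸ (slope ∗ χ↑ ▸ x)) w)
      ≡⟨ cong (λ z → u w + z) (trans (∗-congˡ l (▸-distrib σ slope (slope ∗ χ↑ ▸ x)) w)
           (∗-distribˡ l (σ ▸ slope) (σ ▸ (slope ∗ χ↑ ▸ x)) w)) ⟨
    u w + (l ∗ σ ▸ u) w ∎))
  ω-fix : ω t ≗ (u ⊞ l ∗ σ ▸ u) ⊞ l ∗ χ↑ ▸ ω t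
  ω-fix w = begin
    u w + (x ∗ χ↓ ▸ u) w
      ≡⟨ cong (λ z → u w + z) (trans (∗-congʳ (χ↓ ▸ u) (ξ-eq t) w) (∗-distribʳ l (l ∗ χ↑ ▸ x) (χ↓ ▸ u) w)) ⟩
    u w + ((l ∗ χ↓ ▸ u) w + ((l ∗ χ↑ ▸ x) ∗ χ↓ ▸ u) w)
      ≡⟨ cong₂ (λ y z → u w + (y + z))
           (trans (∗-congˡ l (χ↓≗χ↑+σ u) w) (∗-distribˡ l (χ↑ ▸ u) (σ ▸ u) w))
           (trans (∗-assoc l (χ↑ ▸ x) (χ↓ ▸ u) w) (∗-congˡ l (▸-∗ χ↑ x (χ↓ ▸ u)) w)) ⟩
    u w + (((l ∗ χ↑ ▸ u) w + (l ∗ σ ▸ u) w) + (l ∗ χ↑ ▸ (x ∗ χ↓ ▸ u)) w)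
      ≡⟨ solve 4 (λ a b c d → a :+ ((b :+ c) :+ d) := (a :+ c) :+ (b :+ d)) refl
           (u w) ((l ∗ χ↑ ▸ u) w) ((l ∗ σ ▸ u) w) ((l ∗ χ↑ ▸ (x ∗ χ↓ ▸ u)) w) ⟩
    (u w + (l ∗ σ ▸ u) w) + ((l ∗ χ↑ ▸ u) w + (l ∗ χ↑ ▸ (x ∗ χ↓ ▸ u)) w)
      ≡⟨ cong (λ z → (u w + (l ∗ σ ▸ u) w) + z) (trans (∗-congˡ l (▸-distrib χ↑ u (x ∗ χ↓ ▸ u)) w)
           (∗-distribˡ l (χ↑ ▸ u) (χ↑ ▸ (x ∗ χ↓ ▸ u)) w)) ⟨
    (u w + (l ∗ σ ▸ u) w) + (l ∗ χ↑ ▸ ω t) w ∎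

-- Nonnegativity of fence polynomials

constant : ℚ → Polynomial
constant c = c ∷ []

eval-constant : ∀ c x → eval (constant c) x ≡ c
eval-constant c x = solve 2 (λ c x → c :+ x :* con 0ℚ := c) refl c x

-- Polynomial-valued series whose values at t are slope, υ t and ω t.
slopeᴾ υᴾ ωᴾ : Word → Polynomial
slopeᴾ w = constant (slope w)
υᴾ w = slopeᴾ w +ᴾ (slopeᴾ ∗ᴾ up fence) w
ωᴾ w = υᴾ w +ᴾ (fence ∗ᴾ down υᴾ) w

eval-υ : ∀ t → (λ v → eval (υᴾ v) (nat t)) ≗ υ t
eval-υ t w = trans (eval-+ (slopeᴾ w) ((slopeᴾ ∗ᴾ up fence) w) (nat t)) (cong₂ _+_ (eval-constant (slope w) (nat t))
  (trans (eval-∗ slopeᴾ (up fence) (nat t) w) (∗-cong (λ v → eval-constant (slope v) (nat t)) (eval-up fence (nat t)) w)))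

eval-ω : ∀ t w → eval (ωᴾ w) (nat t) ≡ ω t w
eval-ω t w = trans (eval-+ (υᴾ w) ((fence ∗ᴾ down υᴾ) w) (nat t)) (cong₂ _+_ (eval-υ t w)
  (trans (eval-∗ fence (down υᴾ) (nat t) w)
    (∗-congˡ (ξ t) (λ v → trans (eval-down υᴾ (nat t) v) (▸-cong χ↓ (eval-υ t) v)) w)))

-- All coefficients of f w are nonnegative for the words w of length less than n.
NonNegBelow : ℕ → (Word → Polynomial) → Set
NonNegBelow n f = ∀ w → length w ℕ.< n → NonNeg (f w)

-- As g vanishes at the empty word, only the values of f at shorter words enter.
nonNegBelow-∗ : ∀ {n f g} → NonNegBelow n f → g [] ≡ [] → NonNegBelow (suc n) g → NonNegBelow (suc n) (f ∗ᴾ g)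
nonNegBelow-∗ {n} {f} {g} fs g[] gs []      _         = subst (λ z → NonNeg (f [] *ᴾ z)) (sym g[]) []
nonNegBelow-∗ {suc n} {f} {g} fs g[] gs (l ∷ w) (s≤s w<n) =
  nonNeg-+ (nonNeg-* (fs [] (s≤s z≤n)) (gs (l ∷ w) (s≤s w<n)))
    (nonNegBelow-∗ (λ v v<n → fs (l ∷ v) (s≤s v<n)) g[] (λ v v<n → gs v (ℕ.m≤n⇒m≤1+n v<n)) w w<n)

nonNegBelow-up : ∀ {n f} → NonNegBelow n f → NonNegBelow (suc n) (up f)
nonNegBelow-up fs []      _         = []
nonNegBelow-up fs (↓ ∷ w) _         = []
nonNegBelow-up fs (↑ ∷ w) (s≤s w<n) = fs w w<n

nonNegBelow-down : ∀ {n f} → NonNegBelow n f → NonNegBelow (suc n) (down f)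
nonNegBelow-down fs []      _         = []
nonNegBelow-down fs (↑ ∷ w) _         = []
nonNegBelow-down fs (↓ ∷ w) (s≤s w<n) = fs w w<n

ξ-zero : ∀ w → ξ 0 w ≡ 0ℚ
ξ-zero w = trans (ξ-eq 0 w) (cong₂ _+_ (ℓ-zero w) (∗-zeroˡ (ℓ 0) (χ↑ ▸ ξ 0) ℓ-zero w))

-- Induction on n: the derivative of fence w is ωᴾ w, which involves fence only at
-- words shorter than w.
fence-nonNegBelow : ∀ n → NonNegBelow n fence
fence-nonNegBelow (suc n) w w<1+n = nonNeg-from-derivative (fence w) (ωᴾ w)
  (ℚ.≤-reflexive (sym (trans (cong (eval (fence w)) (sym int-0)) (ξ-zero w))))
  (nonNeg-+ (υs w w<1+n) (nonNegBelow-∗ IH refl (nonNegBelow-down (λ v v<n → υs v (ℕ.m≤n⇒m≤1+n v<n))) w w<1+n))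
  (λ t → trans (ξ-flow t w) (sym (eval-ω t w)))
  where
  IH = fence-nonNegBelow n
  slopes : ∀ {m} → NonNegBelow m slopeᴾ
  slopes v _ = slope-nonneg v ∷ []
  υs : NonNegBelow (suc n) υᴾ
  υs v v<n = nonNeg-+ (slopes v v<n) (nonNegBelow-∗ slopes refl (nonNegBelow-up IH) v v<n)

fence-nonNeg : ∀ w → NonNeg (fence w)
fence-nonNeg w = fence-nonNegBelow (suc (length w)) w ℕ.≤-refl

-- Sums over initial segments of ℕ

-- Σ< n f is the sum of f i over i < n.
Σ< : ℕ → (ℕ → ℚ) → ℚ
Σ< zero    f = 0ℚ
Σ< (suc n) f = f 0 + Σ< n (f ∘ suc)

Σ<-cong : ∀ n {f g} → (∀ i → i ℕ.< n → f i ≡ g i) → Σ< n f ≡ Σ< n g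
Σ<-cong zero    eq = refl
Σ<-cong (suc n) eq = cong₂ _+_ (eq 0 (s≤s z≤n)) (Σ<-cong n λ i i<n → eq (suc i) (s≤s i<n))

Σ<-zero : ∀ n f → (∀ i → f i ≡ 0ℚ) → Σ< n f ≡ 0ℚ
Σ<-zero zero    f eq = refl
Σ<-zero (suc n) f eq = cong₂ _+_ (eq 0) (Σ<-zero n (f ∘ suc) (eq ∘ suc))

Σ<-+ : ∀ n f g → Σ< n (λ i → f i + g i) ≡ Σ< n f + Σ< n g
Σ<-+ zero    f g = refl
Σ<-+ (suc n) f g = trans (cong (λ z → (f 0 + g 0) + z) (Σ<-+ n (f ∘ suc) (g ∘ suc)))
  (solve 4 (λ a b c d → (a :+ b) :+ (c :+ d) := (a :+ c) :+ (b :+ d)) refl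
    (f 0) (g 0) (Σ< n (f ∘ suc)) (Σ< n (g ∘ suc)))

Σ<-split : ∀ m n f → Σ< (m ℕ.+ n) f ≡ Σ< m f + Σ< n (λ i → f (m ℕ.+ i))
Σ<-split zero    n f = sym (ℚ.+-identityˡ (Σ< n f))
Σ<-split (suc m) n f = trans (cong (λ z → f 0 + z) (Σ<-split m n (f ∘ suc)))
  (sym (ℚ.+-assoc (f 0) (Σ< m (f ∘ suc)) (Σ< n (λ i → f (suc m ℕ.+ i)))))

Σ<-last : ∀ n f → Σ< (suc n) f ≡ Σ< n f + f n
Σ<-last zero    f = ℚ.+-comm (f 0) 0ℚ
Σ<-last (suc n) f = trans (cong (λ z → f 0 + z) (Σ<-last n (f ∘ suc)))
  (sym (ℚ.+-assoc (f 0) (Σ< n (f ∘ suc)) (f (suc n))))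

Σ<-reverse : ∀ n f → Σ< (suc n) (λ i → f (n ∸ i)) ≡ Σ< (suc n) f
Σ<-reverse zero    f = refl
Σ<-reverse (suc n) f = begin
  f (suc n) + Σ< (suc n) (λ i → f (n ∸ i)) ≡⟨ cong (λ z → f (suc n) + z) (Σ<-reverse n f) ⟩
  f (suc n) + Σ< (suc n) f                 ≡⟨ ℚ.+-comm (f (suc n)) (Σ< (suc n) f) ⟩
  Σ< (suc n) f + f (suc n)                 ≡⟨ Σ<-last (suc n) f ⟨
  Σ< (suc (suc n)) f                       ∎
  where open ≡-Reasoning

Σ<-telescope : ∀ n m (F : ℕ → ℚ) → Σ< n (λ i → F (suc (m ℕ.+ i)) - F (m ℕ.+ i)) ≡ F (m ℕ.+ n) - F m
Σ<-telescope zero    m F = trans (sym (ℚ.+-inverseʳ (F m))) (cong (λ z → F z - F m) (sym (ℕ.+-identityʳ m)))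
Σ<-telescope (suc n) m F = begin
  (F (suc (m ℕ.+ 0)) - F (m ℕ.+ 0)) + Σ< n (λ i → F (suc (m ℕ.+ suc i)) - F (m ℕ.+ suc i))
    ≡⟨ cong₂ _+_ (cong (λ z → F (suc z) - F z) (ℕ.+-identityʳ m))
         (Σ<-cong n λ i _ → cong (λ z → F (suc z) - F z) (ℕ.+-suc m i)) ⟩
  (F (suc m) - F m) + Σ< n (λ i → F (suc (suc m ℕ.+ i)) - F (suc m ℕ.+ i))
    ≡⟨ cong (λ z → (F (suc m) - F m) + z) (Σ<-telescope n (suc m) F) ⟩
  (F (suc m) - F m) + (F (suc m ℕ.+ n) - F (suc m))
    ≡⟨ solve 3 (λ a b c → (b :- a) :+ (c :- b) := c :- a) refl (F m) (F (suc m)) (F (suc m ℕ.+ n)) ⟩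
  F (suc m ℕ.+ n) - F m
    ≡⟨ cong (λ z → F z - F m) (ℕ.+-suc m n) ⟨
  F (m ℕ.+ suc n) - F m ∎
  where open ≡-Reasoning

length-concatMap : ∀ {A : Set} n (f : ℕ → ℕ) (g : ℕ → List A) →
  nat (length (concatMap g (applyUpTo f n))) ≡ Σ< n (λ i → nat (length (g (f i))))
length-concatMap zero    f g = int-0
length-concatMap (suc n) f g = trans (cong nat (List.length-++ (g (f 0))))
  (trans (nat-+ (length (g (f 0))) _) (cong (λ z → nat (length (g (f 0))) + z) (length-concatMap n (f ∘ suc) g)))

-- Slack walks and words

-- The largest slack that a step of U allows, given the slack d before it.
raise : ℕ → Step → ℕ → ℕ
raise t E d = d
raise t N d = t ℕ.+ d

-- All vectors z such that the slack, starting from d, raised at each north step of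
-- U by t and then lowered by the entry of z, which is at most t, stays nonnegative
-- and ends at 0.
walks : ℕ → ∀ {n} → Vec Step n → ℕ → List (Vec ℕ n)
walks t []      zero    = [] ∷ []
walks t []      (suc d) = []
walks t (e ∷ U) d       =
  concatMap (λ z → map (z ∷_) (walks t U (raise t e d ∸ z))) (upTo (suc (t ⊓ raise t e d)))

-- The number of walks.
count : ℕ → ∀ {n} → Vec Step n → ℕ → ℚ
count t U d = nat (length (walks t U d))

count-∷ : ∀ t {n} e (U : Vec Step n) d →
  count t (e ∷ U) d ≡ Σ< (suc (t ⊓ raise t e d)) (λ z → count t U (raise t e d ∸ z))
count-∷ t e U d = trans (length-concatMap (suc (t ⊓ raise t e d)) id (λ z → map (z ∷_) (walks t U (raise t e d ∸ z))))
  (Σ<-cong (suc (t ⊓ raise t e d)) λ z _ → cong nat (List.length-map (z ∷_) (walks t U (raise t e d ∸ z))))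

-- The number of sequences counted by ξ t v whose first term is less than s, for
-- s ≤ t.
partial : ℕ → Word → ℕ → ℚ
partial t v s = ℓ s v + (ℓ s ∗ χ↑ ▸ ξ t) v

partial-zero : ∀ t v → partial t v 0 ≡ 0ℚ
partial-zero t v = cong₂ _+_ (ℓ-zero v) (∗-zeroˡ (ℓ 0) (χ↑ ▸ ξ t) ℓ-zero v)

partial-full : ∀ t v → partial t v t ≡ ξ t v
partial-full t v = sym (ξ-eq t v)

partial-[] : ∀ t s → partial t [] (suc s) - partial t [] s ≡ 1ℚ
partial-[] t s = begin
  (ℓ (suc s) [] + ℓ (suc s) [] * 0ℚ) - (ℓ s [] + ℓ s [] * 0ℚ)
    ≡⟨ cong₂ (λ y z → (y + y * 0ℚ) - (z + z * 0ℚ)) (trans (ℓ-[] (suc s)) (nat-suc s)) (ℓ-[] s) ⟩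
  ((1ℚ + nat s) + (1ℚ + nat s) * 0ℚ) - (nat s + nat s * 0ℚ)
    ≡⟨ solve 1 (λ x → ((con 1ℚ :+ x) :+ (con 1ℚ :+ x) :* con 0ℚ) :- (x :+ x :* con 0ℚ) := con 1ℚ) refl (nat s) ⟩
  1ℚ ∎
  where open ≡-Reasoning

partial-↓ : ∀ t v s → partial t (↓ ∷ v) (suc s) - partial t (↓ ∷ v) s ≡ partial t v (suc s)
partial-↓ t v s = begin
  (ℓ (suc s) (↓ ∷ v) + (ℓ (suc s) [] * (0ℚ * ξ t v) + (ℓ (suc s) ∘ (↓ ∷_) ∗ g) v)) - partial t (↓ ∷ v) s
    ≡⟨ cong₂ (λ y z → (y + (ℓ (suc s) [] * (0ℚ * ξ t v) + z)) - partial t (↓ ∷ v) s) (ℓ↓ s v)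
         (trans (∗-congʳ g (ℓ↓ s) v) (∗-distribʳ (ℓ s ∘ (↓ ∷_)) (ℓ (suc s)) g v)) ⟩
  ((ℓ s (↓ ∷ v) + ℓ (suc s) v) + (ℓ (suc s) [] * (0ℚ * ξ t v) + ((ℓ s ∘ (↓ ∷_) ∗ g) v + (ℓ (suc s) ∗ g) v)))
    - (ℓ s (↓ ∷ v) + (ℓ s [] * (0ℚ * ξ t v) + (ℓ s ∘ (↓ ∷_) ∗ g) v))
    ≡⟨ solve 7 (λ a b c d x p q → ((a :+ b) :+ (c :* (con 0ℚ :* x) :+ (p :+ q))) :- (a :+ (d :* (con 0ℚ :* x) :+ p)) := b :+ q)
         refl (ℓ s (↓ ∷ v)) (ℓ (suc s) v) (ℓ (suc s) []) (ℓ s []) (ξ t v) ((ℓ s ∘ (↓ ∷_) ∗ g) v) ((ℓ (suc s) ∗ g) v) ⟩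
  ℓ (suc s) v + (ℓ (suc s) ∗ g) v ∎
  where
  open ≡-Reasoning
  g = χ↑ ▸ ξ t

partial-↑ : ∀ t v s → partial t (↑ ∷ v) (suc s) - partial t (↑ ∷ v) s ≡ ξ t v - partial t v s
partial-↑ t v s = begin
  (ℓ (suc s) (↑ ∷ v) + (ℓ (suc s) [] * (1ℚ * ξ t v) + (ℓ (suc s) ∘ (↑ ∷_) ∗ g) v)) - partial t (↑ ∷ v) s
    ≡⟨ cong₂ (λ y z → (y + (ℓ (suc s) [] * (1ℚ * ξ t v) + z)) - partial t (↑ ∷ v) s) (ℓ↑ s v)
         (trans (∗-congʳ g (ℓ↑ s) v) (trans (∗-distribʳ (ℓ s ∘ (↑ ∷_)) (λ w → (- 1ℚ) * ℓ s w) g v)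
           (cong (λ z → (ℓ s ∘ (↑ ∷_) ∗ g) v + z) (∗-scaleˡ (- 1ℚ) (ℓ s) g v)))) ⟩
  ((ℓ s (↑ ∷ v) + (- 1ℚ) * ℓ s v) + (ℓ (suc s) [] * (1ℚ * ξ t v) + ((ℓ s ∘ (↑ ∷_) ∗ g) v + (- 1ℚ) * (ℓ s ∗ g) v)))
    - partial t (↑ ∷ v) s
    ≡⟨ cong₂ (λ y z → ((ℓ s (↑ ∷ v) + (- 1ℚ) * ℓ s v) + (y * (1ℚ * ξ t v) + ((ℓ s ∘ (↑ ∷_) ∗ g) v + (- 1ℚ) * (ℓ s ∗ g) v)))
           - (ℓ s (↑ ∷ v) + (z * (1ℚ * ξ t v) + (ℓ s ∘ (↑ ∷_) ∗ g) v))) (trans (ℓ-[] (suc s)) (nat-suc s)) (ℓ-[] s) ⟩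
  ((ℓ s (↑ ∷ v) + (- 1ℚ) * ℓ s v) + ((1ℚ + nat s) * (1ℚ * ξ t v) + ((ℓ s ∘ (↑ ∷_) ∗ g) v + (- 1ℚ) * (ℓ s ∗ g) v)))
    - (ℓ s (↑ ∷ v) + (nat s * (1ℚ * ξ t v) + (ℓ s ∘ (↑ ∷_) ∗ g) v))
    ≡⟨ solve 6 (λ a b c x p q → ((a :+ con (- 1ℚ) :* b) :+ ((con 1ℚ :+ c) :* (con 1ℚ :* x) :+ (p :+ con (- 1ℚ) :* q)))
           :- (a :+ (c :* (con 1ℚ :* x) :+ p)) := x :- (b :+ q))
         refl (ℓ s (↑ ∷ v)) (ℓ s v) (nat s) (ξ t v) ((ℓ s ∘ (↑ ∷_) ∗ g) v) ((ℓ s ∗ g) v) ⟩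
  ξ t v - partial t v s ∎
  where
  open ≡-Reasoning
  g = χ↑ ▸ ξ t

-- The condition imposed on the remainders by the letters still to come.  A walk ends
-- with remainder 0, so trailing letters ↑ force remainder 0: this is the state
-- nothing.  The last ↓ is followed by that state and imposes nothing on the
-- remainder before it; with the letters before the last ↓ forming the word v, the
-- state is just v.
State : Set
State = Maybe Word

-- The state before a letter, given the state after it.
step : Letter → State → State
step ↓ nothing  = just []
step ↑ nothing  = nothing
step l (just v) = just (l ∷ v)

-- The indicator of remainder 0.
δ : ℕ → ℚ
δ zero    = 1ℚ
δ (suc _) = 0ℚ

-- The number of sequences of remainders that start at r and meet the condition m.
value : ℕ → State → ℕ → ℚ
value t nothing  r = δ r
value t (just v) r = partial t v (suc r) - partial t v r

value-↓ : ∀ t m r → Σ< (suc r) (value t m) ≡ value t (step ↓ m) r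
value-↓ t nothing  r = trans (cong (λ z → 1ℚ + z) (Σ<-zero r (δ ∘ suc) (λ _ → refl))) (sym (partial-[] t r))
value-↓ t (just v) r = trans (Σ<-telescope (suc r) 0 (partial t v))
  (trans (trans (cong (λ z → partial t v (suc r) - z) (partial-zero t v))
    (solve 1 (λ x → x :- con 0ℚ := x) refl (partial t v (suc r)))) (sym (partial-↓ t v r)))

value-↑ : ∀ t m r q → r ℕ.+ suc q ≡ t → Σ< (suc q) (λ i → value t m (r ℕ.+ i)) ≡ value t (step ↑ m) r
value-↑ t nothing  zero    q eq = cong (λ z → 1ℚ + z) (Σ<-zero q (δ ∘ suc) (λ _ → refl))
value-↑ t nothing  (suc r) q eq = Σ<-zero (suc q) (λ i → δ (suc r ℕ.+ i)) (λ _ → refl)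
value-↑ t (just v) r       q eq = trans (Σ<-telescope (suc q) r (partial t v))
  (trans (cong (_- partial t v r) (trans (cong (partial t v) eq) (partial-full t v))) (sym (partial-↑ t v r)))

-- The sum of the values of a list of states.
total : ℕ → List State → ℕ → ℚ
total t []       r = 0ℚ
total t (m ∷ ms) r = value t m r + total t ms r

total-++ : ∀ t ms ms′ r → total t (ms ++ ms′) r ≡ total t ms r + total t ms′ r
total-++ t []       ms′ r = sym (ℚ.+-identityˡ (total t ms′ r))
total-++ t (m ∷ ms) ms′ r = trans (cong (λ z → value t m r + z) (total-++ t ms ms′ r))
  (sym (ℚ.+-assoc (value t m r) (total t ms r) (total t ms′ r)))

total-↓ : ∀ t ms r → Σ< (suc r) (total t ms) ≡ total t (map (step ↓) ms) r
total-↓ t []       r = Σ<-zero (suc r) (λ _ → 0ℚ) (λ _ → refl)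
total-↓ t (m ∷ ms) r = trans (Σ<-+ (suc r) (value t m) (total t ms)) (cong₂ _+_ (value-↓ t m r) (total-↓ t ms r))

total-↑ : ∀ t ms r q → r ℕ.+ suc q ≡ t → Σ< (suc q) (λ i → total t ms (r ℕ.+ i)) ≡ total t (map (step ↑) ms) r
total-↑ t []       r q eq = Σ<-zero (suc q) (λ _ → 0ℚ) (λ _ → refl)
total-↑ t (m ∷ ms) r q eq = trans (Σ<-+ (suc q) (λ i → value t m (r ℕ.+ i)) (λ i → total t ms (r ℕ.+ i)))
  (cong₂ _+_ (value-↑ t m r q eq) (total-↑ t ms r q eq))

-- The states of all words that a walk following U may have, when it starts at level
-- l.  In branches U l the level has already been raised by the step of U: the
-- letter ↓ keeps the level l, and the letter ↑ lowers it by 1.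
states : ∀ {n} → Vec Step n → ℕ → List State
branches : ∀ {n} → Vec Step n → ℕ → List State

states []      zero    = nothing ∷ []
states []      (suc _) = []
states (e ∷ U) l       = branches U (raise 1 e l)

branches U zero    = map (step ↓) (states U zero)
branches U (suc l) = map (step ↑) (states U l) ++ map (step ↓) (states U (suc l))

-- The number of walks whose slack starts at l t + r, as a sum over words.
count-states : ∀ t {n} (U : Vec Step n) l r → r ℕ.< t → count t U (l ℕ.* t ℕ.+ r) ≡ total t (states U l) r
count-branches : ∀ t {n} (U : Vec Step n) l r → r ℕ.< t →
  Σ< (suc (t ⊓ (l ℕ.* t ℕ.+ r))) (λ z → count t U (l ℕ.* t ℕ.+ r ∸ z)) ≡ total t (branches U l) r

count-states t []      zero    zero    r<t = trans int-1 (sym (ℚ.+-identityʳ 1ℚ))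
count-states t []      zero    (suc r) r<t = int-0
count-states (suc t) [] (suc l) r      r<t = int-0
count-states t (e ∷ U) l       r       r<t = begin
  count t (e ∷ U) (l ℕ.* t ℕ.+ r)
    ≡⟨ count-∷ t e U (l ℕ.* t ℕ.+ r) ⟩
  Σ< (suc (t ⊓ raise t e (l ℕ.* t ℕ.+ r))) (λ z → count t U (raise t e (l ℕ.* t ℕ.+ r) ∸ z))
    ≡⟨ cong (λ D → Σ< (suc (t ⊓ D)) (λ z → count t U (D ∸ z))) (raise-level e) ⟩
  Σ< (suc (t ⊓ (raise 1 e l ℕ.* t ℕ.+ r))) (λ z → count t U (raise 1 e l ℕ.* t ℕ.+ r ∸ z))
    ≡⟨ count-branches t U (raise 1 e l) r r<t ⟩
  total t (branches U (raise 1 e l)) r ∎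
  where
  open ≡-Reasoning
  raise-level : ∀ e → raise t e (l ℕ.* t ℕ.+ r) ≡ raise 1 e l ℕ.* t ℕ.+ r
  raise-level E = refl
  raise-level N = sym (ℕ.+-assoc t (l ℕ.* t) r)

count-branches t U zero r r<t = begin
  Σ< (suc (t ⊓ r)) (λ z → count t U (r ∸ z))
    ≡⟨ cong (λ k → Σ< (suc k) (λ z → count t U (r ∸ z))) (ℕ.m≥n⇒m⊓n≡n (ℕ.<⇒≤ r<t)) ⟩
  Σ< (suc r) (λ z → count t U (r ∸ z))
    ≡⟨ Σ<-reverse r (count t U) ⟩
  Σ< (suc r) (count t U)
    ≡⟨ Σ<-cong (suc r) (λ i i<1+r → count-states t U 0 i (ℕ.<-≤-trans i<1+r r<t)) ⟩
  Σ< (suc r) (total t (states U 0))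
    ≡⟨ total-↓ t (states U 0) r ⟩
  total t (map (step ↓) (states U 0)) r ∎
  where open ≡-Reasoning
-- The slacks that can be reached are b, …, b + t.  The first t - r of them lie on
-- level l with remainder at least r, the others on level l + 1 with remainder at
-- most r.
count-branches t U (suc l) r r<t = begin
  Σ< (suc (t ⊓ D)) (λ z → count t U (D ∸ z))
    ≡⟨ cong (λ k → Σ< (suc k) (λ z → count t U (D ∸ z))) (ℕ.m≤n⇒m⊓n≡m t≤D) ⟩
  Σ< (suc t) (λ z → count t U (D ∸ z))
    ≡⟨ Σ<-cong (suc t) (λ z z≤t → cong (count t U) (from-base z (ℕ.≤-pred z≤t))) ⟩
  Σ< (suc t) (λ z → count t U (b ℕ.+ (t ∸ z)))
    ≡⟨ Σ<-reverse t (λ i → count t U (b ℕ.+ i)) ⟩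
  Σ< (suc t) (λ i → count t U (b ℕ.+ i))
    ≡⟨ cong (λ k → Σ< k (λ i → count t U (b ℕ.+ i))) 1+t≡ ⟩
  Σ< (suc q ℕ.+ suc r) (λ i → count t U (b ℕ.+ i))
    ≡⟨ Σ<-split (suc q) (suc r) (λ i → count t U (b ℕ.+ i)) ⟩
  Σ< (suc q) (λ i → count t U (b ℕ.+ i)) + Σ< (suc r) (λ i → count t U (b ℕ.+ (suc q ℕ.+ i)))
    ≡⟨ cong₂ _+_
         (Σ<-cong (suc q) (λ i i≤q → trans (cong (count t U) (ℕ.+-assoc (l ℕ.* t) r i))
           (count-states t U l (r ℕ.+ i) (ℕ.<-≤-trans (ℕ.+-monoʳ-< r i≤q) (ℕ.≤-reflexive r+1+q≡t)))))
         (Σ<-cong (suc r) (λ i i≤r → trans (cong (count t U) (next-level i))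
           (count-states t U (suc l) i (ℕ.<-≤-trans i≤r r<t)))) ⟩
  Σ< (suc q) (λ i → total t (states U l) (r ℕ.+ i)) + Σ< (suc r) (total t (states U (suc l)))
    ≡⟨ cong₂ _+_ (total-↑ t (states U l) r q r+1+q≡t) (total-↓ t (states U (suc l)) r) ⟩
  total t (map (step ↑) (states U l)) r + total t (map (step ↓) (states U (suc l))) r
    ≡⟨ total-++ t (map (step ↑) (states U l)) (map (step ↓) (states U (suc l))) r ⟨
  total t (map (step ↑) (states U l) ++ map (step ↓) (states U (suc l))) r ∎
  where
  open ≡-Reasoning
  b = l ℕ.* t ℕ.+ r
  D = suc l ℕ.* t ℕ.+ r
  q = t ∸ suc r
  r+1+q≡t : r ℕ.+ suc q ≡ t
  r+1+q≡t = trans (ℕ.+-suc r q) (ℕ.m+[n∸m]≡n r<t)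
  1+t≡ : suc t ≡ suc q ℕ.+ suc r
  1+t≡ = trans (cong suc (sym r+1+q≡t)) (trans (sym (ℕ.+-suc r (suc q)))
    (trans (ℕ.+-suc r (suc q)) (ℕ.+-comm (suc r) (suc q))))
  D≡ : D ≡ b ℕ.+ t
  D≡ = trans (ℕ.+-assoc t (l ℕ.* t) r) (ℕ.+-comm t b)
  t≤D : t ℕ.≤ D
  t≤D = subst (t ℕ.≤_) (sym D≡) (ℕ.m≤n+m t b)
  from-base : ∀ z → z ℕ.≤ t → D ∸ z ≡ b ℕ.+ (t ∸ z)
  from-base z z≤t = trans (cong (_∸ z) D≡) (ℕ.+-∸-assoc b z≤t)
  next-level : ∀ i → b ℕ.+ (suc q ℕ.+ i) ≡ suc l ℕ.* t ℕ.+ i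
  next-level i = trans (sym (ℕ.+-assoc b (suc q) i)) (cong (ℕ._+ i)
    (trans (ℕ.+-assoc (l ℕ.* t) r (suc q)) (trans (cong (l ℕ.* t ℕ.+_) r+1+q≡t) (ℕ.+-comm (l ℕ.* t) t))))

-- The case t = 0

-- There are no remainders below 0, so count-states says nothing here.  The only
-- walk has all entries 0.  On the other side the fence polynomials vanish at 0,
-- and of all words that occur exactly one, of the form ↓ ⋯ ↓ ↑ ⋯ ↑, contributes 1.

-- The number of east steps.
easts : ∀ {n} → Vec Step n → ℕ
easts []      = 0
easts (E ∷ U) = suc (easts U)
easts (N ∷ U) = easts U

-- The indicators of m = n and of m ≤ n.
equals atMost : ℕ → ℕ → ℚ
equals zero    zero    = 1ℚ
equals (suc m) (suc n) = equals m n
equals _       _       = 0ℚ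
atMost zero    _       = 1ℚ
atMost (suc m) zero    = 0ℚ
atMost (suc m) (suc n) = atMost m n

equals+atMost : ∀ m n → equals m n + atMost (suc m) n ≡ atMost m n
equals+atMost zero    zero    = refl
equals+atMost zero    (suc n) = refl
equals+atMost (suc m) zero    = refl
equals+atMost (suc m) (suc n) = equals+atMost m n

-- The number of states equal to nothing, that is, of words without ↓.
stopped : List State → ℚ
stopped []             = 0ℚ
stopped (nothing ∷ ms) = 1ℚ + stopped ms
stopped (just _ ∷ ms)  = 0ℚ + stopped ms

stopped-++ : ∀ ms ms′ → stopped (ms ++ ms′) ≡ stopped ms + stopped ms′
stopped-++ []             ms′ = sym (ℚ.+-identityˡ (stopped ms′))
stopped-++ (nothing ∷ ms) ms′ = trans (cong (λ z → 1ℚ + z) (stopped-++ ms ms′)) (sym (ℚ.+-assoc 1ℚ (stopped ms) (stopped ms′)))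
stopped-++ (just _ ∷ ms)  ms′ = trans (cong (λ z → 0ℚ + z) (stopped-++ ms ms′)) (sym (ℚ.+-assoc 0ℚ (stopped ms) (stopped ms′)))

stopped-↓ : ∀ ms → stopped (map (step ↓) ms) ≡ 0ℚ
stopped-↓ []             = refl
stopped-↓ (nothing ∷ ms) = trans (ℚ.+-identityˡ _) (stopped-↓ ms)
stopped-↓ (just _ ∷ ms)  = trans (ℚ.+-identityˡ _) (stopped-↓ ms)

stopped-↑ : ∀ ms → stopped (map (step ↑) ms) ≡ stopped ms
stopped-↑ []             = refl
stopped-↑ (nothing ∷ ms) = cong (λ z → 1ℚ + z) (stopped-↑ ms)
stopped-↑ (just _ ∷ ms)  = cong (λ z → 0ℚ + z) (stopped-↑ ms)

stopped-states : ∀ {n} (U : Vec Step n) l → stopped (states U l) ≡ equals l (easts U)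
stopped-branches : ∀ {n} (U : Vec Step n) l → stopped (branches U (suc l)) ≡ equals l (easts U)

stopped-states []      zero    = ℚ.+-identityʳ 1ℚ
stopped-states []      (suc l) = refl
stopped-states (E ∷ U) zero    = stopped-↓ (states U 0)
stopped-states (E ∷ U) (suc l) = stopped-branches U l
stopped-states (N ∷ U) l       = stopped-branches U l

stopped-branches U l = begin
  stopped (map (step ↑) (states U l) ++ map (step ↓) (states U (suc l)))
    ≡⟨ stopped-++ (map (step ↑) (states U l)) (map (step ↓) (states U (suc l))) ⟩
  stopped (map (step ↑) (states U l)) + stopped (map (step ↓) (states U (suc l)))
    ≡⟨ cong₂ _+_ (trans (stopped-↑ (states U l)) (stopped-states U l)) (stopped-↓ (states U (suc l))) ⟩
  equals l (easts U) + 0ℚ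
    ≡⟨ ℚ.+-identityʳ _ ⟩
  equals l (easts U) ∎
  where open ≡-Reasoning

value₀ : ∀ t v → value t (just v) 0 ≡ partial t v 1
value₀ t v = trans (cong (λ z → partial t v 1 - z) (partial-zero t v)) (solve 1 (λ x → x :- con 0ℚ := x) refl (partial t v 1))

∗-zeroʳ : ∀ f g → (∀ v → g v ≡ 0ℚ) → ∀ w → (f ∗ g) w ≡ 0ℚ
∗-zeroʳ f g g≡0 []      = trans (cong (f [] *_) (g≡0 [])) (ℚ.*-zeroʳ (f []))
∗-zeroʳ f g g≡0 (l ∷ w) = cong₂ _+_ (trans (cong (f [] *_) (g≡0 (l ∷ w))) (ℚ.*-zeroʳ (f [])))
                                   (∗-zeroʳ (f ∘ (l ∷_)) g g≡0 w)

value₀₀ : ∀ v → value 0 (just v) 0 ≡ ℓ 1 v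
value₀₀ v = trans (value₀ 0 v) (trans (cong (λ z → ℓ 1 v + z) (∗-zeroʳ (ℓ 1) (χ↑ ▸ ξ 0) up-zero v)) (ℚ.+-identityʳ (ℓ 1 v)))
  where
  up-zero : ∀ w → (χ↑ ▸ ξ 0) w ≡ 0ℚ
  up-zero []      = refl
  up-zero (l ∷ w) = trans (cong (χ↑ l *_) (ξ-zero w)) (ℚ.*-zeroʳ (χ↑ l))

ℓ₁↓ : ∀ v → ℓ 1 (↓ ∷ v) ≡ ℓ 1 v
ℓ₁↓ v = trans (ℓ↓ 0 v) (trans (cong (_+ ℓ 1 v) (ℓ-zero (↓ ∷ v))) (ℚ.+-identityˡ (ℓ 1 v)))

ℓ₁↑ : ∀ v → ℓ 1 (↑ ∷ v) ≡ 0ℚ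
ℓ₁↑ v = trans (ℓ↑ 0 v) (cong₂ (λ y z → y + (- 1ℚ) * z) (ℓ-zero (↑ ∷ v)) (ℓ-zero v))

ℓ₁-nonneg : ∀ v → 0ℚ ≤ ℓ 1 v
ℓ₁-nonneg []      = subst (0ℚ ≤_) (sym (ℓ-[] 1)) (0≤nat 1)
ℓ₁-nonneg (↓ ∷ v) = subst (0ℚ ≤_) (sym (ℓ₁↓ v)) (ℓ₁-nonneg v)
ℓ₁-nonneg (↑ ∷ v) = ℚ.≤-reflexive (sym (ℓ₁↑ v))

total₀-↓ : ∀ ms → total 0 (map (step ↓) ms) 0 ≡ total 0 ms 0
total₀-↓ []             = refl
total₀-↓ (nothing ∷ ms) = cong₂ _+_ (trans (value₀₀ []) (trans (ℓ-[] 1) int-1)) (total₀-↓ ms)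
total₀-↓ (just v ∷ ms)  = cong₂ _+_ (trans (value₀₀ (↓ ∷ v)) (trans (ℓ₁↓ v) (sym (value₀₀ v)))) (total₀-↓ ms)

total₀-↑ : ∀ ms → total 0 (map (step ↑) ms) 0 ≡ stopped ms
total₀-↑ []             = refl
total₀-↑ (nothing ∷ ms) = cong (λ z → 1ℚ + z) (total₀-↑ ms)
total₀-↑ (just v ∷ ms)  = cong₂ _+_ (trans (value₀₀ (↑ ∷ v)) (ℓ₁↑ v)) (total₀-↑ ms)

total₀-states : ∀ {n} (U : Vec Step n) l → total 0 (states U l) 0 ≡ atMost l (easts U)
total₀-branches : ∀ {n} (U : Vec Step n) l → total 0 (branches U (suc l)) 0 ≡ atMost l (easts U)

total₀-states []      zero    = ℚ.+-identityʳ 1ℚ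
total₀-states []      (suc l) = refl
total₀-states (E ∷ U) zero    = trans (total₀-↓ (states U 0)) (total₀-states U 0)
total₀-states (E ∷ U) (suc l) = total₀-branches U l
total₀-states (N ∷ U) l       = total₀-branches U l

total₀-branches U l = begin
  total 0 (map (step ↑) (states U l) ++ map (step ↓) (states U (suc l))) 0
    ≡⟨ total-++ 0 (map (step ↑) (states U l)) (map (step ↓) (states U (suc l))) 0 ⟩
  total 0 (map (step ↑) (states U l)) 0 + total 0 (map (step ↓) (states U (suc l))) 0
    ≡⟨ cong₂ _+_ (trans (total₀-↑ (states U l)) (stopped-states U l))
         (trans (total₀-↓ (states U (suc l))) (total₀-states U (suc l))) ⟩
  equals l (easts U) + atMost (suc l) (easts U)
    ≡⟨ equals+atMost l (easts U) ⟩
  atMost l (easts U) ∎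
  where open ≡-Reasoning

raise-0 : ∀ e → raise 0 e 0 ≡ 0
raise-0 E = refl
raise-0 N = refl

count₀ : ∀ {n} (U : Vec Step n) → count 0 U 0 ≡ 1ℚ
count₀ []      = int-1
count₀ (e ∷ U) = trans (count-∷ 0 e U 0) (trans (ℚ.+-identityʳ (count 0 U (raise 0 e 0)))
  (trans (cong (count 0 U) (raise-0 e)) (count₀ U)))

count-total : ∀ t {n} (U : Vec Step n) → count t U 0 ≡ total t (states U 0) 0
count-total zero    U = trans (count₀ U) (sym (total₀-states U 0))
count-total (suc t) U = count-states (suc t) U 0 0 (s≤s z≤n)

-- The value of a state at remainder 0, as a polynomial in t.
valueᴾ : State → Polynomial
valueᴾ nothing  = constant 1ℚ
valueᴾ (just v) = constant (ℓ 1 v) +ᴾ ((constant ∘ ℓ 1) ∗ᴾ up fence) v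

eval-value : ∀ t m → eval (valueᴾ m) (nat t) ≡ value t m 0
eval-value t nothing  = eval-constant 1ℚ (nat t)
eval-value t (just v) = trans (eval-+ (constant (ℓ 1 v)) (((constant ∘ ℓ 1) ∗ᴾ up fence) v) (nat t))
  (trans (cong₂ _+_ (eval-constant (ℓ 1 v) (nat t)) (trans (eval-∗ (constant ∘ ℓ 1) (up fence) (nat t) v)
    (∗-cong (λ w → eval-constant (ℓ 1 w) (nat t)) (eval-up fence (nat t)) v))) (sym (value₀ t v)))

nonNeg-value : ∀ m → NonNeg (valueᴾ m)
nonNeg-value nothing  = ℚ.<⇒≤ (ℚ.positive⁻¹ 1ℚ) ∷ []
nonNeg-value (just v) = nonNeg-+ (ℓ₁-nonneg v ∷ [])
  (nonNegBelow-∗ {suc (length v)} {constant ∘ ℓ 1} {up fence} (λ w _ → ℓ₁-nonneg w ∷ []) refl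
    (nonNegBelow-up (λ w _ → fence-nonNeg w)) v (ℕ.m≤n⇒m≤1+n ℕ.≤-refl))

totalᴾ : List State → Polynomial
totalᴾ []       = []
totalᴾ (m ∷ ms) = valueᴾ m +ᴾ totalᴾ ms

eval-total : ∀ t ms → eval (totalᴾ ms) (nat t) ≡ total t ms 0
eval-total t []       = refl
eval-total t (m ∷ ms) = trans (eval-+ (valueᴾ m) (totalᴾ ms) (nat t)) (cong₂ _+_ (eval-value t m) (eval-total t ms))

nonNeg-total : ∀ ms → NonNeg (totalᴾ ms)
nonNeg-total []       = []
nonNeg-total (m ∷ ms) = nonNeg-+ (nonNeg-value m) (nonNeg-total ms)

-- The Ehrhart polynomial of the Schubert matroid of U: the sum over all words.
ehrhart : ∀ {n} → Vec Step n → Polynomial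
ehrhart U = totalᴾ (states U 0)

eval-ehrhart : ∀ t {n} (U : Vec Step n) → eval (ehrhart U) (+ t ℚ./ 1) ≡ + length (walks t U 0) ℚ./ 1
eval-ehrhart t U = begin
  eval (ehrhart U) (+ t ℚ./ 1)   ≡⟨ cong (eval (ehrhart U)) (int-def (+ t)) ⟨
  eval (ehrhart U) (nat t)       ≡⟨ eval-total t (states U 0) ⟩
  total t (states U 0) 0         ≡⟨ count-total t U ⟨
  count t U 0                    ≡⟨ int-def (+ length (walks t U 0)) ⟩
  + length (walks t U 0) ℚ./ 1   ∎
  where open ≡-Reasoning

-- Membership in the list of walks

-- The entries of z are the falls of a slack walk along U that starts at slack d.
Valid : ℕ → ∀ {n} → Vec Step n → ℕ → Vec ℕ n → Set
Valid t []      d []       = d ≡ 0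
Valid t (e ∷ U) d (z ∷ zs) = z ℕ.≤ t × z ℕ.≤ raise t e d × Valid t U (raise t e d ∸ z) zs

valid⇒∈ : ∀ t {n} (U : Vec Step n) d z → Valid t U d z → z ∈ walks t U d
valid⇒∈ t []      .0 []       refl              = here refl
valid⇒∈ t (e ∷ U) d  (z ∷ zs) (z≤t , z≤D , v) =
  List.∈-concatMap⁺ (λ y → map (y ∷_) (walks t U (raise t e d ∸ y)))
    (lose (List.∈-upTo⁺ (s≤s (ℕ.⊓-glb z≤t z≤D)))
      (List.∈-map⁺ (z ∷_) (valid⇒∈ t U (raise t e d ∸ z) zs v)))

∈⇒valid : ∀ t {n} (U : Vec Step n) d z → z ∈ walks t U d → Valid t U d z
∈⇒valid t []      zero []       _ = refl
∈⇒valid t (e ∷ U) d    (z ∷ zs) z∈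
  with find (List.∈-concatMap⁻ (λ y → map (y ∷_) (walks t U (raise t e d ∸ y)))
         {xs = upTo (suc (t ⊓ raise t e d))} z∈)
... | y , y∈ , z∈′ with List.∈-map⁻ (y ∷_) z∈′
... | _ , zs∈ , refl = ℕ.≤-trans y≤ (ℕ.m⊓n≤m t (raise t e d)) , ℕ.≤-trans y≤ (ℕ.m⊓n≤n t (raise t e d))
                     , ∈⇒valid t U (raise t e d ∸ z) zs zs∈
  where
  y≤ : y ℕ.≤ t ⊓ raise t e d
  y≤ = ℕ.≤-pred (List.∈-upTo⁻ y∈)

walks-unique : ∀ t {n} (U : Vec Step n) d → Unique (walks t U d)
walks-unique t []      zero    = All.[] AllPairs.∷ AllPairs.[]
walks-unique t []      (suc d) = AllPairs.[]
walks-unique t (e ∷ U) d       = Unique.concat⁺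
  (All.map⁺ (All.universal (λ z → Unique.map⁺ Vec.∷-injectiveʳ (walks-unique t U (raise t e d ∸ z)))
    (upTo (suc (t ⊓ raise t e d)))))
  (AllPairs.map⁺ (AllPairs.map disjoint (Unique.upTo⁺ (suc (t ⊓ raise t e d)))))
  where
  disjoint : ∀ {y z} → y ≢ z → ∀ {x} →
    x ∈ map (y ∷_) (walks t U (raise t e d ∸ y)) × x ∈ map (z ∷_) (walks t U (raise t e d ∸ z)) → _
  disjoint {y} {z} y≢z (x∈y , x∈z) with List.∈-map⁻ (y ∷_) x∈y | List.∈-map⁻ (z ∷_) x∈z
  ... | _ , _ , refl | _ , _ , eq = y≢z (Vec.∷-injectiveˡ eq)

-- Walks described by prefix sums

-- The sum of the first m entries.
prefix : ℕ → ∀ {n} → Vec ℕ n → ℕ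
prefix zero    z        = 0
prefix (suc m) []       = 0
prefix (suc m) (z ∷ zs) = z ℕ.+ prefix m zs

bit : Step → ℕ
bit E = 0
bit N = 1

bits : ∀ {n} → Vec Step n → Vec ℕ n
bits = Vec.map bit

raise-bit : ∀ t e d → raise t e d ≡ d ℕ.+ t ℕ.* bit e
raise-bit t E d = sym (trans (cong (d ℕ.+_) (ℕ.*-zeroʳ t)) (ℕ.+-identityʳ d))
raise-bit t N d = trans (ℕ.+-comm t d) (cong (d ℕ.+_) (sym (ℕ.*-identityʳ t)))

bound-∷ : ∀ t e d {n} (U : Vec Step n) m →
  d ℕ.+ t ℕ.* prefix (suc m) (bits (e ∷ U)) ≡ raise t e d ℕ.+ t ℕ.* prefix m (bits U)
bound-∷ t e d U m = begin
  d ℕ.+ t ℕ.* (bit e ℕ.+ prefix m (bits U))         ≡⟨ cong (d ℕ.+_) (ℕ.*-distribˡ-+ t (bit e) (prefix m (bits U))) ⟩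
  d ℕ.+ (t ℕ.* bit e ℕ.+ t ℕ.* prefix m (bits U))     ≡⟨ ℕ.+-assoc d (t ℕ.* bit e) (t ℕ.* prefix m (bits U)) ⟨
  (d ℕ.+ t ℕ.* bit e) ℕ.+ t ℕ.* prefix m (bits U)     ≡⟨ cong (ℕ._+ t ℕ.* prefix m (bits U)) (raise-bit t e d) ⟨
  raise t e d ℕ.+ t ℕ.* prefix m (bits U)         ∎
  where open ≡-Reasoning

cancel-∸ : ∀ {z D} x → z ℕ.≤ D → z ℕ.+ ((D ∸ z) ℕ.+ x) ≡ D ℕ.+ x
cancel-∸ {z} {D} x z≤D = trans (sym (ℕ.+-assoc z (D ∸ z) x)) (cong (ℕ._+ x) (ℕ.m+[n∸m]≡n z≤D))

valid⇒prefix : ∀ t {n} (U : Vec Step n) d z → Valid t U d z → ∀ m → m ℕ.≤ n →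
  prefix m z ℕ.≤ d ℕ.+ t ℕ.* prefix m (bits U)
valid⇒prefix t U       d z        v                zero    _         = z≤n
valid⇒prefix t (e ∷ U) d (z ∷ zs) (z≤t , z≤D , v) (suc m) (s≤s m≤n) = begin
  z ℕ.+ prefix m zs                                      ≤⟨ ℕ.+-monoʳ-≤ z (valid⇒prefix t U _ zs v m m≤n) ⟩
  z ℕ.+ ((raise t e d ∸ z) ℕ.+ t ℕ.* prefix m (bits U))      ≡⟨ cancel-∸ (t ℕ.* prefix m (bits U)) z≤D ⟩
  raise t e d ℕ.+ t ℕ.* prefix m (bits U)                  ≡⟨ bound-∷ t e d U m ⟨
  d ℕ.+ t ℕ.* prefix (suc m) (bits (e ∷ U))                ∎
  where open ℕ.≤-Reasoning

valid⇒total : ∀ t {n} (U : Vec Step n) d z → Valid t U d z → prefix n z ≡ d ℕ.+ t ℕ.* prefix n (bits U)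
valid⇒total t []          d []       refl             = sym (ℕ.*-zeroʳ t)
valid⇒total t {suc n} (e ∷ U) d (z ∷ zs) (z≤t , z≤D , v) = begin
  z ℕ.+ prefix n zs                                      ≡⟨ cong (z ℕ.+_) (valid⇒total t U _ zs v) ⟩
  z ℕ.+ ((raise t e d ∸ z) ℕ.+ t ℕ.* prefix n (bits U))      ≡⟨ cancel-∸ (t ℕ.* prefix n (bits U)) z≤D ⟩
  raise t e d ℕ.+ t ℕ.* prefix n (bits U)                  ≡⟨ bound-∷ t e d U n ⟨
  d ℕ.+ t ℕ.* prefix (suc n) (bits (e ∷ U))                ∎
  where open ≡-Reasoning

prefix⇒valid : ∀ t {n} (U : Vec Step n) d z → (∀ i → lookup z i ℕ.≤ t) →
  (∀ m → m ℕ.≤ n → prefix m z ℕ.≤ d ℕ.+ t ℕ.* prefix m (bits U)) →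
  prefix n z ≡ d ℕ.+ t ℕ.* prefix n (bits U) → Valid t U d z
prefix⇒valid t []      d []       z≤t below total = sym (trans total (trans (cong (d ℕ.+_) (ℕ.*-zeroʳ t)) (ℕ.+-identityʳ d)))
prefix⇒valid t {suc n} (e ∷ U) d (z ∷ zs) z≤t below total =
  z≤t zero , z≤D , prefix⇒valid t U (D ∸ z) zs (z≤t ∘ suc)
    (λ m m≤n → ℕ.+-cancelˡ-≤ z _ _ (subst (z ℕ.+ prefix m zs ℕ.≤_)
      (trans (bound-∷ t e d U m) (sym (cancel-∸ (t ℕ.* prefix m (bits U)) z≤D))) (below (suc m) (s≤s m≤n))))
    (ℕ.+-cancelˡ-≡ z _ _ (trans total (trans (bound-∷ t e d U n) (sym (cancel-∸ (t ℕ.* prefix n (bits U)) z≤D)))))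
  where
  D = raise t e d
  z≤D : z ℕ.≤ D
  z≤D = subst₂ ℕ._≤_ (ℕ.+-identityʳ z)
    (trans (bound-∷ t e d U 0) (trans (cong (D ℕ.+_) (ℕ.*-zeroʳ t)) (ℕ.+-identityʳ D))) (below 1 (s≤s z≤n))

-- Bases as walks with t = 1

prefix-north : ∀ {n} m (P : Vec Step n) → Subset.∣ Vec.map isNorth P Subset.∩ initial m ∣ ≡ prefix m (bits P)
prefix-north zero    []      = refl
prefix-north (suc m) []      = refl
prefix-north zero    (E ∷ P) = prefix-north 0 P
prefix-north zero    (N ∷ P) = prefix-north 0 P
prefix-north (suc m) (E ∷ P) = prefix-north m P
prefix-north (suc m) (N ∷ P) = cong suc (prefix-north m P)

-- The bounds lowest-prefix and prefix-bits-≥ place the path of a east steps followed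
-- by b north steps below every path with the same number of east steps.
lowest-prefix : ∀ {n} a b .(eq : a ℕ.+ b ≡ n) m →
  prefix m (bits (Vec.cast eq (Vec.replicate a E Vec.++ Vec.replicate b N))) ℕ.≤ m ∸ a
lowest-prefix a               b       eq zero    = z≤n
lowest-prefix {zero}  zero    zero    eq (suc m) = z≤n
lowest-prefix {suc n} zero    (suc b) eq (suc m) = s≤s (lowest-prefix zero b (cong ℕ.pred eq) m)
lowest-prefix {suc n} (suc a) b       eq (suc m) = lowest-prefix a b (cong ℕ.pred eq) m

prefix-bits-≥ : ∀ {n} (P : Vec Step n) m → m ℕ.≤ n → m ∸ easts P ℕ.≤ prefix m (bits P)
prefix-bits-≥ P       zero    _         = ℕ.≤-reflexive (ℕ.0∸n≡0 (easts P))
prefix-bits-≥ (E ∷ P) (suc m) (s≤s m≤n) = prefix-bits-≥ P m m≤n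
prefix-bits-≥ (N ∷ P) (suc m) (s≤s m≤n) = ℕ.m≤n+o⇒m∸n≤o (suc m) (easts P)
  (ℕ.≤-trans (s≤s (ℕ.m≤n+m∸n m (easts P)))
    (ℕ.≤-trans (ℕ.≤-reflexive (sym (ℕ.+-suc (easts P) (m ∸ easts P))))
      (ℕ.+-monoʳ-≤ (easts P) (s≤s (prefix-bits-≥ P m m≤n)))))

endpoint-counts : ∀ {n} (P : Vec Step n) → endpoint P ≡ (easts P , prefix n (bits P))
endpoint-counts []      = refl
endpoint-counts (E ∷ P) rewrite endpoint-counts P = refl
endpoint-counts (N ∷ P) rewrite endpoint-counts P = refl

easts+norths : ∀ {n} (P : Vec Step n) → easts P ℕ.+ prefix n (bits P) ≡ n
easts+norths []      = refl
easts+norths (E ∷ P) = cong suc (easts+norths P)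
easts+norths {suc n} (N ∷ P) = trans (ℕ.+-suc (easts P) (prefix n (bits P))) (cong suc (easts+norths P))

path-norths : ∀ {n k} (P : LatticePath n k) → prefix n (bits (steps P)) ≡ k
path-norths P = cong proj₂ (trans (sym (endpoint-counts (steps P))) (ends P))

path-easts : ∀ {n} k (P : Vec Step n) → prefix n (bits P) ≡ k → easts P ≡ n ∸ k
path-easts {n} k P eq = trans (sym (ℕ.m+n∸n≡m (easts P) k)) (cong (_∸ k) (trans (cong (easts P ℕ.+_) (sym eq)) (easts+norths P)))

valid⇒basis : ∀ {n k} (k≤n : k ℕ.≤ n) (U : LatticePath n k) (P : Vec Step n) →
  Valid 1 (steps U) 0 (bits P) → pathBases (lowestPath k≤n) U (Vec.map isNorth P)
valid⇒basis {n} {k} k≤n U P v = path , lowest≤P , P≤U , refl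
  where
  norths≡k : prefix n (bits P) ≡ k
  norths≡k = trans (valid⇒total 1 (steps U) 0 (bits P) v) (trans (ℕ.*-identityˡ _) (path-norths U))
  path : LatticePath n k
  path = mkPath P (trans (endpoint-counts P) (cong₂ _,_ (path-easts k P norths≡k) norths≡k))
  lowest≤P : LiesBelow (lowestPath k≤n) path
  lowest≤P m _ m≤n = subst₂ ℕ._≤_ (sym (prefix-north m (steps (lowestPath k≤n)))) (sym (prefix-north m P))
    (ℕ.≤-trans (lowest-prefix (n ∸ k) k (ℕ.m∸n+n≡m k≤n) m)
      (subst (λ a → m ∸ a ℕ.≤ prefix m (bits P)) (path-easts k P norths≡k) (prefix-bits-≥ P m m≤n)))
  P≤U : LiesBelow path U
  P≤U m _ m≤n = subst₂ ℕ._≤_ (sym (prefix-north m P)) (trans (ℕ.*-identityˡ _) (sym (prefix-north m (steps U))))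
    (valid⇒prefix 1 (steps U) 0 (bits P) v m m≤n)

below⇒prefix : ∀ {n k} (P U : LatticePath n k) → LiesBelow P U → ∀ m → m ℕ.≤ n →
  prefix m (bits (steps P)) ℕ.≤ prefix m (bits (steps U))
below⇒prefix P U P≤U zero    _   = z≤n
below⇒prefix P U P≤U (suc m) m≤n = subst₂ ℕ._≤_ (prefix-north (suc m) (steps P)) (prefix-north (suc m) (steps U))
  (P≤U (suc m) (s≤s z≤n) m≤n)

-- Decomposition of a walk into t bases

-- The step taken when the slack below U, raised to x by the step of U, becomes y.
descent : ℕ → ℕ → Step
descent x y = if y ℕ.<ᵇ x then N else E

descent-bit : ∀ x y → y ℕ.≤ x → x ℕ.≤ suc y → bit (descent x y) ℕ.+ y ≡ x
descent-bit x y y≤x x≤1+y with y ℕ.<ᵇ x | ℕ.<ᵇ-reflects-< y x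
... | true  | ofʸ y<x = ℕ.≤-antisym y<x x≤1+y
... | false | ofⁿ y≮x = ℕ.≤-antisym y≤x (ℕ.≮⇒≥ y≮x)

-- The s-th of the t paths into which the walk z is decomposed.  When z has slack d,
-- its slack is ⌊(d + s) / t⌋.
sample : ∀ t .{{_ : ℕ.NonZero t}} → ℕ → ∀ {n} → Vec Step n → ℕ → Vec ℕ n → Vec Step n
sample t s []      d []       = []
sample t s (e ∷ U) d (z ∷ zs) = descent ((D ℕ.+ s) ℕ./ t) ((D ∸ z ℕ.+ s) ℕ./ t) ∷ sample t s U (D ∸ z) zs
  where D = raise t e d

sample-bit : ∀ t .{{_ : ℕ.NonZero t}} s D z → z ℕ.≤ t → z ℕ.≤ D →
  bit (descent ((D ℕ.+ s) ℕ./ t) ((D ∸ z ℕ.+ s) ℕ./ t)) ℕ.+ (D ∸ z ℕ.+ s) ℕ./ t ≡ (D ℕ.+ s) ℕ./ t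
sample-bit t s D z z≤t z≤D = descent-bit ((D ℕ.+ s) ℕ./ t) ((D ∸ z ℕ.+ s) ℕ./ t)
  (ℕ./-monoˡ-≤ t (ℕ.+-monoˡ-≤ s (ℕ.m∸n≤m D z)))
  (ℕ.≤-trans (ℕ./-monoˡ-≤ t bound) (ℕ.≤-reflexive carry))
  where
  bound : D ℕ.+ s ℕ.≤ t ℕ.+ (D ∸ z ℕ.+ s)
  bound = begin
    D ℕ.+ s              ≡⟨ cancel-∸ s z≤D ⟨
    z ℕ.+ (D ∸ z ℕ.+ s)    ≤⟨ ℕ.+-monoˡ-≤ (D ∸ z ℕ.+ s) z≤t ⟩
    t ℕ.+ (D ∸ z ℕ.+ s)    ∎
    where open ℕ.≤-Reasoning
  carry : (t ℕ.+ (D ∸ z ℕ.+ s)) ℕ./ t ≡ suc ((D ∸ z ℕ.+ s) ℕ./ t)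
  carry = trans (ℕ.+-distrib-/-∣ˡ (D ∸ z ℕ.+ s) ∣-refl) (cong (ℕ._+ (D ∸ z ℕ.+ s) ℕ./ t) (ℕ.n/n≡1 t))

raise-/ : ∀ t .{{_ : ℕ.NonZero t}} s e d → raise 1 e ((d ℕ.+ s) ℕ./ t) ≡ (raise t e d ℕ.+ s) ℕ./ t
raise-/ t s E d = refl
raise-/ t s N d = sym (trans (cong (ℕ._/ t) (ℕ.+-assoc t d s))
  (trans (ℕ.+-distrib-/-∣ˡ (d ℕ.+ s) ∣-refl) (cong (ℕ._+ (d ℕ.+ s) ℕ./ t) (ℕ.n/n≡1 t))))

bit≤1 : ∀ e → bit e ℕ.≤ 1
bit≤1 E = z≤n
bit≤1 N = s≤s z≤n

sample-valid : ∀ t .{{_ : ℕ.NonZero t}} s → s ℕ.< t → ∀ {n} (U : Vec Step n) d z → Valid t U d z →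
  Valid 1 U ((d ℕ.+ s) ℕ./ t) (bits (sample t s U d z))
sample-valid t s s<t []      .0 []       refl             = ℕ.m<n⇒m/n≡0 s<t
sample-valid t s s<t (e ∷ U) d  (z ∷ zs) (z≤t , z≤D , v) = bit≤1 b , b≤ ,
  subst (λ y → Valid 1 U y (bits (sample t s U (D ∸ z) zs))) (sym next) (sample-valid t s s<t U (D ∸ z) zs v)
  where
  D = raise t e d
  b = descent ((D ℕ.+ s) ℕ./ t) ((D ∸ z ℕ.+ s) ℕ./ t)
  split : bit b ℕ.+ (D ∸ z ℕ.+ s) ℕ./ t ≡ raise 1 e ((d ℕ.+ s) ℕ./ t)
  split = trans (sample-bit t s D z z≤t z≤D) (sym (raise-/ t s e d))
  b≤ : bit b ℕ.≤ raise 1 e ((d ℕ.+ s) ℕ./ t)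
  b≤ = subst (bit b ℕ.≤_) split (ℕ.m≤m+n (bit b) _)
  next : raise 1 e ((d ℕ.+ s) ℕ./ t) ∸ bit b ≡ (D ∸ z ℕ.+ s) ℕ./ t
  next = trans (cong (_∸ bit b) (sym split)) (ℕ.m+n∸m≡n (bit b) _)

-- Hermite's identity: the sum of ⌊(D + s) / t⌋ over s < t is D.
hermite : ∀ t .{{_ : ℕ.NonZero t}} D → Σ< t (λ s → nat ((D ℕ.+ s) ℕ./ t)) ≡ nat D
hermite t zero    = trans (Σ<-cong t (λ s s<t → trans (cong nat (ℕ.m<n⇒m/n≡0 s<t)) int-0))
  (trans (Σ<-zero t (λ _ → 0ℚ) (λ _ → refl)) (sym int-0))
hermite t (suc D) = begin
  Σ< t (λ s → nat ((suc D ℕ.+ s) ℕ./ t))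
    ≡⟨ Σ<-cong t (λ s _ → cong (λ y → nat (y ℕ./ t)) (sym (ℕ.+-suc D s))) ⟩
  Σ< t (f ∘ suc)
    ≡⟨ +-cancelˡ (f 0) step-f ⟩
  1ℚ + Σ< t f
    ≡⟨ cong (λ y → 1ℚ + y) (hermite t D) ⟩
  1ℚ + nat D
    ≡⟨ nat-suc D ⟨
  nat (suc D) ∎
  where
  open ≡-Reasoning
  f : ℕ → ℚ
  f s = nat ((D ℕ.+ s) ℕ./ t)
  f-t : f t ≡ 1ℚ + f 0
  f-t = trans (cong nat (trans (ℕ.+-distrib-/-∣ʳ D ∣-refl) (trans (cong (D ℕ./ t ℕ.+_) (ℕ.n/n≡1 t)) (ℕ.+-comm (D ℕ./ t) 1))))
    (trans (nat-suc (D ℕ./ t)) (cong (λ y → 1ℚ + nat (y ℕ./ t)) (sym (ℕ.+-identityʳ D))))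
  step-f : f 0 + Σ< t (f ∘ suc) ≡ f 0 + (1ℚ + Σ< t f)
  step-f = begin
    Σ< (suc t) f                 ≡⟨ Σ<-last t f ⟩
    Σ< t f + f t               ≡⟨ cong (λ y → Σ< t f + y) f-t ⟩
    Σ< t f + (1ℚ + f 0)      ≡⟨ solve 2 (λ a b → b :+ (con 1ℚ :+ a) := a :+ (con 1ℚ :+ b)) refl (f 0) (Σ< t f) ⟩
    f 0 + (1ℚ + Σ< t f)      ∎

sample-sum : ∀ t .{{_ : ℕ.NonZero t}} {n} (U : Vec Step n) d z → Valid t U d z → ∀ i →
  Σ< t (λ s → nat (bit (lookup (sample t s U d z) i))) ≡ nat (lookup z i)
sample-sum t (e ∷ U) d (z ∷ zs) (z≤t , z≤D , v) (suc i) = sample-sum t U (raise t e d ∸ z) zs v i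
sample-sum t (e ∷ U) d (z ∷ zs) (z≤t , z≤D , v) zero    = +-cancelˡ (nat (D ∸ z)) (begin
  nat (D ∸ z) + Σ< t β
    ≡⟨ ℚ.+-comm (nat (D ∸ z)) (Σ< t β) ⟩
  Σ< t β + nat (D ∸ z)
    ≡⟨ cong (λ y → Σ< t β + y) (hermite t (D ∸ z)) ⟨
  Σ< t β + Σ< t (λ s → nat ((D ∸ z ℕ.+ s) ℕ./ t))
    ≡⟨ Σ<-+ t β (λ s → nat ((D ∸ z ℕ.+ s) ℕ./ t)) ⟨
  Σ< t (λ s → β s + nat ((D ∸ z ℕ.+ s) ℕ./ t))
    ≡⟨ Σ<-cong t (λ s _ → trans (sym (nat-+ (bit (b s)) ((D ∸ z ℕ.+ s) ℕ./ t))) (cong nat (sample-bit t s D z z≤t z≤D))) ⟩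
  Σ< t (λ s → nat ((D ℕ.+ s) ℕ./ t))
    ≡⟨ hermite t D ⟩
  nat D
    ≡⟨ cong nat (ℕ.m∸n+n≡m z≤D) ⟨
  nat (D ∸ z ℕ.+ z)
    ≡⟨ nat-+ (D ∸ z) z ⟩
  nat (D ∸ z) + nat z ∎)
  where
  open ≡-Reasoning
  D = raise t e d
  b : ℕ → Step
  b s = descent ((D ℕ.+ s) ℕ./ t) ((D ∸ z ℕ.+ s) ℕ./ t)
  β : ℕ → ℚ
  β s = nat (bit (b s))

-- Sums over finite index sets

∑ᶠ : ∀ {n} → (Fin n → ℚ) → ℚ
∑ᶠ = Vector.foldr _+_ 0ℚ

∑ᶠ-cong : ∀ {n} {f g : Fin n → ℚ} → (∀ i → f i ≡ g i) → ∑ᶠ f ≡ ∑ᶠ g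
∑ᶠ-cong {zero}  eq = refl
∑ᶠ-cong {suc n} eq = cong₂ _+_ (eq zero) (∑ᶠ-cong (eq ∘ suc))

∑ᶠ-zero : ∀ {n} (f : Fin n → ℚ) → (∀ i → f i ≡ 0ℚ) → ∑ᶠ f ≡ 0ℚ
∑ᶠ-zero {zero}  f eq = refl
∑ᶠ-zero {suc n} f eq = cong₂ _+_ (eq zero) (∑ᶠ-zero (f ∘ suc) (eq ∘ suc))

∑ᶠ-+ : ∀ {n} (f g : Fin n → ℚ) → ∑ᶠ (λ i → f i + g i) ≡ ∑ᶠ f + ∑ᶠ g
∑ᶠ-+ {zero}  f g = refl
∑ᶠ-+ {suc n} f g = trans (cong (λ z → (f zero + g zero) + z) (∑ᶠ-+ (f ∘ suc) (g ∘ suc)))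
  (solve 4 (λ a b c d → (a :+ b) :+ (c :+ d) := (a :+ c) :+ (b :+ d)) refl
    (f zero) (g zero) (∑ᶠ (f ∘ suc)) (∑ᶠ (g ∘ suc)))

∑ᶠ-* : ∀ {n} c (f : Fin n → ℚ) → ∑ᶠ (λ i → c * f i) ≡ c * ∑ᶠ f
∑ᶠ-* {zero}  c f = sym (ℚ.*-zeroʳ c)
∑ᶠ-* {suc n} c f = trans (cong (λ z → c * f zero + z) (∑ᶠ-* c (f ∘ suc)))
  (sym (ℚ.*-distribˡ-+ c (f zero) (∑ᶠ (f ∘ suc))))

∑ᶠ-swap : ∀ {m n} (f : Fin m → Fin n → ℚ) → ∑ᶠ (λ i → ∑ᶠ (λ j → f i j)) ≡ ∑ᶠ (λ j → ∑ᶠ (λ i → f i j))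
∑ᶠ-swap {zero} {n} f = sym (∑ᶠ-zero {n} (λ _ → 0ℚ) (λ _ → refl))
∑ᶠ-swap {suc m} f = trans (cong (λ z → ∑ᶠ (f zero) + z) (∑ᶠ-swap (f ∘ suc)))
  (sym (∑ᶠ-+ (f zero) (λ j → ∑ᶠ (λ i → f (suc i) j))))

∑ᶠ-toℕ : ∀ n (f : ℕ → ℚ) → ∑ᶠ {n} (f ∘ toℕ) ≡ Σ< n f
∑ᶠ-toℕ zero    f = refl
∑ᶠ-toℕ (suc n) f = cong (λ z → f 0 + z) (∑ᶠ-toℕ n (f ∘ suc))

-- Limits of rational sequences

abstract

  -- Abstract, because these bounds are scrutinised below and their proofs are large.
  scale : ∀ B ε → 0ℚ < B → 0ℚ < ε → ∃ λ δ → 0ℚ < δ × B * δ ≡ ε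
  scale B ε 0<B 0<ε = B⁻¹ * ε
    , subst (_< B⁻¹ * ε) (ℚ.*-zeroʳ B⁻¹) (ℚ.*-monoʳ-<-pos B⁻¹ {{ℚ.1/pos⇒pos B {{ℚ.positive 0<B}}}} 0<ε)
    , trans (sym (ℚ.*-assoc B B⁻¹ ε))
        (trans (cong (_* ε) (ℚ.*-inverseʳ B {{B≢0}})) (ℚ.*-identityˡ ε))
    where
    B≢0 : ℚ.NonZero B
    B≢0 = ℚ.pos⇒nonZero B {{ℚ.positive 0<B}}
    B⁻¹ : ℚ
    B⁻¹ = (ℚ.1/ B) {{B≢0}}

  halve : ∀ ε → 0ℚ < ε → ∃ λ δ → 0ℚ < δ × δ + δ ≡ ε
  halve ε 0<ε with scale (1ℚ + 1ℚ) ε (ℚ.positive⁻¹ (1ℚ + 1ℚ)) 0<ε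
  ... | δ , 0<δ , eq = δ , 0<δ , trans (solve 1 (λ d → d :+ d := (con 1ℚ :+ con 1ℚ) :* d) refl δ) eq

-- Rational sequences whose difference tends to 0.
infix 4 _~_
record _~_ (x y : ℕ → ℚ) : Set where
  constructor close
  field
    closeness : ∀ ε → 0ℚ < ε → ∃ λ M → ∀ n → M ℕ.≤ n → ∣ x n - y n ∣ ≤ ε

-- Rational sequences that are eventually at least - ε, for every ε > 0.  On
-- terms of real numbers, this is 0ℝ ≤ x and the previous relation is x ≈ y.
record EventuallyNonneg (x : ℕ → ℚ) : Set where
  constructor eventually
  field
    bound : ∀ ε → 0ℚ < ε → ∃ λ M → ∀ n → M ℕ.≤ n → 0ℚ ≤ x n + ε

open _~_
open EventuallyNonneg

≗⇒~ : ∀ {x y} → (∀ n → x n ≡ y n) → x ~ y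
≗⇒~ {x} {y} eq = close λ ε 0<ε → 0 , λ n _ → subst (λ z → ∣ z ∣ ≤ ε)
  (sym (trans (cong (_- y n) (eq n)) (ℚ.+-inverseʳ (y n)))) (ℚ.<⇒≤ 0<ε)

add-estimates : ∀ {p} q r {δ ε} → p ≡ q + r → ∣ q ∣ ≤ δ → ∣ r ∣ ≤ δ → δ + δ ≡ ε → ∣ p ∣ ≤ ε
add-estimates q r eq q≤δ r≤δ δ+δ = subst₂ _≤_ (cong ∣_∣ (sym eq)) δ+δ
  (ℚ.≤-trans (ℚ.∣p+q∣≤∣p∣+∣q∣ q r) (ℚ.+-mono-≤ q≤δ r≤δ))

~-trans : ∀ {x y z} → x ~ y → y ~ z → x ~ z
~-trans {x} {y} {z} (close p) (close q) = close estimate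
  where
  estimate : ∀ ε → 0ℚ < ε → ∃ λ M → ∀ n → M ℕ.≤ n → ∣ x n - z n ∣ ≤ ε
  estimate ε 0<ε with halve ε 0<ε
  ... | δ , 0<δ , δ+δ with p δ 0<δ | q δ 0<δ
  ... | M₁ , h₁ | M₂ , h₂ = M₁ ℕ.⊔ M₂ , λ n M≤n → add-estimates (x n - y n) (y n - z n)
    (solve 3 (λ a b c → a :- c := (a :- b) :+ (b :- c)) refl (x n) (y n) (z n))
    (h₁ n (ℕ.m⊔n≤o⇒m≤o M₁ M₂ M≤n)) (h₂ n (ℕ.m⊔n≤o⇒n≤o M₁ M₂ M≤n)) δ+δ

~-+ : ∀ {x x′ y y′} → x ~ x′ → y ~ y′ → (λ n → x n + y n) ~ (λ n → x′ n + y′ n)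
~-+ {x} {x′} {y} {y′} (close p) (close q) = close estimate
  where
  estimate : ∀ ε → 0ℚ < ε → ∃ λ M → ∀ n → M ℕ.≤ n → ∣ (x n + y n) - (x′ n + y′ n) ∣ ≤ ε
  estimate ε 0<ε with halve ε 0<ε
  ... | δ , 0<δ , δ+δ with p δ 0<δ | q δ 0<δ
  ... | M₁ , h₁ | M₂ , h₂ = M₁ ℕ.⊔ M₂ , λ n M≤n → add-estimates (x n - x′ n) (y n - y′ n)
    (solve 4 (λ a b c d → (a :+ b) :- (c :+ d) := (a :- c) :+ (b :- d)) refl (x n) (y n) (x′ n) (y′ n))
    (h₁ n (ℕ.m⊔n≤o⇒m≤o M₁ M₂ M≤n)) (h₂ n (ℕ.m⊔n≤o⇒n≤o M₁ M₂ M≤n)) δ+δ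

abstract

  eventually-bounded : ∀ c → ∃ λ B → 0ℚ < B × ∃ λ M → ∀ n → M ℕ.≤ n → ∣ seq c n ∣ ≤ B
  eventually-bounded c with cauchy c 1ℚ (ℚ.positive⁻¹ 1ℚ)
  ... | M , h = 1ℚ + ∣ seq c M ∣ , ℚ.+-mono-<-≤ (ℚ.positive⁻¹ 1ℚ) (ℚ.0≤∣p∣ (seq c M)) , M , λ n M≤n →
    subst (_≤ 1ℚ + ∣ seq c M ∣)
      (cong ∣_∣ (solve 2 (λ a b → (a :- b) :+ b := a) refl (seq c n) (seq c M)))
      (ℚ.≤-trans (ℚ.∣p+q∣≤∣p∣+∣q∣ (seq c n - seq c M) (seq c M))
        (ℚ.+-monoˡ-≤ ∣ seq c M ∣ (h n M M≤n ℕ.≤-refl)))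

~-* : ∀ c {x y} → x ~ y → (λ n → seq c n * x n) ~ (λ n → seq c n * y n)
~-* c {x} {y} (close p) = close estimate
  where
  estimate : ∀ ε → 0ℚ < ε → ∃ λ M → ∀ n → M ℕ.≤ n → ∣ seq c n * x n - seq c n * y n ∣ ≤ ε
  estimate ε 0<ε with eventually-bounded c
  ... | B , 0<B , M₁ , h₁ with scale B ε 0<B 0<ε
  ... | δ , 0<δ , Bδ≡ε with p δ 0<δ
  ... | M₂ , h₂ = M₁ ℕ.⊔ M₂ , λ n M≤n → let a = seq c n ; u = x n - y n in
    subst₂ _≤_
      (trans (sym (ℚ.∣p*q∣≡∣p∣*∣q∣ a u))
        (cong ∣_∣ (solve 3 (λ a b c → a :* (b :- c) := a :* b :- a :* c) refl a (x n) (y n))))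
      Bδ≡ε
      (ℚ.≤-trans
        (ℚ.*-monoʳ-≤-nonNeg ∣ u ∣ {{ℚ.∣-∣-nonNeg u}} (h₁ n (ℕ.m⊔n≤o⇒m≤o M₁ M₂ M≤n)))
        (ℚ.*-monoˡ-≤-nonNeg B {{ℚ.nonNegative (ℚ.<⇒≤ 0<B)}} (h₂ n (ℕ.m⊔n≤o⇒n≤o M₁ M₂ M≤n))))

~-∑ᶠ : ∀ {r} {x y : Fin r → ℕ → ℚ} → (∀ i → x i ~ y i) → (λ n → ∑ᶠ (λ i → x i n)) ~ (λ n → ∑ᶠ (λ i → y i n))
~-∑ᶠ {zero}  eq = ≗⇒~ (λ _ → refl)
~-∑ᶠ {suc r} eq = ~-+ (eq zero) (~-∑ᶠ (eq ∘ suc))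

seq-∑ : ∀ {r} (x : Fin r → ℝ) n → seq (∑ x) n ≡ ∑ᶠ (λ i → seq (x i) n)
seq-∑ {zero}  x n = refl
seq-∑ {suc r} x n = cong (λ z → seq (x zero) n + z) (seq-∑ (x ∘ suc) n)

nonneg-+ : ∀ {x y} → EventuallyNonneg x → EventuallyNonneg y → EventuallyNonneg (λ n → x n + y n)
nonneg-+ {x} {y} (eventually p) (eventually q) = eventually estimate
  where
  estimate : ∀ ε → 0ℚ < ε → ∃ λ M → ∀ n → M ℕ.≤ n → 0ℚ ≤ (x n + y n) + ε
  estimate ε 0<ε with halve ε 0<ε
  ... | δ , 0<δ , δ+δ with p δ 0<δ | q δ 0<δ
  ... | M₁ , h₁ | M₂ , h₂ = M₁ ℕ.⊔ M₂ , λ n M≤n →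
    subst (0ℚ ≤_) (trans (solve 3 (λ a b d → (a :+ d) :+ (b :+ d) := (a :+ b) :+ (d :+ d)) refl (x n) (y n) δ)
        (cong (λ z → (x n + y n) + z) δ+δ))
      (+-nonneg (h₁ n (ℕ.m⊔n≤o⇒m≤o M₁ M₂ M≤n)) (h₂ n (ℕ.m⊔n≤o⇒n≤o M₁ M₂ M≤n)))

nonneg-* : ∀ {x} q → 0ℚ ≤ q → EventuallyNonneg x → EventuallyNonneg (λ n → x n * q)
nonneg-* {x} q 0≤q (eventually p) = eventually estimate
  where
  estimate : ∀ ε → 0ℚ < ε → ∃ λ M → ∀ n → M ℕ.≤ n → 0ℚ ≤ x n * q + ε
  estimate ε 0<ε with scale (q + 1ℚ) ε (ℚ.+-mono-≤-< 0≤q (ℚ.positive⁻¹ 1ℚ)) 0<ε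
  ... | δ , 0<δ , eq with p δ 0<δ
  ... | M , h = M , λ n M≤n →
    subst (0ℚ ≤_) (trans (solve 3 (λ x q d → (x :+ d) :* q :+ d := x :* q :+ (q :+ con 1ℚ) :* d) refl (x n) q δ)
        (cong (λ z → x n * q + z) eq))
      (+-nonneg (*-nonneg (h n M≤n) 0≤q) (ℚ.<⇒≤ 0<δ))

nonneg-∑ᶠ : ∀ {r} {x : Fin r → ℕ → ℚ} → (∀ i → EventuallyNonneg (x i)) → EventuallyNonneg (λ n → ∑ᶠ (λ i → x i n))
nonneg-∑ᶠ {zero}  0≤x = eventually λ ε 0<ε → 0 , λ n _ → subst (0ℚ ≤_) (sym (ℚ.+-identityˡ ε)) (ℚ.<⇒≤ 0<ε)
nonneg-∑ᶠ {suc r} 0≤x = nonneg-+ (0≤x zero) (nonneg-∑ᶠ (0≤x ∘ suc))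

p≤∣p∣ : ∀ p → p ≤ ∣ p ∣
p≤∣p∣ p with ℚ.≤-total 0ℚ p
... | inj₁ 0≤p = ℚ.≤-reflexive (sym (ℚ.0≤p⇒∣p∣≡p 0≤p))
... | inj₂ p≤0 = ℚ.≤-trans p≤0 (ℚ.0≤∣p∣ p)

limit-≤ : ∀ {a b w} → (λ n → a + w n) ~ (λ _ → b) → EventuallyNonneg w → a ≤ b
limit-≤ {a} {b} {w} (close p) (eventually q) = ℚ.≮⇒≥ impossible
  where
  impossible : b < a → ⊥
  impossible b<a with halve (a - b) (subst (_< a - b) (ℚ.+-inverseʳ b) (ℚ.+-monoˡ-< (- b) b<a))
  ... | γ , 0<γ , γ+γ with halve γ 0<γ
  ... | δ , 0<δ , δ+δ with p δ 0<δ | q δ 0<δ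
  ... | M₁ , h₁ | M₂ , h₂ = ℚ.<-irrefl refl (begin-strict
    γ                        ≡⟨ ℚ.+-identityʳ γ ⟨
    γ + 0ℚ                   <⟨ ℚ.+-monoʳ-< γ 0<γ ⟩
    γ + γ                    ≡⟨ trans γ+γ (sym (ℚ.+-identityʳ (a - b))) ⟩
    (a - b) + 0ℚ             ≤⟨ ℚ.+-monoʳ-≤ (a - b) (h₂ n (ℕ.m≤n⊔m M₁ M₂)) ⟩
    (a - b) + (w n + δ)      ≡⟨ solve 4 (λ a b u d → (a :- b) :+ (u :+ d) := ((a :+ u) :- b) :+ d) refl a b (w n) δ ⟩
    ((a + w n) - b) + δ      ≤⟨ ℚ.+-monoˡ-≤ δ (ℚ.≤-trans (p≤∣p∣ ((a + w n) - b)) (h₁ n (ℕ.m≤m⊔n M₁ M₂))) ⟩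
    δ + δ                    ≡⟨ δ+δ ⟩
    γ                        ∎)
    where
    open ℚ.≤-Reasoning
    n = M₁ ℕ.⊔ M₂

-- Linear inequalities on dilated base polytopes

-- The coordinates of the indicator vector of B, as rational numbers.
coord : ∀ {n} → Subset n → Fin n → ℚ
coord B i = if lookup B i then 1ℚ else 0ℚ

seq-indicator : ∀ {n} (B : Subset n) i k → seq (indicator B i) k ≡ coord B i
seq-indicator B i k with lookup B i
... | true  = refl
... | false = refl

-- The value of a linear functional at t times a combination of vertices q_j, as the
-- combination of its values at t q_j.
interchange : ∀ {m r} (α : Fin m → ℚ) t (c : Fin r → ℚ) (q : Fin r → Fin m → ℚ) →
  ∑ᶠ (λ k → α k * (t * ∑ᶠ (λ j → c j * q j k))) ≡ ∑ᶠ (λ j → c j * (t * ∑ᶠ (λ k → α k * q j k)))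
interchange α t c q = begin
  ∑ᶠ (λ k → α k * (t * ∑ᶠ (λ j → c j * q j k)))
    ≡⟨ ∑ᶠ-cong (λ k → trans (sym (ℚ.*-assoc (α k) t _)) (sym (∑ᶠ-* (α k * t) (λ j → c j * q j k)))) ⟩
  ∑ᶠ (λ k → ∑ᶠ (λ j → (α k * t) * (c j * q j k)))
    ≡⟨ ∑ᶠ-swap (λ k j → (α k * t) * (c j * q j k)) ⟩
  ∑ᶠ (λ j → ∑ᶠ (λ k → (α k * t) * (c j * q j k)))
    ≡⟨ ∑ᶠ-cong (λ j → trans
         (∑ᶠ-cong (λ k → solve 4 (λ a t c q → (a :* t) :* (c :* q) := (c :* t) :* (a :* q)) refl (α k) t (c j) (q j k)))
         (trans (∑ᶠ-* (c j * t) (λ k → α k * q j k)) (ℚ.*-assoc (c j) t _))) ⟩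
  ∑ᶠ (λ j → c j * (t * ∑ᶠ (λ k → α k * q j k))) ∎
  where open ≡-Reasoning

-- A linear inequality that holds at the vertices holds on the polytope: for a convex
-- combination with coefficients c_j, add to the left-hand side t times the sum of
-- c_j (b - Q_j), where Q_j is its value at the j-th vertex; the result tends to t b.
inequality : ∀ {n m} (M : Matroid n) t (z : Vec ℤ n) (α : Fin m → ℚ) (π : Fin m → Fin n) b →
  (∀ B → IsBasis M B → ∑ᶠ (λ k → α k * coord B (π k)) ≤ b) →
  latticePoints (dilate t (basePolytope M)) z →
  ∑ᶠ (λ k → α k * int (lookup z (π k))) ≤ nat t * b
inequality M t z α π b on-bases (x , (r , v , c , vertices , 0≤c , ∑c≈1 , x≋) , z≋) =
  limit-≤ (~-trans (~-+ A~ (≗⇒~ (λ _ → refl))) (~-trans (≗⇒~ combine) tb~))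
    (nonneg-∑ᶠ (λ j → nonneg-* {seq (c j)} (nat t * (b - Q j)) (*-nonneg (0≤nat t) (gap j)) (eventually (0≤c j))))
  where
  T = nat t
  B : Fin r → Subset _
  B j = proj₁ (vertices j)
  Q : Fin r → ℚ
  Q j = ∑ᶠ (λ k → α k * coord (B j) (π k))
  gap : ∀ j → 0ℚ ≤ b - Q j
  gap j = subst (_≤ b - Q j) (ℚ.+-inverseʳ (Q j)) (ℚ.+-monoˡ-≤ (- Q j) (on-bases (B j) (proj₁ (proj₂ (vertices j)))))
  z~ : ∀ i → (λ _ → int (lookup z i)) ~ (λ n → T * ∑ᶠ (λ j → seq (c j) n * coord (B j) i))
  z~ i = ~-trans (≗⇒~ (λ _ → int-def (lookup z i))) (~-trans (close (z≋ i))
    (~-trans (≗⇒~ (λ n → cong (_* seq (x i) n) (sym (int-def (+ t))))) (~-* (fromℚ T) (~-trans (close (x≋ i))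
      (~-trans (≗⇒~ (seq-∑ (λ j → c j Real.* v j i))) (~-∑ᶠ (λ j → ~-* (c j)
        (~-trans (close (proj₂ (proj₂ (vertices j)) i)) (≗⇒~ (seq-indicator (B j) i))))))))))
  A~ : (λ _ → ∑ᶠ (λ k → α k * int (lookup z (π k)))) ~
       (λ n → ∑ᶠ (λ k → α k * (T * ∑ᶠ (λ j → seq (c j) n * coord (B j) (π k)))))
  A~ = ~-∑ᶠ (λ k → ~-* (fromℚ (α k)) (z~ (π k)))
  combine : ∀ n → ∑ᶠ (λ k → α k * (T * ∑ᶠ (λ j → seq (c j) n * coord (B j) (π k))))
                  + ∑ᶠ (λ j → seq (c j) n * (T * (b - Q j))) ≡ (T * b) * ∑ᶠ (λ j → seq (c j) n)
  combine n = begin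
    ∑ᶠ (λ k → α k * (T * ∑ᶠ (λ j → seq (c j) n * coord (B j) (π k)))) + ∑ᶠ (λ j → seq (c j) n * (T * (b - Q j)))
      ≡⟨ cong (_+ ∑ᶠ (λ j → seq (c j) n * (T * (b - Q j))))
           (interchange α T (λ j → seq (c j) n) (λ j k → coord (B j) (π k))) ⟩
    ∑ᶠ (λ j → seq (c j) n * (T * Q j)) + ∑ᶠ (λ j → seq (c j) n * (T * (b - Q j)))
      ≡⟨ ∑ᶠ-+ (λ j → seq (c j) n * (T * Q j)) (λ j → seq (c j) n * (T * (b - Q j))) ⟨
    ∑ᶠ (λ j → seq (c j) n * (T * Q j) + seq (c j) n * (T * (b - Q j)))
      ≡⟨ ∑ᶠ-cong (λ j → solve 4 (λ c t q b → c :* (t :* q) :+ c :* (t :* (b :- q)) := (t :* b) :* c) refl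
           (seq (c j) n) T (Q j) b) ⟩
    ∑ᶠ (λ j → (T * b) * seq (c j) n)
      ≡⟨ ∑ᶠ-* (T * b) (λ j → seq (c j) n) ⟩
    (T * b) * ∑ᶠ (λ j → seq (c j) n) ∎
    where open ≡-Reasoning
  tb~ : (λ n → (T * b) * ∑ᶠ (λ j → seq (c j) n)) ~ (λ _ → T * b)
  tb~ = ~-trans (~-* (fromℚ (T * b)) (~-trans (≗⇒~ (λ n → sym (seq-∑ c n))) (close ∑c≈1)))
    (≗⇒~ (λ _ → ℚ.*-identityʳ (T * b)))

coord-north : ∀ {n} (B : Subset n) i e → lookup B i ≡ isNorth e → coord B i ≡ nat (bit e)
coord-north B i N eq = trans (cong (if_then 1ℚ else 0ℚ) eq) (sym int-1)
coord-north B i E eq = trans (cong (if_then 1ℚ else 0ℚ) eq) (sym int-0)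

coord-bounds : ∀ {n} (B : Subset n) i → 0ℚ ≤ coord B i × coord B i ≤ 1ℚ
coord-bounds B i with lookup B i
... | true  = ℚ.<⇒≤ (ℚ.positive⁻¹ 1ℚ) , ℚ.≤-refl
... | false = ℚ.≤-refl , ℚ.<⇒≤ (ℚ.positive⁻¹ 1ℚ)


nat-* : ∀ m n → nat (m ℕ.* n) ≡ nat m * nat n
nat-* m n = trans (cong int (ℤ.pos-* m n)) (int-* (+ m) (+ n))

nat-cancel-≤ : ∀ {m n} → nat m ≤ nat n → m ℕ.≤ n
nat-cancel-≤ {m} {n} p = ℤ.drop‿+≤+ (int-cancel-≤ {+ m} {+ n} p)

-- The indicator of the first m indices.
inPrefix : ℕ → ∀ {n} → Fin n → ℚ
inPrefix zero    k       = 0ℚ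
inPrefix (suc m) zero    = 1ℚ
inPrefix (suc m) (suc k) = inPrefix m k

∑-inPrefix : ∀ m {n} (z : Vec ℕ n) → ∑ᶠ (λ k → inPrefix m k * nat (lookup z k)) ≡ nat (prefix m z)
∑-inPrefix zero    z        = trans (∑ᶠ-zero (λ k → 0ℚ * nat (lookup z k)) (λ k → ℚ.*-zeroˡ (nat (lookup z k)))) (sym int-0)
∑-inPrefix (suc m) []       = sym int-0
∑-inPrefix (suc m) (z ∷ zs) = trans (cong₂ _+_ (ℚ.*-identityˡ (nat z)) (∑-inPrefix m zs)) (sym (nat-+ z (prefix m zs)))

∑ᶠ-const : ∀ r q → ∑ᶠ {r} (λ _ → q) ≡ nat r * q
∑ᶠ-const zero    q = sym (trans (cong (_* q) int-0) (ℚ.*-zeroˡ q))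
∑ᶠ-const (suc r) q = trans (cong (λ y → q + y) (∑ᶠ-const r q))
  (trans (solve 2 (λ q r → q :+ r :* q := (con 1ℚ :+ r) :* q) refl q (nat r)) (cong (_* q) (sym (nat-suc r))))

-- The average of r bases lies in the base polytope; here q = 1 / r.
average∈dilate : ∀ {n r} (M : Matroid n) t (z : Vec ℤ n) (B : Fin r → Subset n) → (∀ j → IsBasis M (B j)) →
  ∀ q → 0ℚ ≤ q → ∑ᶠ {r} (λ _ → q) ≡ 1ℚ →
  (∀ i → int (lookup z i) ≡ nat t * ∑ᶠ (λ j → q * coord (B j) i)) →
  latticePoints (dilate t (basePolytope M)) z
average∈dilate {n} {r} M t z B bases q 0≤q ∑q≡1 z≡ = x , x∈P , λ i → closeness (≗⇒~ (z≡x i))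
  where
  v : Fin r → Fin n → ℝ
  v j = indicator (B j)
  c : Fin r → ℝ
  c j = fromℚ q
  x : Fin n → ℝ
  x i = ∑ (λ j → c j Real.* v j i)
  x∈P : basePolytope M x
  x∈P = r , v , c
      , (λ j → B j , bases j , λ i → closeness (≗⇒~ {seq (v j i)} (λ _ → refl)))
      , (λ j ε 0<ε → 0 , λ k _ → +-nonneg 0≤q (ℚ.<⇒≤ 0<ε))
      , closeness (≗⇒~ (λ k → trans (seq-∑ c k) ∑q≡1))
      , (λ i → closeness (≗⇒~ {seq (x i)} (λ _ → refl)))
  z≡x : ∀ i k → lookup z i ℚ./ 1 ≡ (+ t ℚ./ 1) * seq (x i) k
  z≡x i k = trans (sym (int-def (lookup z i))) (trans (z≡ i) (cong₂ _*_ (int-def (+ t))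
    (sym (trans (seq-∑ (λ j → c j Real.* v j i) k) (∑ᶠ-cong (λ j → cong (q *_) (seq-indicator (B j) i k)))))))

-- Lattice points of dilates of Schubert matroid polytopes

-- Carries a vector indexed by path positions to one indexed by the ground set of a
-- matroid isomorphic to M[U].
permute : ∀ {n} → Permutation n n → Vec ℕ n → Vec ℤ n
permute σ x = tabulate λ i → + lookup x (σ ⟨$⟩ʳ i)

permute-injective : ∀ {n} (σ : Permutation n n) {x y} → permute σ x ≡ permute σ y → x ≡ y
permute-injective σ {x} {y} eq = trans (sym (Vec.tabulate∘lookup x))
  (trans (Vec.tabulate-cong at) (Vec.tabulate∘lookup y))
  where
  at : ∀ k → lookup x k ≡ lookup y k
  at k = subst (λ k → lookup x k ≡ lookup y k) (inverseʳ σ) (ℤ.+-injective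
    (trans (sym (Vec.lookup∘tabulate _ (σ ⟨$⟩ˡ k))) (trans (cong (λ z → lookup z (σ ⟨$⟩ˡ k)) eq)
      (Vec.lookup∘tabulate _ (σ ⟨$⟩ˡ k)))))

valid⇒lattice : ∀ {n k} (M : Matroid n) (k≤n : k ℕ.≤ n) (U : LatticePath n k) (σ : Permutation n n) →
  (∀ B → IsBasis M B ⇔ pathBases (lowestPath k≤n) U (image σ B)) →
  ∀ t x → Valid t (steps U) 0 x → latticePoints (dilate t (basePolytope M)) (permute σ x)
-- The only walk is 0, which is 0 times any basis.
valid⇒lattice M k≤n U σ iso zero x v =
  average∈dilate {r = 1} M 0 (permute σ x) (λ _ → proj₁ (nonEmpty M)) (λ _ → proj₂ (nonEmpty M)) 1ℚ
    (ℚ.<⇒≤ (ℚ.positive⁻¹ 1ℚ)) (ℚ.+-identityʳ 1ℚ) λ i →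
    trans (cong int (trans (Vec.lookup∘tabulate _ i) (cong +_ (all-zero (steps U) 0 x v (σ ⟨$⟩ʳ i)))))
      (trans int-0 (sym (trans (cong (_* average i) int-0) (ℚ.*-zeroˡ (average i)))))
  where
  average : ∀ i → ℚ
  average i = ∑ᶠ {1} (λ j → 1ℚ * coord (proj₁ (nonEmpty M)) i)
  all-zero : ∀ {n} (U : Vec Step n) d x → Valid 0 U d x → ∀ i → lookup x i ≡ 0
  all-zero (e ∷ U) d (x ∷ xs) (x≤0 , _ , v) zero    = ℕ.n≤0⇒n≡0 x≤0
  all-zero (e ∷ U) d (x ∷ xs) (x≤0 , _ , v) (suc i) = all-zero U _ xs v i
valid⇒lattice {n} M k≤n U σ iso t@(suc t-1) x v =
  average∈dilate {r = t} M t (permute σ x) B bases (inv t-1) (0≤inv t-1)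
    (trans (∑ᶠ-const t (inv t-1)) (inv-inverse t-1)) λ i → begin
    int (lookup (permute σ x) i)
      ≡⟨ cong int (Vec.lookup∘tabulate _ i) ⟩
    nat (lookup x (σ ⟨$⟩ʳ i))
      ≡⟨ sample-sum t (steps U) 0 x v (σ ⟨$⟩ʳ i) ⟨
    Σ< t (β i)
      ≡⟨ ∑ᶠ-toℕ t (β i) ⟨
    ∑ᶠ {t} (β i ∘ toℕ)
      ≡⟨ ∑ᶠ-cong {t} (λ j → sym (coord-B j i)) ⟩
    ∑ᶠ {t} (λ j → coord (B j) i)
      ≡⟨ ℚ.*-identityˡ _ ⟨
    1ℚ * ∑ᶠ {t} (λ j → coord (B j) i)
      ≡⟨ cong (_* ∑ᶠ {t} (λ j → coord (B j) i)) (inv-inverse t-1) ⟨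
    (nat t * inv t-1) * ∑ᶠ {t} (λ j → coord (B j) i)
      ≡⟨ ℚ.*-assoc (nat t) (inv t-1) _ ⟩
    nat t * (inv t-1 * ∑ᶠ {t} (λ j → coord (B j) i))
      ≡⟨ cong (nat t *_) (∑ᶠ-* {t} (inv t-1) (λ j → coord (B j) i)) ⟨
    nat t * ∑ᶠ {t} (λ j → inv t-1 * coord (B j) i) ∎
  where
  open ≡-Reasoning
  P : ℕ → Vec Step n
  P s = sample t s (steps U) 0 x
  β : Fin n → ℕ → ℚ
  β i s = nat (bit (lookup (P s) (σ ⟨$⟩ʳ i)))
  B : Fin t → Subset n
  B j = tabulate λ i → lookup (Vec.map isNorth (P (toℕ j))) (σ ⟨$⟩ʳ i)
  coord-B : ∀ j i → coord (B j) i ≡ β i (toℕ j)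
  coord-B j i = coord-north (B j) i (lookup (P (toℕ j)) (σ ⟨$⟩ʳ i))
    (trans (Vec.lookup∘tabulate _ i) (Vec.lookup-map (σ ⟨$⟩ʳ i) isNorth (P (toℕ j))))
  image-B : ∀ j → image σ (B j) ≡ Vec.map isNorth (P (toℕ j))
  image-B j = trans (Vec.tabulate-cong (λ k → trans (Vec.lookup∘tabulate _ (σ ⟨$⟩ˡ k))
    (cong (lookup (Vec.map isNorth (P (toℕ j)))) (inverseʳ σ)))) (Vec.tabulate∘lookup _)
  valid-P : ∀ j → Valid 1 (steps U) 0 (bits (P (toℕ j)))
  valid-P j = subst (λ d → Valid 1 (steps U) d (bits (P (toℕ j)))) (ℕ.m<n⇒m/n≡0 (Fin.toℕ<n j))
    (sample-valid t (toℕ j) (Fin.toℕ<n j) (steps U) 0 x v)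

  bases : ∀ j → IsBasis M (B j)
  bases j = Equivalence.from (iso (B j)) (subst (pathBases (lowestPath k≤n) U) (sym (image-B j))
    (valid⇒basis k≤n U (P (toℕ j)) (valid-P j)))

lattice⇒valid : ∀ {n k} (M : Matroid n) (k≤n : k ℕ.≤ n) (U : LatticePath n k) (σ : Permutation n n) →
  (∀ B → IsBasis M B ⇔ pathBases (lowestPath k≤n) U (image σ B)) →
  ∀ t z → latticePoints (dilate t (basePolytope M)) z → ∃ λ x → z ≡ permute σ x × Valid t (steps U) 0 x
lattice⇒valid {n} {k} M k≤n U σ iso t z z∈ = x , z≡ , prefix⇒valid t (steps U) 0 x x≤t below balanced
  where
  open ℚ.≤-Reasoning
  T = nat t
  x : Vec ℕ n
  x = tabulate λ k → ℤ.∣ lookup z (σ ⟨$⟩ˡ k) ∣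

  single : ∀ a i b → (∀ B → IsBasis M B → a * coord B i ≤ b) → a * int (lookup z i) ≤ T * b
  single a i b on-bases = subst (_≤ T * b) (ℚ.+-identityʳ (a * int (lookup z i)))
    (inequality {m = 1} M t z (λ _ → a) (λ _ → i) b
      (λ B B∈ → subst (_≤ b) (sym (ℚ.+-identityʳ (a * coord B i))) (on-bases B B∈)) z∈)

  z≥0 : ∀ i → + 0 ℤ.≤ lookup z i
  z≥0 i = int-cancel-≤ (begin
    int (+ 0)                                          ≡⟨ int-0 ⟩
    0ℚ                                                 ≡⟨ ℚ.+-inverseˡ (int (lookup z i)) ⟨
    - int (lookup z i) + int (lookup z i)
      ≤⟨ ℚ.+-monoˡ-≤ (int (lookup z i)) (subst₂ _≤_
           (solve 1 (λ y → con (- 1ℚ) :* y := :- y) refl (int (lookup z i))) (ℚ.*-zeroʳ T)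
           (single (- 1ℚ) i 0ℚ λ B _ → subst₂ _≤_
             (solve 1 (λ y → :- y := con (- 1ℚ) :* y) refl (coord B i)) refl
             (ℚ.neg-antimono-≤ (proj₁ (coord-bounds B i))))) ⟩
    0ℚ + int (lookup z i)                              ≡⟨ ℚ.+-identityˡ (int (lookup z i)) ⟩
    int (lookup z i)                                   ∎)

  nat-x : ∀ k → nat (lookup x k) ≡ int (lookup z (σ ⟨$⟩ˡ k))
  nat-x k = cong int (trans (cong +_ (Vec.lookup∘tabulate _ k)) (ℤ.0≤i⇒+∣i∣≡i (z≥0 (σ ⟨$⟩ˡ k))))

  z≡ : z ≡ permute σ x
  z≡ = trans (sym (Vec.tabulate∘lookup z)) (Vec.tabulate-cong λ i → sym (trans
    (cong +_ (Vec.lookup∘tabulate _ (σ ⟨$⟩ʳ i)))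
    (trans (ℤ.0≤i⇒+∣i∣≡i (z≥0 _)) (cong (lookup z) (inverseˡ σ)))))

  x≤t : ∀ k → lookup x k ℕ.≤ t
  x≤t k = nat-cancel-≤ (begin
    nat (lookup x k)                    ≡⟨ nat-x k ⟩
    int (lookup z (σ ⟨$⟩ˡ k))           ≡⟨ ℚ.*-identityˡ (int (lookup z (σ ⟨$⟩ˡ k))) ⟨
    1ℚ * int (lookup z (σ ⟨$⟩ˡ k))
      ≤⟨ single 1ℚ (σ ⟨$⟩ˡ k) 1ℚ (λ B _ → subst (_≤ 1ℚ) (sym (ℚ.*-identityˡ (coord B (σ ⟨$⟩ˡ k)))) (proj₂ (coord-bounds B (σ ⟨$⟩ˡ k)))) ⟩
    T * 1ℚ                              ≡⟨ ℚ.*-identityʳ T ⟩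
    T                                   ∎)

  path-of : ∀ B → IsBasis M B → pathBases (lowestPath k≤n) U (image σ B)
  path-of B = Equivalence.to (iso B)

  basis-prefix : ∀ m B (B∈ : IsBasis M B) →
    ∑ᶠ (λ k → inPrefix m k * coord B (σ ⟨$⟩ˡ k)) ≡ nat (prefix m (bits (steps (proj₁ (path-of B B∈)))))
  basis-prefix m B B∈ = trans (∑ᶠ-cong (λ k → cong (inPrefix m k *_) (coord≡ k))) (∑-inPrefix m (bits (steps P)))
    where
    P = proj₁ (path-of B B∈)
    coord≡ : ∀ k → coord B (σ ⟨$⟩ˡ k) ≡ nat (lookup (bits (steps P)) k)
    coord≡ k = trans (coord-north B (σ ⟨$⟩ˡ k) (lookup (steps P) k)
      (trans (sym (Vec.lookup∘tabulate _ k)) (trans (cong (λ S → lookup S k) (sym (proj₂ (proj₂ (proj₂ (path-of B B∈))))))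
        (Vec.lookup-map k isNorth (steps P))))) (cong nat (sym (Vec.lookup-map k bit (steps P))))

  x-prefix : ∀ m → ∑ᶠ (λ k → inPrefix m k * int (lookup z (σ ⟨$⟩ˡ k))) ≡ nat (prefix m x)
  x-prefix m = trans (∑ᶠ-cong (λ k → cong (inPrefix m k *_) (sym (nat-x k)))) (∑-inPrefix m x)

  below : ∀ m → m ℕ.≤ n → prefix m x ℕ.≤ t ℕ.* prefix m (bits (steps U))
  below m m≤n = nat-cancel-≤ (begin
    nat (prefix m x)
      ≡⟨ x-prefix m ⟨
    ∑ᶠ (λ k → inPrefix m k * int (lookup z (σ ⟨$⟩ˡ k)))
      ≤⟨ inequality M t z (inPrefix m) (σ ⟨$⟩ˡ_) (nat (prefix m (bits (steps U)))) (λ B B∈ →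
           subst (_≤ nat (prefix m (bits (steps U)))) (sym (basis-prefix m B B∈))
             (nat-mono-≤ (below⇒prefix (proj₁ (path-of B B∈)) U (proj₁ (proj₂ (proj₂ (path-of B B∈)))) m m≤n))) z∈ ⟩
    T * nat (prefix m (bits (steps U)))
      ≡⟨ nat-* t (prefix m (bits (steps U))) ⟨
    nat (t ℕ.* prefix m (bits (steps U))) ∎)
    where
    nat-mono-≤ : ∀ {a b} → a ℕ.≤ b → nat a ≤ nat b
    nat-mono-≤ a≤b = int-mono-≤ (ℤ.+≤+ a≤b)

  negate-∑ : ∀ (f : Fin n → ℚ) → ∑ᶠ (λ k → (- inPrefix n k) * f k) ≡ - ∑ᶠ (λ k → inPrefix n k * f k)
  negate-∑ f = trans (∑ᶠ-cong (λ k → solve 2 (λ a b → :- a :* b := con (- 1ℚ) :* (a :* b)) refl (inPrefix n k) (f k)))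
    (trans (∑ᶠ-* (- 1ℚ) (λ k → inPrefix n k * f k))
      (solve 1 (λ y → con (- 1ℚ) :* y := :- y) refl (∑ᶠ (λ k → inPrefix n k * f k))))

  neg-cancel-≤ : ∀ {p q} → - p ≤ - q → q ≤ p
  neg-cancel-≤ {p} {q} -p≤-q = subst₂ _≤_ (neg-neg q) (neg-neg p) (ℚ.neg-antimono-≤ -p≤-q)
    where
    neg-neg : ∀ y → - (- y) ≡ y
    neg-neg y = solve 1 (λ y → :- (:- y) := y) refl y

  -- The inequality for the negated sum of all coordinates.
  above : t ℕ.* prefix n (bits (steps U)) ℕ.≤ prefix n x
  above = nat-cancel-≤ (neg-cancel-≤ (begin
    - nat (prefix n x)
      ≡⟨ trans (negate-∑ (λ k → int (lookup z (σ ⟨$⟩ˡ k)))) (cong -_ (x-prefix n)) ⟨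
    ∑ᶠ (λ k → (- inPrefix n k) * int (lookup z (σ ⟨$⟩ˡ k)))
      ≤⟨ inequality M t z (λ k → - inPrefix n k) (σ ⟨$⟩ˡ_) (- nat (prefix n (bits (steps U)))) (λ B B∈ →
           ℚ.≤-reflexive (trans (negate-∑ (λ k → coord B (σ ⟨$⟩ˡ k))) (cong -_ (trans (basis-prefix n B B∈)
             (cong nat (trans (path-norths (proj₁ (path-of B B∈))) (sym (path-norths U)))))))) z∈ ⟩
    T * (- nat (prefix n (bits (steps U))))
      ≡⟨ solve 2 (λ a b → a :* (:- b) := :- (a :* b)) refl T (nat (prefix n (bits (steps U)))) ⟩
    - (T * nat (prefix n (bits (steps U))))
      ≡⟨ cong -_ (nat-* t (prefix n (bits (steps U)))) ⟨
    - nat (t ℕ.* prefix n (bits (steps U))) ∎))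

  balanced : prefix n x ≡ t ℕ.* prefix n (bits (steps U))
  balanced = ℕ.≤-antisym (below n ℕ.≤-refl) above

mainTheorem2 : ∀ (n : ℕ) (M : Matroid n) → IsSchubert M → EhrhartPositive (basePolytope M)
mainTheorem2 n M (k , k≤n , U , σ , iso) = ehrhart (steps U) , counts , nonNeg-total (states (steps U) 0)
  where
  counts : IsEhrhartPolynomial (basePolytope M) (ehrhart (steps U))
  counts t = List.length points , (List.map (permute σ) points
      , Unique.map⁺ (permute-injective σ) (walks-unique t (steps U) 0)
      , (λ z → mk⇔ (to z) (from z))
      , List.length-map (permute σ) points)
    , eval-ehrhart t (steps U)
    where
    points : List (Vec ℕ n)
    points = walks t (steps U) 0
    to : ∀ z → z ∈ List.map (permute σ) points → latticePoints (dilate t (basePolytope M)) z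
    to z z∈ = let x , x∈ , z≡ = List.∈-map⁻ (permute σ) z∈ in
      subst (latticePoints (dilate t (basePolytope M))) (sym z≡)
        (valid⇒lattice M k≤n U σ iso t x (∈⇒valid t (steps U) 0 x x∈))
    from : ∀ z → latticePoints (dilate t (basePolytope M)) z → z ∈ List.map (permute σ) points
    from z z∈ = let x , z≡ , v = lattice⇒valid M k≤n U σ iso t z z∈ in
      subst (_∈ List.map (permute σ) points) (sym z≡) (List.∈-map⁺ (permute σ) (valid⇒∈ t (steps U) 0 x v))
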